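{- Let $q$ be an odd prime power and let $\mathcal C$ be an irreducible conic of $\mathrm{PG}(2,q^2)$ which is not defined over $\mathbb F_q$ and contains at least one point of $\mathrm{PG}(2,q)$. Then: (i) if $q=3$, $E_q(\mathcal C)\in\{3,4,5,6,7,8,9\}$; (ii) if $q=5$, $E_q(\mathcal C)\in\{11,12,14,15,16,17,19,20,21,22,25\}$; (iii) if $q>5$, then $E_q(\mathcal C)=\frac12\bigl(q^2+(\alpha-1)q-n_0\bigr)$ for some $n_0\in\{0,1,2,3\}$ and $\alpha\in\{1,2,3,4,5,7\}$ with $\alpha-n_0$ even.
   Context: $\mathrm{PG}(2,q)$ is canonically embedded in $\mathrm{PG}(2,q^2)$. With respect to an irreducible conic $\mathcal C$ of $\mathrm{PG}(2,q^2)$, $q$ odd, a point not on $\mathcal C$ is external if it lies on two tangent lines to $\mathcal C$. $E_q(\mathcal C)$ denotes the number of points of $\mathrm{PG}(2,q)$ that are external to $\mathcal C$. A conic is defined over $\mathbb F_q$ if it has an equation with coefficients in $\mathbb F_q$. -}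

module Defs where

open import Level using (0ℓ)
open import Data.Nat using (ℕ; zero; suc)
open import Data.Product using (Σ; ∃; ∃-syntax; _×_; _,_)
open import Data.List using (List; length)
open import Data.List.Relation.Unary.All using (All)
open import Data.List.Relation.Unary.Any using (Any)
open import Data.List.Relation.Unary.AllPairs using (AllPairs)
open import Data.List.Relation.Unary.Unique.Propositional using (Unique)
open import Data.List.Membership.Propositional using (_∈_)
open import Relation.Nullary using (¬_)
open import Relation.Binary.PropositionalEquality using (_≡_; _≢_)
open import Algebra.Structures using (IsCommutativeRing)

record FiniteField : Set₁ where
  infixl 6 _+_ _-_
  infixl 7 _*_
  field
    Carrier : Set
    _+_ _*_ : Carrier → Carrier → Carrier
    -_      : Carrier → Carrier
    0# 1#   : Carrier
    isCommutativeRing : IsCommutativeRing _≡_ _+_ _*_ -_ 0# 1#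
    0≢1     : 0# ≢ 1#
    inverse : ∀ x → x ≢ 0# → ∃[ y ] (x * y ≡ 1#)
    elements : List Carrier
    elements-unique   : Unique elements
    elements-complete : ∀ x → x ∈ elements

  _-_ : Carrier → Carrier → Carrier
  x - y = x + (- y)

  size : ℕ
  size = length elements

-- Projective geometry PG(2,K) for a finite field K, with the subfield
-- F_q = { x ∈ K | x^q = x } (for |K| = q², this is the subfield of order q).
module Geometry (K : FiniteField) where
  open FiniteField K

  Triple : Set
  Triple = Carrier × Carrier × Carrier

  zero3 : Triple
  zero3 = 0# , 0# , 0#

  NonZero3 : Triple → Set
  NonZero3 t = ¬ (t ≡ zero3)

  scale : Carrier → Triple → Triple
  scale λ' (x , y , z) = λ' * x , λ' * y , λ' * z

  _∼_ : Triple → Triple → Set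
  P ∼ Q = ∃[ λ' ] (λ' ≢ 0# × Q ≡ scale λ' P)

  OnLine : Triple → Triple → Set
  OnLine (u , v , w) (x , y , z) = u * x + v * y + w * z ≡ 0#

  two : Carrier
  two = 1# + 1#

  record Conic : Set where
    constructor conic
    field a b c d e f : Carrier

  quadForm : Conic → Triple → Carrier
  quadForm (conic a b c d e f) (x , y , z) =
    a * x * x + b * y * y + c * z * z + d * x * y + e * x * z + f * y * z

  -- determinant of the symmetric matrix [[2a,d,e],[d,2b,f],[e,f,2c]]
  -- (twice the Gram matrix of the quadratic form)
  det : Conic → Carrier
  det (conic a b c d e f) =
    two * a * (two * b * (two * c) - f * f)
    - d * (d * (two * c) - f * e)
    + e * (d * f - two * b * e)

  -- irreducible (non-degenerate) conic, odd characteristic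
  Irreducible : Conic → Set
  Irreducible C = det C ≢ 0#

  OnConic : Conic → Triple → Set
  OnConic C P = quadForm C P ≡ 0#

  Tangent : Conic → Triple → Set
  Tangent C ℓ = NonZero3 ℓ × ∃[ X ] (NonZero3 X × OnConic C X × OnLine ℓ X ×
                 (∀ Y → NonZero3 Y → OnConic C Y → OnLine ℓ Y → X ∼ Y))

  External : Conic → Triple → Set
  External C P = NonZero3 P × ¬ OnConic C P ×
    ∃[ ℓ₁ ] ∃[ ℓ₂ ] (Tangent C ℓ₁ × Tangent C ℓ₂ × ¬ (ℓ₁ ∼ ℓ₂) × OnLine ℓ₁ P × OnLine ℓ₂ P)

  _^_ : Carrier → ℕ → Carrier
  x ^ zero  = 1#
  x ^ suc n = x * (x ^ n)

  module SubGeometry (q : ℕ) where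

    InFq : Carrier → Set
    InFq x = x ^ q ≡ x

    FqPoint : Triple → Set
    FqPoint (x , y , z) = NonZero3 (x , y , z) × InFq x × InFq y × InFq z

    DefinedOverFq : Conic → Set
    DefinedOverFq (conic a b c d e f) = ∃[ λ' ] (λ' ≢ 0# ×
      InFq (λ' * a) × InFq (λ' * b) × InFq (λ' * c) ×
      InFq (λ' * d) × InFq (λ' * e) × InFq (λ' * f))

    ContainsFqPoint : Conic → Set
    ContainsFqPoint C = ∃[ P ] (FqPoint P × OnConic C P)

    ExtCount : Conic → ℕ → Set
    ExtCount C m = ∃[ L ] (All (λ P → FqPoint P × External C P) L ×
      AllPairs (λ P Q → ¬ (P ∼ Q)) L ×
      (∀ P → FqPoint P → External C P → Any (P ∼_) L) ×
      length L ≡ m)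

{-# OPTIONS --safe #-}
module Submission where

-- A point P off the conic Q = 0 is external exactly when -2 det(Q) Q(P) is a square of K, and every element of the
-- subfield F of order q is such a square.  Take an F-point W on the conic and an F-basis U, V, W.  On the lines through
-- W the form is Q(x U + y V + z W) = g(x, y) + z l(x, y), so for fixed (x : y) one counts the z in F for which a
-- multiple of z + g/l is a square.  If g/l is not in F, the classes of z + g/l modulo F* are all classes but the trivial
-- one, which fixes the count; if g/l is in F, the line contains a further F-point of the conic and all z but one behave
-- alike.  The main terms add up because l takes every class once (or, if the tangent at W is an F-line, because l is
-- constant up to F).  The remaining terms depend only on the at most three further base points and on the quadratic
-- characters of their l.  Moving base points to U and V shows that with three such points the product of the signs
-- is 1, and with two that one of them is 1, unless the tangent at W is an F-line, when all of them agree.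

open import Algebra.Bundles using (CommutativeRing; CommutativeMonoid)
open import Algebra.Solver.Ring.AlmostCommutativeRing using (fromCommutativeRing; _-Raw-AlmostCommutative⟶_)
open import Algebra.Structures using (IsCommutativeMonoid)
open import Data.Fin using (zero; suc; toℕ; fromℕ)
import Data.Fin.Properties as Finₚ
open import Data.Integer as ℤ using (ℤ; -[1+_]; 0ℤ; 1ℤ; -1ℤ)
import Data.Integer.Properties as ℤₚ
import Data.Integer.Solver as ℤSolver
open import Data.List using (List; []; _∷_; _++_; length; map; filter; foldr; cartesianProductWith; lookup; cartesianProduct)
import Data.List.Membership.DecPropositional as DecMembership
open import Data.List.Membership.Propositional using (_∈_; _∉_; lose; find)
open import Data.List.Membership.Propositional.Properties
  using (∈-filter⁺; ∈-filter⁻; ∈-map⁺; ∈-map⁻; ∈-++⁺ˡ; ∈-++⁺ʳ; ∈-++⁻; ∈-cartesianProduct⁻; ∈-cartesianProductWith⁺; ∈-cartesianProductWith⁻)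
open import Data.List.Membership.Propositional.Properties.WithK using (unique∧set⇒bag)
open import Data.List.Properties using (length-map; length-++)
open import Data.List.Relation.Binary.BagAndSetEquality using (∼bag⇒↭)
open import Data.List.Relation.Binary.Permutation.Propositional using (_↭_; ↭⇒↭ₛ)
import Data.List.Relation.Binary.Permutation.Propositional.Properties as ↭ₚ
import Data.List.Relation.Binary.Permutation.Setoid.Properties as ↭ₛ
open import Data.List.Relation.Unary.All as All using (All; []; _∷_)
open import Data.List.Relation.Unary.All.Properties using (all-filter)
import Data.List.Relation.Unary.All.Properties as Allₚ
open import Data.List.Relation.Unary.AllPairs as AllPairs using ([]; _∷_; AllPairs)
import Data.List.Relation.Unary.AllPairs.Properties as AllPairsₚ
open import Data.List.Relation.Unary.Any as Any using (here; there; Any)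
open import Data.List.Relation.Unary.Any.Properties using (lookup-index)
import Data.List.Relation.Unary.Any.Properties as Anyₚ
open import Data.List.Relation.Unary.Unique.Propositional using (Unique)
import Data.List.Relation.Unary.Unique.Propositional.Properties as Uniqueₚ
open import Data.Maybe using (Maybe; just; nothing)
open import Data.Nat as ℕ using (ℕ; zero; suc; z≤n; s≤s)
open import Data.Nat.Base using (_!)
open import Data.Nat.Combinatorics using (nCn≡1; nCk≡n!/k![n-k]!; k![n∸k]!∣n!) renaming (_C_ to _choose_)
import Data.Nat.DivMod as ℕ/
import Data.Nat.Divisibility as ℕ∣
open import Data.Nat.Primality using (Prime; euclidsLemma; prime⇒nonZero; prime⇒nonTrivial; prime⇒irreducible)
open import Data.Nat.Properties using (_!*_!≢0)
import Data.Nat.Properties as ℕₚ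
import Data.Nat.Solver as ℕSolver
open import Data.Product using (_,_; _×_; proj₁; proj₂; ∃; ∃-syntax)
open import Data.Sum using (inj₁; inj₂; _⊎_)
open import Data.Vec.Functional using (tail; init; last)
open import Defs
open import Function using (_∘_; mk⇔)
open import Level using (0ℓ)
open import Relation.Binary.Definitions using (DecidableEquality)
open import Relation.Binary.PropositionalEquality
open import Relation.Nullary using (yes; no; ¬_; Dec; ¬?; contradiction)

-- The name "base point" comes from writing Q = Q₁ + ω Q₂, with Q₁, Q₂ over F and 1, ω an F-basis of
-- K: the F-points of the conic are the F-points common to Q₁ = 0 and Q₂ = 0, the base points of a
-- pencil. The number n₀ counts those other than W. Counting squares among the values of a ternary
-- form would in general give only an estimate. An F-point W on the conic makes Q linear in z, and
-- then every sum is exact, because χ sums to -1 over the F-translates of an element outside F. The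
-- sign attached to a line is χ(γ l), where γ agrees with -2 det(Q) up to squares and is the value
-- of g at the zero of l. If U, V and W all lie on the conic and h, e, f are the coefficients of x
-- y, x z, y z, then γ = -h e f, and the signs of the three possible further base points are χ(h e),
-- χ(h f), χ(e f); this is the source of the relation between them. Two degenerations shape the case
-- distinction. If the tangent at W is an F-line, the characters of l add up instead of cancelling.
-- If a base point is absorbed by U or V, the tangent there is an F-line, and this forces one of the
-- two remaining signs to be 1.

-- Ring solver with integer coefficients for an abstract finite field

module RingTheory (K : FiniteField) where
  open FiniteField K public

  commutativeRing : CommutativeRing 0ℓ 0ℓ
  commutativeRing = record { isCommutativeRing = isCommutativeRing }

  open CommutativeRing commutativeRing public
    using (semiring; ring; commutativeSemiring; +-assoc; +-comm; +-identityˡ; +-identityʳ; *-assoc; *-comm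
          ; *-identityˡ; *-identityʳ; distribˡ; distribʳ; zeroˡ; zeroʳ; -‿inverseˡ; -‿inverseʳ)
  open import Algebra.Properties.Ring ring public
    using (-‿distribˡ-*; -‿distribʳ-*; -‿involutive; -0#≈0#; -‿+-comm)
  open import Algebra.Properties.Semiring.Mult.TCOptimised semiring using (×1-homo-*; 1+×) renaming (_×_ to _·_)
  open import Algebra.Properties.Monoid.Mult.TCOptimised (CommutativeRing.+-monoid commutativeRing) using (×-homo-+)

  private
    -- Taking coefficients in ℤ lets the solver cancel them by computation, without deciding
    -- equality in the abstract carrier. With this form of multiples, 1 and 2 go to `1#` and
    -- `1# + 1#` definitionally, so that `con (ℤ.+ 2)` can stand for `two`.
    ⟦_⟧ : ℤ → Carrier
    ⟦ ℤ.+ n ⟧ = n · 1#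
    ⟦ -[1+ n ] ⟧ = - (suc n · 1#)

    open ≡-Reasoning

    negate-hom : ∀ i → ⟦ ℤ.- i ⟧ ≡ - ⟦ i ⟧
    negate-hom (ℤ.+ zero) = sym -0#≈0#
    negate-hom (ℤ.+ suc n) = refl
    negate-hom -[1+ n ] = sym (-‿involutive _)

    cancel-1 : ∀ a b → (1# + a) + - (1# + b) ≡ a + - b
    cancel-1 a b = begin
      (1# + a) + - (1# + b)       ≡⟨ cong₂ _+_ (+-comm 1# a) (sym (-‿+-comm 1# b)) ⟩
      (a + 1#) + (- 1# + - b)     ≡⟨ +-assoc a 1# _ ⟩
      a + (1# + (- 1# + - b))     ≡⟨ cong (_+_ a) (sym (+-assoc 1# _ _)) ⟩
      a + ((1# + - 1#) + - b)     ≡⟨ cong (λ t → a + (t + - b)) (-‿inverseʳ 1#) ⟩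
      a + (0# + - b)              ≡⟨ cong (_+_ a) (+-identityˡ _) ⟩
      a + - b ∎

    ⊖-hom : ∀ m n → ⟦ m ℤ.⊖ n ⟧ ≡ m · 1# + - (n · 1#)
    ⊖-hom m zero = sym (trans (cong (_+_ _) -0#≈0#) (+-identityʳ _))
    ⊖-hom zero (suc n) = sym (+-identityˡ _)
    ⊖-hom (suc m) (suc n) = begin
      ⟦ suc m ℤ.⊖ suc n ⟧                     ≡⟨ cong ⟦_⟧ (ℤₚ.[1+m]⊖[1+n]≡m⊖n m n) ⟩
      ⟦ m ℤ.⊖ n ⟧                             ≡⟨ ⊖-hom m n ⟩
      m · 1# + - (n · 1#)                     ≡⟨ sym (cancel-1 _ _) ⟩
      (1# + m · 1#) + - (1# + n · 1#)         ≡⟨ cong₂ (λ s t → s + - t) (sym (1+× m 1#)) (sym (1+× n 1#)) ⟩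
      suc m · 1# + - (suc n · 1#) ∎

    +-hom : ∀ i j → ⟦ i ℤ.+ j ⟧ ≡ ⟦ i ⟧ + ⟦ j ⟧
    +-hom (ℤ.+ m) (ℤ.+ n) = ×-homo-+ 1# m n
    +-hom (ℤ.+ m) -[1+ n ] = ⊖-hom m (suc n)
    +-hom -[1+ m ] (ℤ.+ n) = trans (⊖-hom n (suc m)) (+-comm _ _)
    +-hom -[1+ m ] -[1+ n ] = trans (cong (λ t → - (t · 1#)) (cong suc (sym (ℕₚ.+-suc m n))))
      (trans (cong -_ (×-homo-+ 1# (suc m) (suc n))) (sym (-‿+-comm _ _)))

    *-hom-nat : ∀ m j → ⟦ (ℤ.+ m) ℤ.* j ⟧ ≡ m · 1# * ⟦ j ⟧
    *-hom-nat m (ℤ.+ n) = trans (cong ⟦_⟧ (sym (ℤₚ.pos-* m n))) (×1-homo-* m n)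
    *-hom-nat m -[1+ n ] = begin
      ⟦ ℤ.+ m ℤ.* ℤ.- (ℤ.+ suc n) ⟧        ≡⟨ cong ⟦_⟧ (sym (ℤₚ.neg-distribʳ-* (ℤ.+ m) (ℤ.+ suc n))) ⟩
      ⟦ ℤ.- (ℤ.+ m ℤ.* ℤ.+ suc n) ⟧        ≡⟨ negate-hom (ℤ.+ m ℤ.* ℤ.+ suc n) ⟩
      - ⟦ ℤ.+ m ℤ.* ℤ.+ suc n ⟧            ≡⟨ cong -_ (*-hom-nat m (ℤ.+ suc n)) ⟩
      - (m · 1# * (suc n · 1#))        ≡⟨ -‿distribʳ-* _ _ ⟩
      m · 1# * - (suc n · 1#) ∎

    *-hom : ∀ i j → ⟦ i ℤ.* j ⟧ ≡ ⟦ i ⟧ * ⟦ j ⟧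
    *-hom (ℤ.+ m) j = *-hom-nat m j
    *-hom -[1+ m ] j = begin
      ⟦ ℤ.- (ℤ.+ suc m) ℤ.* j ⟧        ≡⟨ cong ⟦_⟧ (sym (ℤₚ.neg-distribˡ-* (ℤ.+ suc m) j)) ⟩
      ⟦ ℤ.- (ℤ.+ suc m ℤ.* j) ⟧        ≡⟨ negate-hom (ℤ.+ suc m ℤ.* j) ⟩
      - ⟦ ℤ.+ suc m ℤ.* j ⟧            ≡⟨ cong -_ (*-hom-nat (suc m) j) ⟩
      - (suc m · 1# * ⟦ j ⟧)         ≡⟨ -‿distribˡ-* _ _ ⟩
      - (suc m · 1#) * ⟦ j ⟧ ∎

    homomorphism : CommutativeRing.rawRing ℤₚ.+-*-commutativeRing
                     -Raw-AlmostCommutative⟶ fromCommutativeRing commutativeRing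
    homomorphism = record
      { ⟦_⟧ = ⟦_⟧ ; +-homo = +-hom ; *-homo = *-hom ; -‿homo = negate-hom ; 0-homo = refl ; 1-homo = refl }

    coefficient≟ : ∀ i j → Maybe (⟦ i ⟧ ≡ ⟦ j ⟧)
    coefficient≟ i j with i ℤ.≟ j
    ... | yes refl = just refl
    ... | no _ = nothing

  open import Algebra.Solver.Ring _ (fromCommutativeRing commutativeRing) homomorphism coefficient≟ public
    using (Polynomial; con; _:+_; _:*_; _:-_; :-_; _:=_; solve)

-- Counting with duplicate-free lists, and integer sums over lists

module ℤS = ℤSolver.+-*-Solver

module _ {A : Set} where

  -- In a list without duplicates an element has only one membership proof, so equality as sets is
  -- already equality as bags.
  unique⇒↭ : ∀ {xs ys : List A} → Unique xs → Unique ys →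
             (∀ {x} → x ∈ xs → x ∈ ys) → (∀ {x} → x ∈ ys → x ∈ xs) → xs ↭ ys
  unique⇒↭ uxs uys to from = ∼bag⇒↭ (unique∧set⇒bag uxs uys (mk⇔ to from))

  length-filter-split : ∀ {P : A → Set} (P? : ∀ x → Dec (P x)) xs →
    length xs ≡ length (filter P? xs) ℕ.+ length (filter (¬? ∘ P?) xs)
  length-filter-split P? [] = refl
  length-filter-split P? (x ∷ xs) with P? x
  ... | yes _ = cong suc (length-filter-split P? xs)
  ... | no _ = trans (cong suc (length-filter-split P? xs)) (sym (ℕₚ.+-suc _ _))

  -- Induction on the codomain, splitting off one fibre at a time. It serves to bound images from
  -- below: the image of the trace and the set of squares.
  length≤-fibres : ∀ {B : Set} (_≟_ : DecidableEquality B) (f : A → B) (c : ℕ) (ys : List B) (xs : List A) →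
    Unique xs → (∀ {x} → x ∈ xs → f x ∈ ys) →
    (∀ y zs → Unique zs → All (λ z → f z ≡ y) zs → length zs ℕ.≤ c) →
    length xs ℕ.≤ length ys ℕ.* c
  length≤-fibres _≟_ f c [] [] uxs into fibre = z≤n
  length≤-fibres _≟_ f c [] (x ∷ xs) uxs into fibre with () ← into (here refl)
  length≤-fibres _≟_ f c (y ∷ ys) xs uxs into fibre =
    subst (ℕ._≤ c ℕ.+ length ys ℕ.* c) (sym (length-filter-split (λ x → f x ≟ y) xs))
      (ℕₚ.+-mono-≤
        (fibre y _ (Uniqueₚ.filter⁺ _ uxs) (all-filter (λ x → f x ≟ y) xs))
        (length≤-fibres _≟_ f c ys _ (Uniqueₚ.filter⁺ _ uxs) into′ fibre))
    where
    into′ : ∀ {x} → x ∈ filter (¬? ∘ (λ x → f x ≟ y)) xs → f x ∈ ys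
    into′ x∈ with ∈-filter⁻ (¬? ∘ (λ x → f x ≟ y)) {xs = xs} x∈
    ... | x∈xs , fx≢y with into x∈xs
    ... | here fx≡y = contradiction fx≡y fx≢y
    ... | there fx∈ys = fx∈ys

  module _ (_≟_ : DecidableEquality A) where

    unique-⊆⇒length≤ : ∀ {xs ys : List A} → Unique xs → (∀ {x} → x ∈ xs → x ∈ ys) → length xs ℕ.≤ length ys
    unique-⊆⇒length≤ {xs} {ys} uxs sub =
      subst (length xs ℕ.≤_) (ℕₚ.*-identityʳ _) (length≤-fibres _≟_ (λ x → x) 1 ys xs uxs sub fibre)
      where
      fibre : ∀ y zs → Unique zs → All (λ z → z ≡ y) zs → length zs ℕ.≤ 1
      fibre y [] _ _ = z≤n
      fibre y (z ∷ []) _ _ = s≤s z≤n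
      fibre y (z ∷ z′ ∷ zs) ((z≢z′ ∷ _) ∷ _) (p ∷ p′ ∷ _) = contradiction (trans p (sym p′)) z≢z′

    unique-⊆⇒⊇ : ∀ {xs ys : List A} → Unique xs → (∀ {x} → x ∈ xs → x ∈ ys) → length ys ℕ.≤ length xs →
                 ∀ {y} → y ∈ ys → y ∈ xs
    unique-⊆⇒⊇ {xs} {ys} uxs sub le {y} y∈ys with DecMembership._∈?_ _≟_ y xs
    ... | yes y∈xs = y∈xs
    ... | no y∉xs = contradiction (ℕₚ.≤-trans (unique-⊆⇒length≤ unique′ sub′) le) (ℕₚ.<⇒≱ ℕₚ.≤-refl)
      where
      unique′ : Unique (y ∷ xs)
      unique′ = All.tabulate (λ x∈xs y≡x → y∉xs (subst (_∈ xs) (sym y≡x) x∈xs)) ∷ uxs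
      sub′ : ∀ {x} → x ∈ y ∷ xs → x ∈ ys
      sub′ (here refl) = y∈ys
      sub′ (there x∈) = sub x∈

module _ {A : Set} where

  ∑ : List A → (A → ℤ) → ℤ
  ∑ xs f = foldr (λ x s → f x ℤ.+ s) 0ℤ xs

  ∑-cong : ∀ {f g} (xs : List A) → (∀ {x} → x ∈ xs → f x ≡ g x) → ∑ xs f ≡ ∑ xs g
  ∑-cong [] eq = refl
  ∑-cong (x ∷ xs) eq = cong₂ ℤ._+_ (eq (here refl)) (∑-cong xs (eq ∘ there))

  ∑-+ : ∀ f g (xs : List A) → ∑ xs (λ x → f x ℤ.+ g x) ≡ ∑ xs f ℤ.+ ∑ xs g
  ∑-+ f g [] = refl
  ∑-+ f g (x ∷ xs) = trans (cong (ℤ._+_ (f x ℤ.+ g x)) (∑-+ f g xs))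
    (ℤS.solve 4 (λ a b s t → a :+ b :+ (s :+ t) := (a :+ s) :+ (b :+ t)) refl (f x) (g x) (∑ xs f) (∑ xs g))
    where
    open ℤS using (_:+_; _:=_)

  ∑-*ˡ : ∀ c f (xs : List A) → ∑ xs (λ x → c ℤ.* f x) ≡ c ℤ.* ∑ xs f
  ∑-*ˡ c f [] = sym (ℤₚ.*-zeroʳ c)
  ∑-*ˡ c f (x ∷ xs) = trans (cong (ℤ._+_ (c ℤ.* f x)) (∑-*ˡ c f xs)) (sym (ℤₚ.*-distribˡ-+ c (f x) _))

  ∑-const : ∀ c (xs : List A) → ∑ xs (λ _ → c) ≡ ℤ.+ length xs ℤ.* c
  ∑-const c [] = refl
  ∑-const c (x ∷ xs) = trans (cong (ℤ._+_ c) (∑-const c xs)) (sym (ℤₚ.suc-* (ℤ.+ length xs) c))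

  ∑-zero : ∀ f (xs : List A) → (∀ {x} → x ∈ xs → f x ≡ 0ℤ) → ∑ xs f ≡ 0ℤ
  ∑-zero f xs eq = trans (∑-cong xs eq) (trans (∑-const 0ℤ xs) (ℤₚ.*-zeroʳ (ℤ.+ length xs)))

  ∑-++ : ∀ f (xs ys : List A) → ∑ (xs ++ ys) f ≡ ∑ xs f ℤ.+ ∑ ys f
  ∑-++ f [] ys = sym (ℤₚ.+-identityˡ _)
  ∑-++ f (x ∷ xs) ys = trans (cong (ℤ._+_ (f x)) (∑-++ f xs ys)) (sym (ℤₚ.+-assoc (f x) _ _))

  ∑-↭ : ∀ f {xs ys : List A} → xs ↭ ys → ∑ xs f ≡ ∑ ys f
  ∑-↭ f {xs} {ys} xs↭ys = trans (sym (fold-map xs)) (trans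
    (↭ₛ.foldr-commMonoid (setoid ℤ) ℤₚ.+-0-isCommutativeMonoid (↭⇒↭ₛ (↭ₚ.map⁺ f xs↭ys))) (fold-map ys))
    where
    fold-map : ∀ xs → foldr ℤ._+_ 0ℤ (map f xs) ≡ ∑ xs f
    fold-map [] = refl
    fold-map (x ∷ xs) = cong (ℤ._+_ (f x)) (fold-map xs)

  ∑-support : (_≟_ : DecidableEquality A) → ∀ f (xs ys : List A) → Unique xs → Unique ys →
    (∀ {y} → y ∈ ys → y ∈ xs) → (∀ {x} → x ∈ xs → x ∉ ys → f x ≡ 0ℤ) → ∑ xs f ≡ ∑ ys f
  ∑-support _≟_ f xs ys uxs uys sub zero-off = trans (split xs) (trans
    (cong₂ ℤ._+_ (∑-↭ f (unique⇒↭ (Uniqueₚ.filter⁺ ∈ys? uxs) uys (λ x∈ → proj₂ (∈-filter⁻ ∈ys? {xs = xs} x∈))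
      (λ y∈ → ∈-filter⁺ ∈ys? (sub y∈) y∈)))
      (∑-zero f _ λ x∈ → let x∈xs , x∉ys = ∈-filter⁻ (¬? ∘ ∈ys?) {xs = xs} x∈ in zero-off x∈xs x∉ys))
    (ℤₚ.+-identityʳ _))
    where
    ∈ys? : ∀ x → Dec (x ∈ ys)
    ∈ys? x = DecMembership._∈?_ _≟_ x ys
    split : ∀ xs → ∑ xs f ≡ ∑ (filter ∈ys? xs) f ℤ.+ ∑ (filter (¬? ∘ ∈ys?) xs) f
    split [] = refl
    split (x ∷ xs) with ∈ys? x
    ... | yes _ = trans (cong (ℤ._+_ (f x)) (split xs)) (sym (ℤₚ.+-assoc (f x) _ _))
    ... | no _ = trans (cong (ℤ._+_ (f x)) (split xs))
      (ℤS.solve 3 (λ a s t → a :+ (s :+ t) := s :+ (a :+ t)) refl (f x) (∑ (filter ∈ys? xs) f) _)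
      where
      open ℤS using (_:+_; _:=_)

∑-map : ∀ {A B : Set} (f : B → ℤ) (g : A → B) xs → ∑ (map g xs) f ≡ ∑ xs (f ∘ g)
∑-map f g [] = refl
∑-map f g (x ∷ xs) = cong (ℤ._+_ (f (g x))) (∑-map f g xs)

∑-cartesian : ∀ {A B C : Set} (h : A → B → C) (f : C → ℤ) xs ys →
  ∑ (cartesianProductWith h xs ys) f ≡ ∑ xs (λ x → ∑ ys (λ y → f (h x y)))
∑-cartesian h f [] ys = refl
∑-cartesian h f (x ∷ xs) ys = trans (∑-++ f (map (h x) ys) _)
  (cong₂ ℤ._+_ (∑-map f (h x) ys) (∑-cartesian h f xs ys))

module _ {A : Set} {_∙_ : A → A → A} {ε : A} (M : IsCommutativeMonoid _≡_ _∙_ ε) where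
  open IsCommutativeMonoid M using (assoc; comm; identityˡ)

  private
    commutativeMonoid : CommutativeMonoid 0ℓ 0ℓ
    commutativeMonoid = record { isCommutativeMonoid = M }

  open import Algebra.Definitions.RawMonoid (CommutativeMonoid.rawMonoid commutativeMonoid) renaming (_×_ to _·_) using ()

  foldr-translate : ∀ a xs → foldr _∙_ ε (map (a ∙_) xs) ≡ (length xs · a) ∙ foldr _∙_ ε xs
  foldr-translate a [] = sym (identityˡ ε)
  foldr-translate a (x ∷ xs) = begin
    (a ∙ x) ∙ foldr _∙_ ε (map (a ∙_) xs) ≡⟨ cong ((a ∙ x) ∙_) (foldr-translate a xs) ⟩
    (a ∙ x) ∙ (n ∙ t)                      ≡⟨ assoc a x _ ⟩
    a ∙ (x ∙ (n ∙ t))                      ≡⟨ cong (a ∙_) (sym (assoc x n t)) ⟩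
    a ∙ ((x ∙ n) ∙ t)                      ≡⟨ cong (λ s → a ∙ (s ∙ t)) (comm x n) ⟩
    a ∙ ((n ∙ x) ∙ t)                      ≡⟨ cong (a ∙_) (assoc n x t) ⟩
    a ∙ (n ∙ (x ∙ t))                      ≡⟨ sym (assoc a n _) ⟩
    (a ∙ n) ∙ (x ∙ t) ∎
    where
    open ≡-Reasoning
    n = length xs · a
    t = foldr _∙_ ε xs

  -- The common core of `size·1≡0` and `fermat`: if translation by a permutes a finite list, the
  -- product of the list absorbs the power of a that the translation produces.
  foldr-invariant : ∀ a xs → map (a ∙_) xs ↭ xs → (length xs · a) ∙ foldr _∙_ ε xs ≡ foldr _∙_ ε xs
  foldr-invariant a xs perm =
    trans (sym (foldr-translate a xs)) (↭ₛ.foldr-commMonoid (setoid A) M (↭⇒↭ₛ perm))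

-- Finite fields: roots of polynomials and Fermat's theorem

module FieldTheory (K : FiniteField) where
  open RingTheory K public
  open import Algebra.Properties.Semiring.Exp semiring public using (_^_; ^-homo-*; ^-assocʳ)
  open import Algebra.Properties.CommutativeSemiring.Exp commutativeSemiring public using (^-distrib-*)
  open import Algebra.Properties.Semiring.Mult semiring public renaming (_×_ to _·_) using ()
  open CommutativeRing commutativeRing public using (+-isCommutativeMonoid; *-isCommutativeMonoid; +-monoid)

  infix 4 _≟_
  -- Elements are compared through the positions at which `elements-complete` finds them.
  _≟_ : DecidableEquality Carrier
  x ≟ y with Any.index (elements-complete x) Finₚ.≟ Any.index (elements-complete y)
  ... | yes i≡j = yes (trans (lookup-index (elements-complete x))
                        (trans (cong (lookup elements) i≡j) (sym (lookup-index (elements-complete y)))))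
  ... | no i≢j = no λ x≡y → i≢j (cong (λ z → Any.index (elements-complete z)) x≡y)

  ≡0? : ∀ x → x ≡ 0# ⊎ x ≢ 0#
  ≡0? x with x ≟ 0#
  ... | yes x≡0 = inj₁ x≡0
  ... | no x≢0 = inj₂ x≢0

  infix 9 _⁻¹
  abstract
    -- Made total by the value `0#` at `0#`, and abstract so that inverses stay atoms for the
    -- solver.
    _⁻¹ : Carrier → Carrier
    x ⁻¹ with x ≟ 0#
    ... | yes _ = 0#
    ... | no x≢0 = proj₁ (inverse x x≢0)

    *-inverseʳ : ∀ {x} → x ≢ 0# → x * x ⁻¹ ≡ 1#
    *-inverseʳ {x} x≢0 with x ≟ 0#
    ... | yes x≡0 = contradiction x≡0 x≢0
    ... | no x≢0′ = proj₂ (inverse x x≢0′)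

  *-cancelˡ : ∀ {x y z} → x ≢ 0# → x * y ≡ x * z → y ≡ z
  *-cancelˡ {x} {y} {z} x≢0 eq = trans (sym (undo y)) (trans (cong (x ⁻¹ *_) eq) (undo z))
    where
    undo : ∀ t → x ⁻¹ * (x * t) ≡ t
    undo t = trans (sym (*-assoc _ _ _)) (trans (cong (_* t) (trans (*-comm _ _) (*-inverseʳ x≢0))) (*-identityˡ t))

  zero-product : ∀ {x y} → x ≢ 0# → x * y ≡ 0# → y ≡ 0#
  zero-product x≢0 eq = *-cancelˡ x≢0 (trans eq (sym (zeroʳ _)))

  *-nonzero : ∀ {x y} → x ≢ 0# → y ≢ 0# → x * y ≢ 0#
  *-nonzero x≢0 y≢0 eq = y≢0 (zero-product x≢0 eq)

  *-nonzeroˡ : ∀ {x y} → x * y ≢ 0# → x ≢ 0#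
  *-nonzeroˡ {x} {y} xy≢0 x≡0 = xy≢0 (trans (cong (_* y) x≡0) (zeroˡ y))

  *-nonzeroʳ : ∀ {x y} → x * y ≢ 0# → y ≢ 0#
  *-nonzeroʳ {x} {y} xy≢0 y≡0 = xy≢0 (trans (cong (x *_) y≡0) (zeroʳ x))

  1≢0 : 1# ≢ 0#
  1≢0 = 0≢1 ∘ sym

  ⁻¹-nonzero : ∀ {x} → x ≢ 0# → x ⁻¹ ≢ 0#
  ⁻¹-nonzero x≢0 = *-nonzeroʳ (λ eq → 1≢0 (trans (sym (*-inverseʳ x≢0)) eq))

  ^-nonzero : ∀ {x} n → x ≢ 0# → x ^ n ≢ 0#
  ^-nonzero zero x≢0 = 1≢0
  ^-nonzero (suc n) x≢0 = *-nonzero x≢0 (^-nonzero n x≢0)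

  -‿nonzero : ∀ {x} → x ≢ 0# → - x ≢ 0#
  -‿nonzero {x} x≢0 eq = x≢0 (trans (sym (-‿involutive x)) (trans (cong -_ eq) -0#≈0#))

  sub≡0⇒≡ : ∀ {x y} → x - y ≡ 0# → x ≡ y
  sub≡0⇒≡ {x} {y} eq = trans
    (solve 2 (λ x y → x := (x :- y) :+ y) refl x y) (trans (cong (_+ y) eq) (+-identityˡ y))

  ≡⇒sub≡0 : ∀ {x y} → x ≡ y → x - y ≡ 0#
  ≡⇒sub≡0 {x} refl = -‿inverseʳ x

  1^n≡1 : ∀ n → 1# ^ n ≡ 1#
  1^n≡1 zero = refl
  1^n≡1 (suc n) = trans (*-identityˡ _) (1^n≡1 n)

  -- Polynomial functions in Horner form, the index being the degree. No coefficient list is needed,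
  -- since polynomials serve only to bound numbers of roots.
  data IsMonic : ℕ → (Carrier → Carrier) → Set where
    one : ∀ {f} → (∀ x → f x ≡ 1#) → IsMonic 0 f
    cons : ∀ {n f} c g → (∀ x → f x ≡ c + x * g x) → IsMonic n g → IsMonic (suc n) f

  -- Synthetic division: the Horner form of f yields that of the quotient by `x - a`, and the
  -- remainder is the value at a.
  factor : ∀ {n f} → IsMonic (suc n) f → ∀ a → ∃[ g ] IsMonic n g × (∀ x → f x ≡ (x - a) * g x + f a)
  factor {f = f} (cons c g f≡ (one g≡)) a = g , one g≡ , λ x → begin
    f x                              ≡⟨ trans (f≡ x) (cong (λ t → c + x * t) (g≡ x)) ⟩
    c + x * 1#                       ≡⟨ solve 3 (λ x a c → c :+ x :* con (ℤ.+ 1) := (x :- a) :* con (ℤ.+ 1) :+ (c :+ a :* con (ℤ.+ 1))) refl x a c ⟩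
    (x - a) * 1# + (c + a * 1#)      ≡⟨ cong₂ (λ s t → (x - a) * s + t) (sym (g≡ x)) (sym (trans (f≡ a) (cong (λ t → c + a * t) (g≡ a)))) ⟩
    (x - a) * g x + f a ∎
    where
    open ≡-Reasoning
  factor {f = f} (cons c g f≡ g-monic@(cons _ _ _ _)) a with factor g-monic a
  ... | h , h-monic , g≡ = (λ x → g a + x * h x) , cons (g a) h (λ _ → refl) h-monic , λ x → begin
    f x                                         ≡⟨ trans (f≡ x) (cong (λ t → c + x * t) (g≡ x)) ⟩
    c + x * ((x - a) * h x + g a)               ≡⟨ solve 5 (λ x a c s t → c :+ x :* ((x :- a) :* s :+ t) := (x :- a) :* (t :+ x :* s) :+ (c :+ a :* t)) refl x a c (h x) (g a) ⟩
    (x - a) * (g a + x * h x) + (c + a * g a)   ≡⟨ cong ((x - a) * (g a + x * h x) +_) (sym (f≡ a)) ⟩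
    (x - a) * (g a + x * h x) + f a ∎
    where
    open ≡-Reasoning

  roots≤degree : ∀ {n f} → IsMonic n f → ∀ xs → Unique xs → All (λ x → f x ≡ 0#) xs → length xs ℕ.≤ n
  roots≤degree _ [] _ _ = z≤n
  roots≤degree (one f≡) (x ∷ xs) _ (fx≡0 ∷ _) = contradiction (trans (sym (f≡ x)) fx≡0) 1≢0
  roots≤degree {f = f} f-monic@(cons _ _ _ _) (a ∷ xs) (a∉ ∷ uxs) (fa≡0 ∷ fxs≡0) with factor f-monic a
  ... | g , g-monic , f≡ = s≤s (roots≤degree g-monic xs uxs (All.map root (All.zip (a∉ , fxs≡0))))
    where
    root : ∀ {x} → a ≢ x × f x ≡ 0# → g x ≡ 0#
    root {x} (a≢x , fx≡0) = zero-product (λ x-a≡0 → a≢x (sym (sub≡0⇒≡ x-a≡0)))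
      (trans (sym (+-identityʳ _)) (trans (cong ((x - a) * g x +_) (sym fa≡0)) (trans (sym (f≡ x)) fx≡0)))

  monomial-monic : ∀ n → IsMonic n (_^ n)
  monomial-monic zero = one λ _ → refl
  monomial-monic (suc n) = cons 0# (_^ n) (λ x → sym (+-identityˡ _)) (monomial-monic n)

  translate-↭ : ∀ {_∙_ : Carrier → Carrier → Carrier} a → (∀ {x y} → a ∙ x ≡ a ∙ y → x ≡ y) →
                ∀ xs → Unique xs → (∀ {x} → x ∈ xs → a ∙ x ∈ xs) → map (a ∙_) xs ↭ xs
  translate-↭ {_∙_} a inj xs uxs closed = unique⇒↭ unique′ uxs sub
    (unique-⊆⇒⊇ _≟_ unique′ sub (ℕₚ.≤-reflexive (sym (length-map (a ∙_) xs))))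
    where
    unique′ : Unique (map (a ∙_) xs)
    unique′ = Uniqueₚ.map⁺ inj uxs
    sub : ∀ {x} → x ∈ map (a ∙_) xs → x ∈ xs
    sub x∈ with ∈-map⁻ (a ∙_) x∈
    ... | y , y∈ , refl = closed y∈

  *-translate-↭ : ∀ {a} → a ≢ 0# → map (a *_) elements ↭ elements
  *-translate-↭ {a} a≢0 = translate-↭ {_*_} a (*-cancelˡ a≢0) elements elements-unique (λ _ → elements-complete _)

  size·1≡0 : size · 1# ≡ 0#
  size·1≡0 = begin
    n                ≡⟨ solve 2 (λ n t → n := (n :+ t) :- t) refl n t ⟩
    (n + t) - t      ≡⟨ cong (_- t) (foldr-invariant +-isCommutativeMonoid 1# elements perm) ⟩
    t - t            ≡⟨ -‿inverseʳ t ⟩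
    0# ∎
    where
    open ≡-Reasoning
    n = size · 1#
    t = foldr _+_ 0# elements
    perm : map (1# +_) elements ↭ elements
    perm = translate-↭ {_+_} 1#
      (λ {x} {y} eq → trans (undo x) (trans (cong (- 1# +_) eq) (sym (undo y))))
      elements elements-unique (λ _ → elements-complete _)
      where
      undo : ∀ x → x ≡ - 1# + (1# + x)
      undo x = solve 2 (λ o x → x := :- o :+ (o :+ x)) refl 1# x

  nonzeros : List Carrier
  nonzeros = filter (λ x → ¬? (x ≟ 0#)) elements

  nonzeros-unique : Unique nonzeros
  nonzeros-unique = Uniqueₚ.filter⁺ _ elements-unique

  ∈-nonzeros : ∀ {x} → x ≢ 0# → x ∈ nonzeros
  ∈-nonzeros = ∈-filter⁺ (λ x → ¬? (x ≟ 0#)) (elements-complete _)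

  nonzeros-≢0 : ∀ {x} → x ∈ nonzeros → x ≢ 0#
  nonzeros-≢0 x∈ = proj₂ (∈-filter⁻ (λ x → ¬? (x ≟ 0#)) {xs = elements} x∈)

  size≡1+nonzeros : size ≡ suc (length nonzeros)
  size≡1+nonzeros = ℕₚ.≤-antisym
    (unique-⊆⇒length≤ _≟_ {ys = 0# ∷ nonzeros} elements-unique λ {x} _ → zero-or-∈ x)
    (unique-⊆⇒length≤ _≟_ (All.tabulate (λ x∈ 0≡x → nonzeros-≢0 x∈ (sym 0≡x)) ∷ nonzeros-unique)
      (λ _ → elements-complete _))
    where
    zero-or-∈ : ∀ x → x ∈ 0# ∷ nonzeros
    zero-or-∈ x with x ≟ 0#
    ... | yes x≡0 = here x≡0
    ... | no x≢0 = there (∈-nonzeros x≢0)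

  fermat : ∀ {x} → x ≢ 0# → x ^ length nonzeros ≡ 1#
  fermat {x} x≢0 = *-cancelˡ (product≢0 nonzeros nonzeros-≢0)
    (trans (*-comm _ _) (trans (foldr-invariant *-isCommutativeMonoid x nonzeros perm) (sym (*-identityʳ _))))
    where
    perm : map (x *_) nonzeros ↭ nonzeros
    perm = translate-↭ {_*_} x (*-cancelˡ x≢0) nonzeros nonzeros-unique
      (λ y∈ → ∈-nonzeros (*-nonzero x≢0 (nonzeros-≢0 y∈)))
    product≢0 : ∀ ys → (∀ {y} → y ∈ ys → y ≢ 0#) → foldr _*_ 1# ys ≢ 0#
    product≢0 [] _ = 1≢0
    product≢0 (y ∷ ys) nz = *-nonzero (nz (here refl)) (product≢0 ys (nz ∘ there))

  x^size≡x : ∀ x → x ^ size ≡ x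
  x^size≡x x = trans (cong (x ^_) size≡1+nonzeros) pow
    where
    pow : x * x ^ length nonzeros ≡ x
    pow with x ≟ 0#
    ... | yes refl = zeroˡ _
    ... | no x≢0 = trans (cong (x *_) (fermat x≢0)) (*-identityʳ x)

-- Binomial coefficients modulo a prime, characteristic and Frobenius map

prime∤! : ∀ {p} → Prime p → ∀ k → k ℕ.< p → ¬ (p ℕ∣.∣ k !)
prime∤! pp zero k<p p∣1 = contradiction (ℕ∣.∣1⇒≡1 p∣1) λ { refl → ℕ.nonTrivial⇒≢1 {{prime⇒nonTrivial pp}} refl }
prime∤! pp (suc k) k<p p∣ with euclidsLemma (suc k) (k !) pp p∣
... | inj₁ p∣k = ℕₚ.<⇒≱ k<p (ℕ∣.∣⇒≤ p∣k)
... | inj₂ p∣k! = prime∤! pp k (ℕₚ.<-trans (ℕₚ.n<1+n k) k<p) p∣k!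

-- The prime divides p!, which is the product of the binomial coefficient with k! and (p - k)!, but
-- it divides neither of these two factorials.
prime∣binomial : ∀ {p} → Prime p → ∀ k → 0 ℕ.< k → k ℕ.< p → p ℕ∣.∣ (p choose k)
prime∣binomial {suc p-1} pp k 0<k k<p with euclidsLemma (p choose k) (k ! ℕ.* (p ℕ.∸ k) !) pp p∣product
  where
  p = suc p-1
  instance _ = k !* (p ℕ.∸ k) !≢0
  k≤p = ℕₚ.<⇒≤ k<p
  p∣product : p ℕ∣.∣ (p choose k) ℕ.* (k ! ℕ.* (p ℕ.∸ k) !)
  p∣product = subst (p ℕ∣.∣_)
    (sym (trans (cong (ℕ._* (k ! ℕ.* (p ℕ.∸ k) !)) (nCk≡n!/k![n-k]! k≤p)) (ℕ/.m/n*n≡m (k![n∸k]!∣n! k≤p))))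
    (ℕ∣.m∣m*n (p-1 !))
... | inj₁ p∣C = p∣C
... | inj₂ p∣k!l! with euclidsLemma (k !) ((suc p-1 ℕ.∸ k) !) pp p∣k!l!
... | inj₁ p∣k! = contradiction p∣k! (prime∤! pp k k<p)
... | inj₂ p∣l! = contradiction p∣l! (prime∤! pp _ (ℕₚ.∸-monoʳ-< 0<k (ℕₚ.<⇒≤ k<p)))

module Characteristic (K : FiniteField) where
  open FieldTheory K public
  open import Algebra.Properties.Semiring.Mult semiring using (×1-homo-*; ×-assoc-*; ×-assocˡ; ×-congʳ; ×-homo-1)
  import Algebra.Properties.CommutativeSemiring.Binomial commutativeSemiring as Binomial
  open import Algebra.Properties.Monoid.Sum +-monoid using (sum; sum-init-last; sum-cong-≗; sum-replicate-zero)

  -- The multiple `(p ℕ.^ n) · 1#` is the n-th power of `p · 1#`, and a field has no zero divisors.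
  prime-power-char : ∀ p n → (p ℕ.^ n) · 1# ≡ 0# → p · 1# ≡ 0#
  prime-power-char p zero eq = contradiction (trans (sym (+-identityʳ 1#)) eq) 1≢0
  prime-power-char p (suc n) eq with p · 1# ≟ 0#
  ... | yes p≡0 = p≡0
  ... | no p≢0 = prime-power-char p n (zero-product p≢0 (trans (sym (×1-homo-* p (p ℕ.^ n))) eq))

  module _ {p} (pp : Prime p) (p≡0 : p · 1# ≡ 0#) where

    multiple≡0 : ∀ n x → p ℕ∣.∣ n → n · x ≡ 0#
    multiple≡0 n x (ℕ∣.divides c n≡c*p) = begin
      n · x                 ≡⟨ cong (n ·_) (sym (*-identityˡ x)) ⟩
      n · (1# * x)          ≡⟨ sym (×-assoc-* n 1# x) ⟩
      n · 1# * x            ≡⟨ cong (λ m → m · 1# * x) n≡c*p ⟩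
      (c ℕ.* p) · 1# * x    ≡⟨ cong (_* x) (×1-homo-* c p) ⟩
      c · 1# * p · 1# * x   ≡⟨ cong (λ t → c · 1# * t * x) p≡0 ⟩
      c · 1# * 0# * x       ≡⟨ trans (cong (_* x) (zeroʳ _)) (zeroˡ x) ⟩
      0# ∎
      where
      open ≡-Reasoning

    ^p-+ : ∀ x y → (x + y) ^ p ≡ x ^ p + y ^ p
    ^p-+ x y = go p refl
      where
      open ≡-Reasoning
      -- The exponent becomes a variable, so that matching on it exposes the two outer terms of the
      -- binomial sum; all the others carry a coefficient divisible by p.
      go : ∀ n → n ≡ p → (x + y) ^ n ≡ x ^ n + y ^ n
      go zero refl = contradiction p≡0 λ _ → ℕ.≢-nonZero⁻¹ 0 {{prime⇒nonZero pp}} refl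
      go (suc m) refl = begin
        (x + y) ^ n                              ≡⟨ Binomial.theorem n x y ⟩
        t zero + sum (tail t)                    ≡⟨ cong (t zero +_) (sum-init-last (tail t)) ⟩
        t zero + (sum (init (tail t)) + last (tail t))
          ≡⟨ cong (λ s → t zero + (s + last (tail t))) (trans (sum-cong-≗ middle) (sum-replicate-zero m)) ⟩
        t zero + (0# + last (tail t))            ≡⟨ cong₂ _+_ first (trans (+-identityˡ _) final) ⟩
        y ^ n + x ^ n                            ≡⟨ +-comm _ _ ⟩
        x ^ n + y ^ n ∎
        where
        n = suc m
        t = Binomial.binomialTerm x y n
        first : t zero ≡ y ^ n
        first = trans (+-identityʳ _) (*-identityˡ _)
        middle : ∀ i → init (tail t) i ≡ 0#
        middle i = multiple≡0 _ _ (prime∣binomial pp _ (s≤s z≤n)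
          (s≤s (subst (ℕ._< m) (sym (Finₚ.toℕ-inject₁ i)) (Finₚ.toℕ<n i))))
        final : last (tail t) ≡ x ^ n
        final = begin
          (n choose suc (toℕ (fromℕ m))) · (x ^ suc (toℕ (fromℕ m)) * y ^ (m ℕ.∸ toℕ (fromℕ m)))
            ≡⟨ cong (λ k → (n choose suc k) · (x ^ suc k * y ^ (m ℕ.∸ k))) (Finₚ.toℕ-fromℕ m) ⟩
          (n choose n) · (x ^ n * y ^ (m ℕ.∸ m))
            ≡⟨ cong₂ (λ c k → c · (x ^ n * y ^ k)) (nCn≡1 n) (ℕₚ.n∸n≡0 m) ⟩
          1 · (x ^ n * 1#)  ≡⟨ trans (+-identityʳ _) (*-identityʳ _) ⟩
          x ^ n ∎

    ^p^k-+ : ∀ k x y → (x + y) ^ (p ℕ.^ k) ≡ x ^ (p ℕ.^ k) + y ^ (p ℕ.^ k)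
    ^p^k-+ zero x y = distribʳ 1# x y
    ^p^k-+ (suc k) x y = begin
      (x + y) ^ (p ℕ.* p ℕ.^ k)                 ≡⟨ sym (^-assocʳ (x + y) p _) ⟩
      ((x + y) ^ p) ^ (p ℕ.^ k)                 ≡⟨ cong (_^ (p ℕ.^ k)) (^p-+ x y) ⟩
      (x ^ p + y ^ p) ^ (p ℕ.^ k)               ≡⟨ ^p^k-+ k _ _ ⟩
      (x ^ p) ^ (p ℕ.^ k) + (y ^ p) ^ (p ℕ.^ k) ≡⟨ cong₂ _+_ (^-assocʳ x p _) (^-assocʳ y p _) ⟩
      x ^ (p ℕ.* p ℕ.^ k) + y ^ (p ℕ.* p ℕ.^ k) ∎
      where
      open ≡-Reasoning

odd-prime : ∀ {p} → Prime p → p ≢ 2 → ∃[ j ] p ≡ suc (j ℕ.+ j)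
odd-prime {p} pp p≢2 with p ℕ/.% 2 in eq | ℕ/.m%n<n p 2 | ℕ/.m≡m%n+[m/n]*n p 2
... | 0 | _ | p≡ with prime⇒irreducible pp (ℕ∣.m%n≡0⇒n∣m p 2 eq)
...   | inj₁ ()
...   | inj₂ 2≡p = contradiction (sym 2≡p) p≢2
odd-prime {p} pp p≢2 | 1 | _ | p≡ = p ℕ/./ 2 , trans p≡ (cong suc (trans (ℕₚ.*-comm (p ℕ/./ 2) 2) (cong (p ℕ/./ 2 ℕ.+_) (ℕₚ.+-identityʳ _))))
odd-prime {p} pp p≢2 | suc (suc _) | s≤s (s≤s ()) | _

odd-^ : ∀ j k → ∃[ r ] suc (j ℕ.+ j) ℕ.^ k ≡ suc (r ℕ.+ r)
odd-^ j zero = 0 , refl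
odd-^ j (suc k) with odd-^ j k
... | r , eq = r ℕ.+ j ℕ.* suc (r ℕ.+ r) , trans (cong (suc (j ℕ.+ j) ℕ.*_) eq)
  (solve 2 (λ j r → (con 1 :+ (j :+ j)) :* (con 1 :+ (r :+ r)) :=
     con 1 :+ ((r :+ j :* (con 1 :+ (r :+ r))) :+ (r :+ j :* (con 1 :+ (r :+ r))))) refl j r)
  where
  open ℕSolver.+-*-Solver

odd-square : ∀ r → suc (r ℕ.+ r) ℕ.* suc (r ℕ.+ r) ≡ suc ((r ℕ.+ r) ℕ.* suc r ℕ.+ (r ℕ.+ r) ℕ.* suc r)
odd-square = solve 1 (λ r → (con 1 :+ (r :+ r)) :* (con 1 :+ (r :+ r)) :=
  con 1 :+ ((r :+ r) :* (con 1 :+ r) :+ (r :+ r) :* (con 1 :+ r))) refl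
  where
  open ℕSolver.+-*-Solver

-- The subfield F of order q, conjugation and the quadratic character of K

module QuadraticExtension (K : FiniteField) (p k q : ℕ) (p-prime : Prime p) (p≢2 : p ≢ 2) (q≡p^k : q ≡ p ℕ.^ k)
  (size≡q*q : FiniteField.size K ≡ q ℕ.* q) where
  open Characteristic K public
  open ≡-Reasoning

  p·1≡0 : p · 1# ≡ 0#
  p·1≡0 = prime-power-char p (k ℕ.+ k) (trans (cong (_· 1#) (begin
    p ℕ.^ (k ℕ.+ k)          ≡⟨ ℕₚ.^-distribˡ-+-* p k k ⟩
    p ℕ.^ k ℕ.* p ℕ.^ k      ≡⟨ sym (cong₂ ℕ._*_ q≡p^k q≡p^k) ⟩
    q ℕ.* q                  ≡⟨ sym size≡q*q ⟩
    size ∎)) size·1≡0)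

  half : ∃[ r ] q ≡ suc (r ℕ.+ r)
  half with odd-prime p-prime p≢2
  ... | j , refl = let r , eq = odd-^ j k in r , trans q≡p^k eq

  r : ℕ
  r = proj₁ half

  -- q = 2 r + 1, so this is (q² - 1) / 2.
  h : ℕ
  h = (r ℕ.+ r) ℕ.* suc r

  length-nonzeros : length nonzeros ≡ h ℕ.+ h
  length-nonzeros = ℕₚ.suc-injective (begin
    suc (length nonzeros)              ≡⟨ sym size≡1+nonzeros ⟩
    size                               ≡⟨ size≡q*q ⟩
    q ℕ.* q                            ≡⟨ cong₂ ℕ._*_ (proj₂ half) (proj₂ half) ⟩
    suc (r ℕ.+ r) ℕ.* suc (r ℕ.+ r)    ≡⟨ odd-square r ⟩
    suc (h ℕ.+ h) ∎)

  -- For r = 0 also h = 0, and there would be no nonzero elements, although `1#` is one.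
  r≢0 : r ≢ 0
  r≢0 r≡0 = contradiction (trans length-nonzeros (cong₂ ℕ._+_ h≡0 h≡0)) λ len≡0 → empty len≡0 (∈-nonzeros 1≢0)
    where
    h≡0 : h ≡ 0
    h≡0 = cong (λ s → (s ℕ.+ s) ℕ.* suc s) r≡0
    empty : ∀ {x} {xs : List Carrier} → length xs ≡ 0 → ¬ x ∈ xs
    empty {xs = []} _ ()

  q≡2+ : ∃[ m ] q ≡ suc (suc m)
  q≡2+ with r | proj₂ half | r≢0
  ... | zero | _ | r≢0 = contradiction refl r≢0
  ... | suc r′ | eq | _ = r′ ℕ.+ suc r′ , eq

  2≢0 : 1# + 1# ≢ 0#
  2≢0 2≡0 with odd-prime p-prime p≢2
  ... | j , refl = 1≢0 (trans (sym (+-identityʳ 1#)) (trans (sym (cong (1# +_) (even j))) p·1≡0))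
    where
    open import Algebra.Properties.Monoid.Mult +-monoid using (×-homo-+)
    even : ∀ j → (j ℕ.+ j) · 1# ≡ 0#
    even j = begin
      (j ℕ.+ j) · 1#               ≡⟨ ×-homo-+ 1# j j ⟩
      j · 1# + j · 1#              ≡⟨ solve 1 (λ t → t :+ t := con (ℤ.+ 2) :* t) refl (j · 1#) ⟩
      (1# + 1#) * j · 1#           ≡⟨ cong (_* j · 1#) 2≡0 ⟩
      0# * j · 1#                  ≡⟨ zeroˡ _ ⟩
      0# ∎

  -- The conjugation of K over F. It is additive because q is a power of the characteristic, and an
  -- involution because K has q² elements.
  σ : Carrier → Carrier
  σ x = x ^ q

  InF : Carrier → Set
  InF x = σ x ≡ x

  σ-+ : ∀ x y → σ (x + y) ≡ σ x + σ y
  σ-+ x y = subst (λ n → (x + y) ^ n ≡ x ^ n + y ^ n) (sym q≡p^k) (^p^k-+ p-prime p·1≡0 k x y)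

  σ-* : ∀ x y → σ (x * y) ≡ σ x * σ y
  σ-* x y = ^-distrib-* x y q

  σ-σ : ∀ x → σ (σ x) ≡ x
  σ-σ x = trans (^-assocʳ x q q) (trans (cong (x ^_) (sym size≡q*q)) (x^size≡x x))

  σ-0 : σ 0# ≡ 0#
  σ-0 = trans (cong (0# ^_) (proj₂ half)) (zeroˡ _)

  σ-1 : σ 1# ≡ 1#
  σ-1 = 1^n≡1 q

  σ-neg : ∀ x → σ (- x) ≡ - σ x
  σ-neg x = begin
    σ (- x)                    ≡⟨ solve 2 (λ a b → a := (b :+ a) :- b) refl (σ (- x)) (σ x) ⟩
    (σ x + σ (- x)) - σ x      ≡⟨ cong (_- σ x) (trans (sym (σ-+ x (- x))) (trans (cong σ (-‿inverseʳ x)) σ-0)) ⟩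
    0# - σ x                   ≡⟨ +-identityˡ _ ⟩
    - σ x ∎

  σ-sub : ∀ x y → σ (x - y) ≡ σ x - σ y
  σ-sub x y = trans (σ-+ x (- y)) (cong (_+_ (σ x)) (σ-neg y))

  σ-≢0 : ∀ {x} → x ≢ 0# → σ x ≢ 0#
  σ-≢0 x≢0 = ^-nonzero q x≢0

  InF-+ : ∀ {x y} → InF x → InF y → InF (x + y)
  InF-+ {x} {y} x∈ y∈ = trans (σ-+ x y) (cong₂ _+_ x∈ y∈)

  InF-* : ∀ {x y} → InF x → InF y → InF (x * y)
  InF-* {x} {y} x∈ y∈ = trans (σ-* x y) (cong₂ _*_ x∈ y∈)

  InF-neg : ∀ {x} → InF x → InF (- x)
  InF-neg {x} x∈ = trans (σ-neg x) (cong -_ x∈)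

  InF-sub : ∀ {x y} → InF x → InF y → InF (x - y)
  InF-sub x∈ y∈ = InF-+ x∈ (InF-neg y∈)

  -- The condition that a / b is fixed by `σ`, with denominators cleared. All later tests for a
  -- ratio in F take this cross-multiplied form.
  proportional⇒InF : ∀ {a b} → b ≢ 0# → a * σ b ≡ b * σ a → InF (a * b ⁻¹)
  proportional⇒InF {a} {b} b≢0 eq = *-cancelˡ (*-nonzero b≢0 (σ-≢0 b≢0)) (begin
    b * σ b * σ (a * b ⁻¹)           ≡⟨ cong (b * σ b *_) (σ-* a (b ⁻¹)) ⟩
    b * σ b * (σ a * σ (b ⁻¹))       ≡⟨ solve 4 (λ b sb sa si → b :* sb :* (sa :* si) := b :* sa :* (sb :* si)) refl b (σ b) (σ a) (σ (b ⁻¹)) ⟩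
    b * σ a * (σ b * σ (b ⁻¹))       ≡⟨ cong₂ _*_ (sym eq) (trans (sym (σ-* b (b ⁻¹))) (trans (cong σ (*-inverseʳ b≢0)) σ-1)) ⟩
    a * σ b * 1#                     ≡⟨ cong (a * σ b *_) (sym (*-inverseʳ b≢0)) ⟩
    a * σ b * (b * b ⁻¹)             ≡⟨ solve 4 (λ a sb b i → a :* sb :* (b :* i) := b :* sb :* (a :* i)) refl a (σ b) b (b ⁻¹) ⟩
    b * σ b * (a * b ⁻¹) ∎)

  InF-⁻¹ : ∀ {x} → x ≢ 0# → InF x → InF (x ⁻¹)
  InF-⁻¹ {x} x≢0 x∈ = subst InF (*-identityˡ _)
    (proportional⇒InF x≢0 (trans (*-identityˡ _) (trans x∈ (trans (sym (*-identityʳ x)) (cong (x *_) (sym σ-1))))))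

  F : List Carrier
  F = filter (λ x → σ x ≟ x) elements

  F-unique : Unique F
  F-unique = Uniqueₚ.filter⁺ _ elements-unique

  ∈-F : ∀ {x} → InF x → x ∈ F
  ∈-F = ∈-filter⁺ (λ x → σ x ≟ x) (elements-complete _)

  F-InF : ∀ {x} → x ∈ F → InF x
  F-InF x∈ = proj₂ (∈-filter⁻ (λ x → σ x ≟ x) {xs = elements} x∈)

  private
    ^q≡ : ∀ x → x ^ q ≡ x * (x * x ^ proj₁ q≡2+)
    ^q≡ x = cong (x ^_) (proj₂ q≡2+)

    -- As q is at least 2, the constant and the linear coefficient of x^q + d x + c can be peeled
    -- off in front of a monomial.
    degree-q : ∀ {f} c d → (∀ x → f x ≡ c + x * (d + x * x ^ proj₁ q≡2+)) → IsMonic q f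
    degree-q {f} c d eq = subst (λ n → IsMonic n f) (sym (proj₂ q≡2+))
      (cons c _ eq (cons d _ (λ _ → refl) (monomial-monic _)))

  length-F≤q : length F ℕ.≤ q
  length-F≤q = roots≤degree (degree-q {λ x → σ x - x} 0# (- 1#) λ x → trans (cong (_- x) (^q≡ x))
      (solve 2 (λ x y → x :* (x :* y) :- x := con (ℤ.+ 0) :+ x :* (:- con (ℤ.+ 1) :+ x :* y)) refl x _))
    F F-unique (All.tabulate (λ x∈ → ≡⇒sub≡0 (F-InF x∈)))

  -- The trace x + x^q maps K to F and its fibres are root sets of polynomials of degree q.
  q≤length-F : q ℕ.≤ length F
  q≤length-F = ℕₚ.*-cancelʳ-≤ q (length F) q {{subst ℕ.NonZero (sym (proj₂ half)) _}}
    (subst (ℕ._≤ length F ℕ.* q) size≡q*q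
      (length≤-fibres _≟_ trace q F elements elements-unique (λ {x} _ → ∈-F (trace-InF x)) fibre))
    where
    trace : Carrier → Carrier
    trace x = x + σ x
    trace-InF : ∀ x → InF (trace x)
    trace-InF x = trans (σ-+ x (σ x)) (trans (cong (_+_ (σ x)) (σ-σ x)) (+-comm _ _))
    fibre : ∀ c zs → Unique zs → All (λ z → trace z ≡ c) zs → length zs ℕ.≤ q
    fibre c zs uzs tr = roots≤degree (degree-q {λ x → trace x - c} (- c) 1# λ x → trans (cong (λ t → x + t - c) (^q≡ x))
        (solve 3 (λ x y c → x :+ x :* (x :* y) :- c := :- c :+ x :* (con (ℤ.+ 1) :+ x :* y)) refl x _ c))
      zs uzs (All.map ≡⇒sub≡0 tr)

  length-F : length F ≡ q
  length-F = ℕₚ.≤-antisym length-F≤q q≤length-F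

  x^2h≡1 : ∀ {x} → x ≢ 0# → x ^ h * x ^ h ≡ 1#
  x^2h≡1 {x} x≢0 = trans (sym (^-homo-* x h h)) (trans (cong (x ^_) (sym length-nonzeros)) (fermat x≢0))

  0<h : 0 ℕ.< h
  0<h with r | r≢0
  ... | zero | r≢0 = contradiction refl r≢0
  ... | suc _ | _ = s≤s z≤n

  abstract
    -- The quadratic character, defined by Euler's criterion and valued in ℤ so that its sums count
    -- points. Being abstract, it is used only through `χ-0`, `χ-pos` and `χ-neg`.
    χ : Carrier → ℤ
    χ x with x ≟ 0#
    ... | yes _ = 0ℤ
    ... | no _ with x ^ h ≟ 1#
    ...   | yes _ = 1ℤ
    ...   | no _ = -1ℤ

    χ-0 : ∀ {x} → x ≡ 0# → χ x ≡ 0ℤ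
    χ-0 {x} x≡0 with x ≟ 0#
    ... | yes _ = refl
    ... | no x≢0 = contradiction x≡0 x≢0

    χ-pos : ∀ {x} → x ≢ 0# → x ^ h ≡ 1# → χ x ≡ 1ℤ
    χ-pos {x} x≢0 x^h≡1 with x ≟ 0#
    ... | yes x≡0 = contradiction x≡0 x≢0
    ... | no _ with x ^ h ≟ 1#
    ...   | yes _ = refl
    ...   | no x^h≢1 = contradiction x^h≡1 x^h≢1

    χ-neg : ∀ {x} → x ≢ 0# → x ^ h ≡ - 1# → χ x ≡ -1ℤ
    χ-neg {x} x≢0 x^h≡-1 with x ≟ 0#
    ... | yes x≡0 = contradiction x≡0 x≢0
    ... | no _ with x ^ h ≟ 1#
    ...   | yes x^h≡1 = contradiction (trans (cong (1# +_) (trans (sym x^h≡1) x^h≡-1)) (-‿inverseʳ 1#)) 2≢0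
    ...   | no _ = refl

  euler : ∀ {x} → x ≢ 0# → x ^ h ≡ 1# ⊎ x ^ h ≡ - 1#
  euler {x} x≢0 with x ^ h ≟ 1#
  ... | yes eq = inj₁ eq
  ... | no x^h≢1 = inj₂ (begin
    x ^ h                  ≡⟨ solve 1 (λ y → y := (con (ℤ.+ 1) :+ y) :- con (ℤ.+ 1)) refl (x ^ h) ⟩
    (1# + x ^ h) - 1#      ≡⟨ cong (_- 1#) (zero-product (λ eq → x^h≢1 (sub≡0⇒≡ eq)) (begin
      (x ^ h - 1#) * (1# + x ^ h)   ≡⟨ solve 1 (λ y → (y :- con (ℤ.+ 1)) :* (con (ℤ.+ 1) :+ y) := y :* y :- con (ℤ.+ 1)) refl (x ^ h) ⟩
      x ^ h * x ^ h - 1#            ≡⟨ ≡⇒sub≡0 (x^2h≡1 x≢0) ⟩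
      0# ∎)) ⟩
    0# - 1#                ≡⟨ +-identityˡ _ ⟩
    - 1# ∎)

  χ-±1 : ∀ {x} → x ≢ 0# → χ x ≡ 1ℤ ⊎ χ x ≡ -1ℤ
  χ-±1 x≢0 with euler x≢0
  ... | inj₁ eq = inj₁ (χ-pos x≢0 eq)
  ... | inj₂ eq = inj₂ (χ-neg x≢0 eq)

  χ≡1⇒≢0 : ∀ {x} → χ x ≡ 1ℤ → x ≢ 0#
  χ≡1⇒≢0 {x} eq x≡0 = contradiction (trans (sym eq) (χ-0 x≡0)) λ ()

  χ≡1⇒^h≡1 : ∀ {x} → χ x ≡ 1ℤ → x ^ h ≡ 1#
  χ≡1⇒^h≡1 {x} eq with euler (χ≡1⇒≢0 {x} eq)
  ... | inj₁ x^h≡1 = x^h≡1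
  ... | inj₂ x^h≡-1 = contradiction (trans (sym eq) (χ-neg (χ≡1⇒≢0 {x} eq) x^h≡-1)) λ ()

  χ²≡1 : ∀ {x} → x ≢ 0# → χ x ℤ.* χ x ≡ 1ℤ
  χ²≡1 {x} x≢0 with χ-±1 {x} x≢0
  ... | inj₁ eq = cong₂ ℤ._*_ eq eq
  ... | inj₂ eq = cong₂ ℤ._*_ eq eq

  χ-* : ∀ x y → χ (x * y) ≡ χ x ℤ.* χ y
  χ-* x y with ≡0? x | ≡0? y
  ... | inj₁ x≡0 | _ = trans (χ-0 (trans (cong (_* y) x≡0) (zeroˡ y))) (sym (cong (ℤ._* χ y) (χ-0 x≡0)))
  ... | inj₂ _ | inj₁ y≡0 = trans (χ-0 (trans (cong (x *_) y≡0) (zeroʳ x))) (sym (trans (cong (χ x ℤ.*_) (χ-0 y≡0)) (ℤₚ.*-zeroʳ (χ x))))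
  ... | inj₂ x≢0 | inj₂ y≢0 with euler x≢0 | euler y≢0
  ...   | inj₁ ex | inj₁ ey = trans (χ-pos (*-nonzero x≢0 y≢0) (trans (^-distrib-* x y h) (trans (cong₂ _*_ ex ey) (*-identityˡ 1#))))
                                (sym (cong₂ ℤ._*_ (χ-pos x≢0 ex) (χ-pos y≢0 ey)))
  ...   | inj₁ ex | inj₂ ey = trans (χ-neg (*-nonzero x≢0 y≢0) (trans (^-distrib-* x y h) (trans (cong₂ _*_ ex ey) (*-identityˡ _))))
                                (sym (cong₂ ℤ._*_ (χ-pos x≢0 ex) (χ-neg y≢0 ey)))
  ...   | inj₂ ex | inj₁ ey = trans (χ-neg (*-nonzero x≢0 y≢0) (trans (^-distrib-* x y h) (trans (cong₂ _*_ ex ey) (*-identityʳ _))))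
                                (sym (cong₂ ℤ._*_ (χ-neg x≢0 ex) (χ-pos y≢0 ey)))
  ...   | inj₂ ex | inj₂ ey = trans (χ-pos (*-nonzero x≢0 y≢0) (trans (^-distrib-* x y h) (trans (cong₂ _*_ ex ey) neg-neg)))
                                (sym (cong₂ ℤ._*_ (χ-neg x≢0 ex) (χ-neg y≢0 ey)))
    where
    neg-neg : - 1# * - 1# ≡ 1#
    neg-neg = solve 0 (:- con (ℤ.+ 1) :* :- con (ℤ.+ 1) := con (ℤ.+ 1)) refl

  χ-square : ∀ {x} → x ≢ 0# → χ (x * x) ≡ 1ℤ
  χ-square {x} x≢0 = trans (χ-* x x) (χ²≡1 x≢0)

  -- For x in F the power with exponent q - 1 is 1, and h is the multiple (q - 1) (q + 1) / 2 of
  -- that exponent, q being odd.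
  χ-F : ∀ {x} → InF x → x ≢ 0# → χ x ≡ 1ℤ
  χ-F {x} x∈ x≢0 = χ-pos x≢0 (begin
    x ^ h                            ≡⟨ sym (^-assocʳ x (r ℕ.+ r) (suc r)) ⟩
    (x ^ (r ℕ.+ r)) ^ suc r          ≡⟨ cong (_^ suc r) (*-cancelˡ x≢0 (trans (sym (cong (x ^_) (proj₂ half))) (trans x∈ (sym (*-identityʳ x))))) ⟩
    1# ^ suc r                       ≡⟨ 1^n≡1 (suc r) ⟩
    1# ∎)

  -- The product a b is (a / b) b², where a / b lies in F and is therefore a square of K.
  χ-proportional : ∀ {a b} → a ≢ 0# → b ≢ 0# → a * σ b ≡ b * σ a → χ (a * b) ≡ 1ℤ
  χ-proportional {a} {b} a≢0 b≢0 eq = begin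
    χ (a * b)                          ≡⟨ cong χ (begin
        a * b                            ≡⟨ sym (*-identityʳ _) ⟩
        a * b * 1#                       ≡⟨ cong (a * b *_) (sym (*-inverseʳ b≢0)) ⟩
        a * b * (b * b ⁻¹)               ≡⟨ solve 3 (λ a b i → a :* b :* (b :* i) := (a :* i) :* (b :* b)) refl a b (b ⁻¹) ⟩
        a * b ⁻¹ * (b * b) ∎) ⟩
    χ (a * b ⁻¹ * (b * b))             ≡⟨ χ-* _ _ ⟩
    χ (a * b ⁻¹) ℤ.* χ (b * b)
      ≡⟨ cong₂ ℤ._*_ (χ-F (proportional⇒InF b≢0 eq) (*-nonzero a≢0 (⁻¹-nonzero b≢0))) (χ-square b≢0) ⟩
    1ℤ ∎

  private
    h-roots : ∀ xs → Unique xs → (∀ {x} → x ∈ xs → x ^ h ≡ 1#) → length xs ℕ.≤ h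
    h-roots xs uxs root = roots≤degree (monic h 0<h) xs uxs (All.tabulate (λ x∈ → ≡⇒sub≡0 (root x∈)))
      where
      monic : ∀ n → 0 ℕ.< n → IsMonic n (λ x → x ^ n - 1#)
      monic (suc n) _ = cons (- 1#) (_^ n) (λ x → +-comm _ _) (monomial-monic n)

  -- Filtered from `elements` because the list of all `y * y` has repetitions, whereas the root
  -- count needs a duplicate-free list.
  squares : List Carrier
  squares = filter (λ s → DecMembership._∈?_ _≟_ s (map (λ y → y * y) nonzeros)) elements

  h≤length-squares : h ℕ.≤ length squares
  h≤length-squares = ℕₚ.*-cancelʳ-≤ h (length squares) 2 (subst (ℕ._≤ length squares ℕ.* 2)
    (trans length-nonzeros (trans (cong (h ℕ.+_) (sym (ℕₚ.+-identityʳ h))) (ℕₚ.*-comm 2 h)))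
    (length≤-fibres _≟_ (λ y → y * y) 2 squares nonzeros nonzeros-unique
      (λ y∈ → ∈-filter⁺ (λ s → DecMembership._∈?_ _≟_ s (map (λ y → y * y) nonzeros)) (elements-complete _) (∈-map⁺ _ y∈))
      (λ s zs uzs eq → roots≤degree (monic s) zs uzs (All.map ≡⇒sub≡0 eq))))
    where
    monic : ∀ s → IsMonic 2 (λ y → y * y - s)
    monic s = cons (- s) (_^ 1) (λ y → trans (+-comm _ _) (cong (λ t → - s + y * t) (sym (*-identityʳ y)))) (monomial-monic 1)

  -- The squares already provide h roots of x^h - 1, since squaring is at most two-to-one on 2 h
  -- elements. A nonsquare with character 1 would be one root too many.
  χ≡1⇒square : ∀ {x} → χ x ≡ 1ℤ → ∃[ y ] y * y ≡ x
  χ≡1⇒square {x} χx≡1 with DecMembership._∈?_ _≟_ x (map (λ y → y * y) nonzeros)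
  ... | yes x∈ = let y , _ , eq = ∈-map⁻ (λ y → y * y) x∈ in y , sym eq
  ... | no x∉ = contradiction
    (ℕₚ.≤-trans (h-roots (x ∷ squares) (All.tabulate x≢ ∷ Uniqueₚ.filter⁺ _ elements-unique) root) h≤length-squares)
    (ℕₚ.<⇒≱ ℕₚ.≤-refl)
    where
    is-square : ∀ {s} → s ∈ squares → s ∈ map (λ y → y * y) nonzeros
    is-square s∈ = proj₂ (∈-filter⁻ (λ s → DecMembership._∈?_ _≟_ s (map (λ y → y * y) nonzeros)) {xs = elements} s∈)
    x≢ : ∀ {s} → s ∈ squares → x ≢ s
    x≢ s∈ refl = x∉ (is-square s∈)
    root : ∀ {s} → s ∈ x ∷ squares → s ^ h ≡ 1#
    root (here refl) = χ≡1⇒^h≡1 χx≡1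
    root (there s∈) with ∈-map⁻ (λ y → y * y) (is-square s∈)
    ... | y , y∈ , refl = trans (^-distrib-* y y h) (x^2h≡1 (nonzeros-≢0 y∈))

  -- Otherwise all 2 h nonzero elements would be roots of x^h - 1.
  nonsquare : ∃[ m ] χ m ≡ -1ℤ
  nonsquare with Any.any? (λ x → χ x ℤ.≟ -1ℤ) elements
  ... | yes found = Any.satisfied found
  ... | no none = contradiction
    (subst (ℕ._≤ h) length-nonzeros (h-roots nonzeros nonzeros-unique root))
    (ℕₚ.<⇒≱ (subst (ℕ._< h ℕ.+ h) (ℕₚ.+-identityʳ h) (ℕₚ.+-monoʳ-< h 0<h)))
    where
    root : ∀ {x} → x ∈ nonzeros → x ^ h ≡ 1#
    root {x} x∈ with χ-±1 (nonzeros-≢0 x∈)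
    ... | inj₁ eq = χ≡1⇒^h≡1 eq
    ... | inj₂ eq = contradiction (Any.map (λ { refl → eq }) (elements-complete x)) none

  -- Multiplication by a nonsquare permutes K and changes the sign of the sum.
  ∑χ≡0 : ∑ elements χ ≡ 0ℤ
  ∑χ≡0 = self-negative (begin
    s                                       ≡⟨ sym (∑-↭ χ (*-translate-↭ m≢0)) ⟩
    ∑ (map (m *_) elements) χ               ≡⟨ ∑-map χ (m *_) elements ⟩
    ∑ elements (λ x → χ (m * x))            ≡⟨ ∑-cong elements (λ {x} _ → trans (χ-* m x) (cong (ℤ._* χ x) (proj₂ nonsquare))) ⟩
    ∑ elements (λ x → -1ℤ ℤ.* χ x)          ≡⟨ ∑-*ˡ -1ℤ χ elements ⟩
    -1ℤ ℤ.* s ∎)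
    where
    s = ∑ elements χ
    m = proj₁ nonsquare
    m≢0 : m ≢ 0#
    m≢0 m≡0 = contradiction (trans (sym (proj₂ nonsquare)) (χ-0 m≡0)) λ ()
    self-negative : ∀ {i} → i ≡ -1ℤ ℤ.* i → i ≡ 0ℤ
    self-negative {ℤ.+ zero} _ = refl
    self-negative {ℤ.+ suc n} ()
    self-negative {ℤ.-[1+ n ]} ()

-- Sums of the quadratic character over translates of F

Unique-map : ∀ {A B : Set} {f : A → B} (xs : List A) → (∀ {x y} → x ∈ xs → y ∈ xs → f x ≡ f y → x ≡ y) →
             Unique xs → Unique (map f xs)
Unique-map [] inj [] = []
Unique-map {f = f} (x ∷ xs) inj (x∉ ∷ uxs) =
  All.tabulate distinct ∷ Unique-map xs (λ x∈ y∈ → inj (there x∈) (there y∈)) uxs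
  where
  distinct : ∀ {z} → z ∈ map f xs → f x ≢ z
  distinct z∈ fx≡z with ∈-map⁻ f z∈
  ... | y , y∈ , refl = All.lookup x∉ y∈ (inj (here refl) (there y∈) fx≡z)

length-cartesianProduct : ∀ {A B : Set} (xs : List A) (ys : List B) →
  length (cartesianProduct xs ys) ≡ length xs ℕ.* length ys
length-cartesianProduct [] ys = refl
length-cartesianProduct (x ∷ xs) ys = trans (length-++ (map (x ,_) ys))
  (cong₂ ℕ._+_ (length-map (x ,_) ys) (length-cartesianProduct xs ys))

module CharacterSums (K : FiniteField) (p k q : ℕ) (p-prime : Prime p) (p≢2 : p ≢ 2) (q≡p^k : q ≡ p ℕ.^ k)
  (size≡q*q : FiniteField.size K ≡ q ℕ.* q) where
  open QuadraticExtension K p k q p-prime p≢2 q≡p^k size≡q*q public hiding (h; r)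
  open ≡-Reasoning

  S : Carrier → ℤ
  S w = ∑ F (λ z → χ (z + w))

  ∑-const-F : ∀ c → ∑ F (λ _ → c) ≡ ℤ.+ q ℤ.* c
  ∑-const-F c = trans (∑-const c F) (cong (λ n → ℤ.+ n ℤ.* c) length-F)

  module _ where
    open ℤS renaming (solve to ℤ-solve; con to κ; _:+_ to _⊕_; _:*_ to _⊗_; _:=_ to _⊜_; :-_ to ⊝_; _:-_ to _⊖_)

    ∑-F-except : ∀ f c a → InF a → (∀ {x} → InF x → x ≢ a → f x ≡ c) → ∑ F f ≡ ℤ.+ q ℤ.* c ℤ.+ (f a ℤ.- c)
    ∑-F-except f c a a∈ eq = begin
      ∑ F f                                          ≡⟨ ∑-cong F (λ {x} _ → ℤ-solve 2 (λ f c → f ⊜ c ⊕ (f ⊖ c)) refl (f x) c) ⟩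
      ∑ F (λ x → c ℤ.+ (f x ℤ.- c))                  ≡⟨ ∑-+ (λ _ → c) (λ x → f x ℤ.- c) F ⟩
      ∑ F (λ _ → c) ℤ.+ ∑ F (λ x → f x ℤ.- c)        ≡⟨ cong₂ ℤ._+_ (∑-const-F c)
          (∑-support _≟_ (λ x → f x ℤ.- c) F (a ∷ []) F-unique ([] ∷ []) (λ { (here refl) → ∈-F a∈ })
            (λ x∈ x∉ → trans (cong (ℤ._- c) (eq (F-InF x∈) (x∉ ∘ here))) (ℤₚ.+-inverseʳ c))) ⟩
      ℤ.+ q ℤ.* c ℤ.+ (f a ℤ.- c ℤ.+ 0ℤ)             ≡⟨ cong (ℤ._+_ (ℤ.+ q ℤ.* c)) (ℤₚ.+-identityʳ _) ⟩
      ℤ.+ q ℤ.* c ℤ.+ (f a ℤ.- c) ∎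

    S-InF : ∀ {w} → InF w → S w ≡ ℤ.+ q ℤ.- 1ℤ
    S-InF {w} w∈ = begin
      S w
        ≡⟨ ∑-F-except (λ z → χ (z + w)) 1ℤ (- w) (InF-neg w∈)
             (λ {z} z∈ z≢ → χ-F (InF-+ z∈ w∈) (λ z+w≡0 → z≢ (trans (solve 2 (λ z w → z := (z :+ w) :- w) refl z w)
               (trans (cong (_- w) z+w≡0) (+-identityˡ _))))) ⟩
      ℤ.+ q ℤ.* 1ℤ ℤ.+ (χ (- w + w) ℤ.- 1ℤ)
        ≡⟨ cong (λ t → ℤ.+ q ℤ.* 1ℤ ℤ.+ (t ℤ.- 1ℤ)) (χ-0 (-‿inverseˡ w)) ⟩
      ℤ.+ q ℤ.* 1ℤ ℤ.+ (0ℤ ℤ.- 1ℤ)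
        ≡⟨ ℤ-solve 1 (λ q → q ⊗ κ 1ℤ ⊕ (κ 0ℤ ⊖ κ 1ℤ) ⊜ q ⊖ κ 1ℤ) refl (ℤ.+ q) ⟩
      ℤ.+ q ℤ.- 1ℤ ∎

    -- For w outside F the map (b, a) ↦ a + b w is a bijection F × F → K, so ∑_K χ = 0 becomes (q - 1) (1 + S w) = 0.
    S-∉F : ∀ {w} → ¬ InF w → S w ≡ -1ℤ
    S-∉F {w} w∉ = solve-S (begin
      (ℤ.+ q ℤ.- 1ℤ) ℤ.* (S w ℤ.+ 1ℤ)
        ≡⟨ ℤ-solve 2 (λ q s → (q ⊖ κ 1ℤ) ⊗ (s ⊕ κ 1ℤ) ⊜ q ⊗ s ⊕ (q ⊖ κ 1ℤ ⊖ s)) refl (ℤ.+ q) (S w) ⟩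
      ℤ.+ q ℤ.* S w ℤ.+ (ℤ.+ q ℤ.- 1ℤ ℤ.- S w)
        ≡⟨ cong (λ t → ℤ.+ q ℤ.* S w ℤ.+ (t ℤ.- S w)) (sym row-0) ⟩
      ℤ.+ q ℤ.* S w ℤ.+ (row 0# ℤ.- S w)
        ≡⟨ sym (∑-F-except row (S w) 0# σ-0 row-≢0) ⟩
      ∑ F row
        ≡⟨ sym (∑-cartesian _,_ (χ ∘ combine) F F) ⟩
      ∑ (cartesianProduct F F) (χ ∘ combine)
        ≡⟨ sym (∑-map χ combine (cartesianProduct F F)) ⟩
      ∑ pairs χ
        ≡⟨ ∑-↭ χ (unique⇒↭ pairs-unique elements-unique (λ _ → elements-complete _)
             (unique-⊆⇒⊇ _≟_ pairs-unique (λ _ → elements-complete _) (ℕₚ.≤-reflexive (begin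
               length elements                          ≡⟨ size≡q*q ⟩
               q ℕ.* q                                  ≡⟨ sym (cong₂ ℕ._*_ length-F length-F) ⟩
               length F ℕ.* length F                    ≡⟨ sym (length-cartesianProduct F F) ⟩
               length (cartesianProduct F F)            ≡⟨ sym (length-map combine (cartesianProduct F F)) ⟩
               length pairs ∎)))) ⟩
      ∑ elements χ
        ≡⟨ ∑χ≡0 ⟩
      0ℤ ∎)
      where
      combine : Carrier × Carrier → Carrier
      combine (b , a) = a + b * w

      pairs : List Carrier
      pairs = map combine (cartesianProduct F F)

      row : Carrier → ℤ
      row b = ∑ F (λ a → χ (a + b * w))

      row-0 : row 0# ≡ ℤ.+ q ℤ.- 1ℤ
      row-0 = trans (∑-cong F (λ {a} _ → cong (λ t → χ (a + t)) (zeroˡ w))) (S-InF σ-0)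

      -- Multiplication by b permutes F, and b itself is a square of K, so the row can be rescaled
      -- to the row of 1.
      row-≢0 : ∀ {b} → InF b → b ≢ 0# → row b ≡ S w
      row-≢0 {b} b∈ b≢0 = begin
        row b                                    ≡⟨ sym (∑-↭ (λ a → χ (a + b * w)) (translate-↭ {_*_} b (*-cancelˡ b≢0) F F-unique (λ a∈ → ∈-F (InF-* b∈ (F-InF a∈))))) ⟩
        ∑ (map (b *_) F) (λ a → χ (a + b * w))   ≡⟨ ∑-map (λ a → χ (a + b * w)) (b *_) F ⟩
        ∑ F (λ a → χ (b * a + b * w))            ≡⟨ ∑-cong F (λ {a} _ → begin
            χ (b * a + b * w)       ≡⟨ cong χ (sym (distribˡ b a w)) ⟩
            χ (b * (a + w))         ≡⟨ χ-* b (a + w) ⟩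
            χ b ℤ.* χ (a + w)       ≡⟨ cong (ℤ._* χ (a + w)) (χ-F b∈ b≢0) ⟩
            1ℤ ℤ.* χ (a + w)        ≡⟨ ℤₚ.*-identityˡ _ ⟩
            χ (a + w) ∎) ⟩
        S w ∎

      combine-injective : ∀ {u v} → u ∈ cartesianProduct F F → v ∈ cartesianProduct F F → combine u ≡ combine v → u ≡ v
      combine-injective {b , a} {b′ , a′} u∈ v∈ eq = cong₂ _,_ b≡b′ a≡a′
        where
        u∈F = ∈-cartesianProduct⁻ F F u∈
        v∈F = ∈-cartesianProduct⁻ F F v∈
        σ-combine : ∀ {b a} → b ∈ F → a ∈ F → σ (a + b * w) ≡ a + b * σ w
        σ-combine {b} {a} b∈ a∈ = trans (σ-+ a (b * w)) (cong₂ _+_ (F-InF a∈) (trans (σ-* b w) (cong (_* σ w) (F-InF b∈))))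
        σ-eq : a + b * σ w ≡ a′ + b′ * σ w
        σ-eq = trans (sym (σ-combine (proj₁ u∈F) (proj₂ u∈F))) (trans (cong σ eq) (σ-combine (proj₁ v∈F) (proj₂ v∈F)))
        -- Subtracting the conjugate equation from the given one leaves (w - σ w) (b - b′) = 0, and
        -- w is not fixed by `σ`.
        b≡b′ : b ≡ b′
        b≡b′ = sub≡0⇒≡ (zero-product (λ w-σw≡0 → w∉ (sym (sub≡0⇒≡ w-σw≡0))) (begin
          (w - σ w) * (b - b′)
            ≡⟨ solve 6 (λ a b a′ b′ w v → (w :- v) :* (b :- b′) :=
                 ((a :+ b :* w) :- (a′ :+ b′ :* w)) :- ((a :+ b :* v) :- (a′ :+ b′ :* v))) refl a b a′ b′ w (σ w) ⟩
          ((a + b * w) - (a′ + b′ * w)) - ((a + b * σ w) - (a′ + b′ * σ w))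
            ≡⟨ cong₂ _-_ (≡⇒sub≡0 eq) (≡⇒sub≡0 σ-eq) ⟩
          0# - 0#
            ≡⟨ -‿inverseʳ 0# ⟩
          0# ∎))
        a≡a′ : a ≡ a′
        a≡a′ = begin
          a                       ≡⟨ solve 2 (λ a t → a := (a :+ t) :- t) refl a (b * w) ⟩
          (a + b * w) - b * w     ≡⟨ cong₂ (λ s t → s - t * w) eq b≡b′ ⟩
          (a′ + b′ * w) - b′ * w  ≡⟨ sym (solve 2 (λ a t → a := (a :+ t) :- t) refl a′ (b′ * w)) ⟩
          a′ ∎

      pairs-unique : Unique pairs
      pairs-unique = Unique-map (cartesianProduct F F) combine-injective (Uniqueₚ.cartesianProduct⁺ F-unique F-unique)

      solve-S : (ℤ.+ q ℤ.- 1ℤ) ℤ.* (S w ℤ.+ 1ℤ) ≡ 0ℤ → S w ≡ -1ℤ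
      solve-S eq with ℤₚ.i*j≡0⇒i≡0∨j≡0 (ℤ.+ q ℤ.- 1ℤ) eq
      ... | inj₁ q-1≡0 = contradiction (trans (sym (cong (λ n → ℤ.+ n ℤ.- 1ℤ) (proj₂ q≡2+))) q-1≡0) λ ()
      ... | inj₂ s+1≡0 = trans (ℤ-solve 1 (λ s → s ⊜ (s ⊕ κ 1ℤ) ⊖ κ 1ℤ) refl (S w)) (cong (ℤ._- 1ℤ) s+1≡0)

-- Vector algebra and identities for ternary quadratic forms

-- Stated over bare operations so that the same formulas can be read in the field and in the solver's syntax.
module Formulas {A : Set} (_+_ _*_ : A → A → A) (-_ : A → A) (two : A) where
  infixl 6 _+′_ _-′_
  infixl 7 _*′_
  private
    _+′_ = _+_
    _*′_ = _*_
    _-′_ : A → A → A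
    x -′ y = x + (- y)

  dot : A × A × A → A × A × A → A
  dot (a₁ , a₂ , a₃) (b₁ , b₂ , b₃) = a₁ *′ b₁ +′ a₂ *′ b₂ +′ a₃ *′ b₃

  cross : A × A × A → A × A × A → A × A × A
  cross (a₁ , a₂ , a₃) (b₁ , b₂ , b₃) = a₂ *′ b₃ -′ a₃ *′ b₂ , a₃ *′ b₁ -′ a₁ *′ b₃ , a₁ *′ b₂ -′ a₂ *′ b₁

  bracket : A × A × A → A × A × A → A × A × A → A
  bracket a b c = dot (cross a b) c

  combine : A → A × A × A → A → A × A × A → A × A × A
  combine s (a₁ , a₂ , a₃) t (b₁ , b₂ , b₃) = s *′ a₁ +′ t *′ b₁ , s *′ a₂ +′ t *′ b₂ , s *′ a₃ +′ t *′ b₃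

  symmetricDet : A → A → A → A → A → A → A
  symmetricDet g₁₁ g₂₂ g₃₃ g₁₂ g₁₃ g₂₃ =
    g₁₁ *′ (g₂₂ *′ g₃₃ -′ g₂₃ *′ g₂₃) -′ g₁₂ *′ (g₁₂ *′ g₃₃ -′ g₂₃ *′ g₁₃) +′ g₁₃ *′ (g₁₂ *′ g₂₃ -′ g₂₂ *′ g₁₃)

  module Form (a b c d e f : A) where

    form : A × A × A → A
    form (x , y , z) = a *′ x *′ x +′ b *′ y *′ y +′ c *′ z *′ z +′ d *′ x *′ y +′ e *′ x *′ z +′ f *′ y *′ z

    gradient : A × A × A → A × A × A
    gradient (x , y , z) =
      two *′ a *′ x +′ d *′ y +′ e *′ z , d *′ x +′ two *′ b *′ y +′ f *′ z , e *′ x +′ f *′ y +′ two *′ c *′ z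

    discriminant : A
    discriminant = two *′ a *′ (two *′ b *′ (two *′ c) -′ f *′ f) -′ d *′ (d *′ (two *′ c) -′ f *′ e) +′ e *′ (d *′ f -′ two *′ b *′ e)

module VectorAlgebra (K : FiniteField) where
  open FieldTheory K public
  open Geometry K public hiding (_^_)
  open Formulas _+_ _*_ -_ two public using (dot; symmetricDet)
  private
    module V = Formulas _+_ _*_ -_ two
    module P {n} = Formulas {Polynomial n} _:+_ _:*_ :-_ (con (ℤ.+ 2))

  triple≡ : ∀ {x y z x′ y′ z′ : Carrier} → x ≡ x′ → y ≡ y′ → z ≡ z′ → (x , y , z) ≡ (x′ , y′ , z′)
  triple≡ refl refl refl = refl

  abstract
    -- Abstract, so that later goals do not expand into coordinates; the polynomial identities are
    -- proved once, inside abstract blocks.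
    cross : Triple → Triple → Triple
    cross = V.cross

    combine : Carrier → Triple → Carrier → Triple → Triple
    combine = V.combine

  bracket : Triple → Triple → Triple → Carrier
  bracket X Y Z = dot (cross X Y) Z

  abstract

    dot-combine : ∀ L s X t Y → dot L (combine s X t Y) ≡ s * dot L X + t * dot L Y
    dot-combine (l₁ , l₂ , l₃) s (x₁ , x₂ , x₃) t (y₁ , y₂ , y₃) =
      solve 11 (λ l₁ l₂ l₃ s x₁ x₂ x₃ t y₁ y₂ y₃ →
        let L = l₁ , l₂ , l₃ ; X = x₁ , x₂ , x₃ ; Y = y₁ , y₂ , y₃ in
        P.dot L (P.combine s X t Y) := s :* P.dot L X :+ t :* P.dot L Y)
        refl l₁ l₂ l₃ s x₁ x₂ x₃ t y₁ y₂ y₃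

    dot-comm : ∀ X Y → dot X Y ≡ dot Y X
    dot-comm (x₁ , x₂ , x₃) (y₁ , y₂ , y₃) =
      solve 6 (λ x₁ x₂ x₃ y₁ y₂ y₃ → P.dot (x₁ , x₂ , x₃) (y₁ , y₂ , y₃) := P.dot (y₁ , y₂ , y₃) (x₁ , x₂ , x₃))
        refl x₁ x₂ x₃ y₁ y₂ y₃

    dot-scale : ∀ s X Y → dot (scale s X) Y ≡ s * dot X Y
    dot-scale s (x₁ , x₂ , x₃) (y₁ , y₂ , y₃) =
      solve 7 (λ s x₁ x₂ x₃ y₁ y₂ y₃ → P.dot (s :* x₁ , s :* x₂ , s :* x₃) (y₁ , y₂ , y₃) := s :* P.dot (x₁ , x₂ , x₃) (y₁ , y₂ , y₃))
        refl s x₁ x₂ x₃ y₁ y₂ y₃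

    dot-zeroˡ : ∀ X → dot zero3 X ≡ 0#
    dot-zeroˡ (x₁ , x₂ , x₃) =
      solve 3 (λ x₁ x₂ x₃ → P.dot (con (ℤ.+ 0) , con (ℤ.+ 0) , con (ℤ.+ 0)) (x₁ , x₂ , x₃) := con (ℤ.+ 0)) refl x₁ x₂ x₃

    dot-zeroʳ : ∀ X → dot X zero3 ≡ 0#
    dot-zeroʳ X = trans (dot-comm X zero3) (dot-zeroˡ X)

    dot-crossˡ : ∀ X Y → dot X (cross X Y) ≡ 0#
    dot-crossˡ (x₁ , x₂ , x₃) (y₁ , y₂ , y₃) =
      solve 6 (λ x₁ x₂ x₃ y₁ y₂ y₃ → P.dot (x₁ , x₂ , x₃) (P.cross (x₁ , x₂ , x₃) (y₁ , y₂ , y₃)) := con (ℤ.+ 0))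
        refl x₁ x₂ x₃ y₁ y₂ y₃

    dot-crossʳ : ∀ X Y → dot Y (cross X Y) ≡ 0#
    dot-crossʳ (x₁ , x₂ , x₃) (y₁ , y₂ , y₃) =
      solve 6 (λ x₁ x₂ x₃ y₁ y₂ y₃ → P.dot (y₁ , y₂ , y₃) (P.cross (x₁ , x₂ , x₃) (y₁ , y₂ , y₃)) := con (ℤ.+ 0))
        refl x₁ x₂ x₃ y₁ y₂ y₃

    dot-cross-cross : ∀ X Y U V → dot (cross X Y) (cross U V) ≡ dot X U * dot Y V - dot X V * dot Y U
    dot-cross-cross (x₁ , x₂ , x₃) (y₁ , y₂ , y₃) (u₁ , u₂ , u₃) (v₁ , v₂ , v₃) =
      solve 12 (λ x₁ x₂ x₃ y₁ y₂ y₃ u₁ u₂ u₃ v₁ v₂ v₃ →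
        let X = x₁ , x₂ , x₃ ; Y = y₁ , y₂ , y₃ ; U = u₁ , u₂ , u₃ ; V = v₁ , v₂ , v₃ in
        P.dot (P.cross X Y) (P.cross U V) := P.dot X U :* P.dot Y V :- P.dot X V :* P.dot Y U)
        refl x₁ x₂ x₃ y₁ y₂ y₃ u₁ u₂ u₃ v₁ v₂ v₃

    -- Multiplicativity of the 3 × 3 determinant: the pairings are the entries of a matrix product.
    bracket-multiplicative : ∀ U V W A B C →
      bracket (dot A U , dot A V , dot A W) (dot B U , dot B V , dot B W) (dot C U , dot C V , dot C W)
        ≡ bracket U V W * bracket A B C
    bracket-multiplicative (u₁ , u₂ , u₃) (v₁ , v₂ , v₃) (w₁ , w₂ , w₃) (a₁ , a₂ , a₃) (b₁ , b₂ , b₃) (c₁ , c₂ , c₃) =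
      solve 18 (λ u₁ u₂ u₃ v₁ v₂ v₃ w₁ w₂ w₃ a₁ a₂ a₃ b₁ b₂ b₃ c₁ c₂ c₃ →
        let U = u₁ , u₂ , u₃ ; V = v₁ , v₂ , v₃ ; W = w₁ , w₂ , w₃ ; A = a₁ , a₂ , a₃ ; B = b₁ , b₂ , b₃ ; C = c₁ , c₂ , c₃ in
        P.bracket (P.dot A U , P.dot A V , P.dot A W) (P.dot B U , P.dot B V , P.dot B W) (P.dot C U , P.dot C V , P.dot C W)
          := P.bracket U V W :* P.bracket A B C)
        refl u₁ u₂ u₃ v₁ v₂ v₃ w₁ w₂ w₃ a₁ a₂ a₃ b₁ b₂ b₃ c₁ c₂ c₃


  span : Carrier → Triple → Carrier → Triple → Carrier → Triple → Triple
  span x U y V z W = combine 1# (combine x U y V) z W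

  abstract
    cramer : ∀ U V W X → scale (bracket U V W) X ≡ span (bracket X V W) U (bracket U X W) V (bracket U V X) W
    cramer (u₁ , u₂ , u₃) (v₁ , v₂ , v₃) (w₁ , w₂ , w₃) (x₁ , x₂ , x₃) = triple≡
      (solve 12 (λ u₁ u₂ u₃ v₁ v₂ v₃ w₁ w₂ w₃ x₁ x₂ x₃ →
        let U = u₁ , u₂ , u₃ ; V = v₁ , v₂ , v₃ ; W = w₁ , w₂ , w₃ ; X = x₁ , x₂ , x₃ in
        P.bracket U V W :* x₁ := con (ℤ.+ 1) :* (P.bracket X V W :* u₁ :+ P.bracket U X W :* v₁) :+ P.bracket U V X :* w₁)
        refl u₁ u₂ u₃ v₁ v₂ v₃ w₁ w₂ w₃ x₁ x₂ x₃)
      (solve 12 (λ u₁ u₂ u₃ v₁ v₂ v₃ w₁ w₂ w₃ x₁ x₂ x₃ →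
        let U = u₁ , u₂ , u₃ ; V = v₁ , v₂ , v₃ ; W = w₁ , w₂ , w₃ ; X = x₁ , x₂ , x₃ in
        P.bracket U V W :* x₂ := con (ℤ.+ 1) :* (P.bracket X V W :* u₂ :+ P.bracket U X W :* v₂) :+ P.bracket U V X :* w₂)
        refl u₁ u₂ u₃ v₁ v₂ v₃ w₁ w₂ w₃ x₁ x₂ x₃)
      (solve 12 (λ u₁ u₂ u₃ v₁ v₂ v₃ w₁ w₂ w₃ x₁ x₂ x₃ →
        let U = u₁ , u₂ , u₃ ; V = v₁ , v₂ , v₃ ; W = w₁ , w₂ , w₃ ; X = x₁ , x₂ , x₃ in
        P.bracket U V W :* x₃ := con (ℤ.+ 1) :* (P.bracket X V W :* u₃ :+ P.bracket U X W :* v₃) :+ P.bracket U V X :* w₃)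
        refl u₁ u₂ u₃ v₁ v₂ v₃ w₁ w₂ w₃ x₁ x₂ x₃)

    bracket-span₁ : ∀ U V W x y z → bracket (span x U y V z W) V W ≡ x * bracket U V W
    bracket-span₁ (u₁ , u₂ , u₃) (v₁ , v₂ , v₃) (w₁ , w₂ , w₃) x y z =
      solve 12 (λ u₁ u₂ u₃ v₁ v₂ v₃ w₁ w₂ w₃ x y z →
        let U = u₁ , u₂ , u₃ ; V = v₁ , v₂ , v₃ ; W = w₁ , w₂ , w₃ in
        P.bracket (P.combine (con (ℤ.+ 1)) (P.combine x U y V) z W) V W := x :* P.bracket U V W)
        refl u₁ u₂ u₃ v₁ v₂ v₃ w₁ w₂ w₃ x y z

    bracket-span₂ : ∀ U V W x y z → bracket U (span x U y V z W) W ≡ y * bracket U V W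
    bracket-span₂ (u₁ , u₂ , u₃) (v₁ , v₂ , v₃) (w₁ , w₂ , w₃) x y z =
      solve 12 (λ u₁ u₂ u₃ v₁ v₂ v₃ w₁ w₂ w₃ x y z →
        let U = u₁ , u₂ , u₃ ; V = v₁ , v₂ , v₃ ; W = w₁ , w₂ , w₃ in
        P.bracket U (P.combine (con (ℤ.+ 1)) (P.combine x U y V) z W) W := y :* P.bracket U V W)
        refl u₁ u₂ u₃ v₁ v₂ v₃ w₁ w₂ w₃ x y z

    bracket-span₃ : ∀ U V W x y z → bracket U V (span x U y V z W) ≡ z * bracket U V W
    bracket-span₃ (u₁ , u₂ , u₃) (v₁ , v₂ , v₃) (w₁ , w₂ , w₃) x y z =
      solve 12 (λ u₁ u₂ u₃ v₁ v₂ v₃ w₁ w₂ w₃ x y z →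
        let U = u₁ , u₂ , u₃ ; V = v₁ , v₂ , v₃ ; W = w₁ , w₂ , w₃ in
        P.bracket U V (P.combine (con (ℤ.+ 1)) (P.combine x U y V) z W) := z :* P.bracket U V W)
        refl u₁ u₂ u₃ v₁ v₂ v₃ w₁ w₂ w₃ x y z

    bracket-swap : ∀ U V W → bracket V U W ≡ - bracket U V W
    bracket-swap (u₁ , u₂ , u₃) (v₁ , v₂ , v₃) (w₁ , w₂ , w₃) =
      solve 9 (λ u₁ u₂ u₃ v₁ v₂ v₃ w₁ w₂ w₃ →
        let U = u₁ , u₂ , u₃ ; V = v₁ , v₂ , v₃ ; W = w₁ , w₂ , w₃ in
        P.bracket V U W := :- P.bracket U V W)
        refl u₁ u₂ u₃ v₁ v₂ v₃ w₁ w₂ w₃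

    scale-span : ∀ c x U y V z W → scale c (span x U y V z W) ≡ span (c * x) U (c * y) V (c * z) W
    scale-span c x (u₁ , u₂ , u₃) y (v₁ , v₂ , v₃) z (w₁ , w₂ , w₃) = triple≡ (coordinate u₁ v₁ w₁) (coordinate u₂ v₂ w₂) (coordinate u₃ v₃ w₃)
      where
      coordinate : ∀ u v w → c * (1# * (x * u + y * v) + z * w) ≡ 1# * (c * x * u + c * y * v) + c * z * w
      coordinate u v w = solve 7 (λ c x y z u v w → c :* (con (ℤ.+ 1) :* (x :* u :+ y :* v) :+ z :* w)
        := con (ℤ.+ 1) :* (c :* x :* u :+ c :* y :* v) :+ c :* z :* w) refl c x y z u v w

    scale-inverse : ∀ {c} → c ≢ 0# → ∀ X → scale (c ⁻¹) (scale c X) ≡ X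
    scale-inverse {c} c≢0 (x₁ , x₂ , x₃) = triple≡ (coordinate x₁) (coordinate x₂) (coordinate x₃)
      where
      coordinate : ∀ x → c ⁻¹ * (c * x) ≡ x
      coordinate x = *-cancelˡ c≢0 (trans (solve 3 (λ c i x → c :* (i :* (c :* x)) := (c :* i) :* (c :* x)) refl c (c ⁻¹) x)
        (trans (cong (_* (c * x)) (*-inverseʳ c≢0)) (*-identityˡ _)))

    cross-components : ∀ X Y → cross X Y ≡ V.cross X Y
    cross-components X Y = refl

    combine-components : ∀ s X t Y → combine s X t Y ≡ V.combine s X t Y
    combine-components s X t Y = refl

  e₁ e₂ e₃ : Triple
  e₁ = 1# , 0# , 0#
  e₂ = 0# , 1# , 0#
  e₃ = 0# , 0# , 1#

  nonzero-coordinate : ∀ {X} → NonZero3 X → proj₁ X ≢ 0# ⊎ proj₁ (proj₂ X) ≢ 0# ⊎ proj₂ (proj₂ X) ≢ 0#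
  nonzero-coordinate {x , y , z} X≢0 with ≡0? x | ≡0? y | ≡0? z
  ... | inj₂ x≢0 | _ | _ = inj₁ x≢0
  ... | inj₁ _ | inj₂ y≢0 | _ = inj₂ (inj₁ y≢0)
  ... | inj₁ _ | inj₁ _ | inj₂ z≢0 = inj₂ (inj₂ z≢0)
  ... | inj₁ x≡0 | inj₁ y≡0 | inj₁ z≡0 = contradiction (triple≡ x≡0 y≡0 z≡0) X≢0

  dot-e₁ : ∀ X → dot X e₁ ≡ proj₁ X
  dot-e₁ (x , y , z) = solve 3 (λ x y z → P.dot (x , y , z) (con (ℤ.+ 1) , con (ℤ.+ 0) , con (ℤ.+ 0)) := x) refl x y z

  dot-e₂ : ∀ X → dot X e₂ ≡ proj₁ (proj₂ X)
  dot-e₂ (x , y , z) = solve 3 (λ x y z → P.dot (x , y , z) (con (ℤ.+ 0) , con (ℤ.+ 1) , con (ℤ.+ 0)) := y) refl x y z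

  dot-e₃ : ∀ X → dot X e₃ ≡ proj₂ (proj₂ X)
  dot-e₃ (x , y , z) = solve 3 (λ x y z → P.dot (x , y , z) (con (ℤ.+ 0) , con (ℤ.+ 0) , con (ℤ.+ 1)) := z) refl x y z

  dot-nondegenerate : ∀ {X} → NonZero3 X → ∃[ Z ] dot X Z ≢ 0#
  dot-nondegenerate {X} X≢0 with nonzero-coordinate X≢0
  ... | inj₁ x≢0 = e₁ , λ eq → x≢0 (trans (sym (dot-e₁ X)) eq)
  ... | inj₂ (inj₁ y≢0) = e₂ , λ eq → y≢0 (trans (sym (dot-e₂ X)) eq)
  ... | inj₂ (inj₂ z≢0) = e₃ , λ eq → z≢0 (trans (sym (dot-e₃ X)) eq)

  dot-all-zero : ∀ {X} → (∀ Z → dot X Z ≡ 0#) → X ≡ zero3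
  dot-all-zero {X} eq = triple≡ (trans (sym (dot-e₁ X)) (eq e₁)) (trans (sym (dot-e₂ X)) (eq e₂)) (trans (sym (dot-e₃ X)) (eq e₃))

  dot≢0⇒NonZero3ʳ : ∀ {X Y} → dot X Y ≢ 0# → NonZero3 Y
  dot≢0⇒NonZero3ʳ {X} {Y} ≢0 refl = ≢0 (dot-zeroʳ X)

  abstract
    cross≡0⇒∼ : ∀ {X Y} → NonZero3 X → NonZero3 Y → cross X Y ≡ zero3 → X ∼ Y
    cross≡0⇒∼ {X@(x₁ , x₂ , x₃)} {Y@(y₁ , y₂ , y₃)} X≢0 Y≢0 eq = main
      where
      eq₂₃ : x₂ * y₃ ≡ x₃ * y₂
      eq₂₃ = sub≡0⇒≡ (cong proj₁ eq)
      eq₃₁ : x₃ * y₁ ≡ x₁ * y₃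
      eq₃₁ = sub≡0⇒≡ (cong (proj₁ ∘ proj₂) eq)
      eq₁₂ : x₁ * y₂ ≡ x₂ * y₁
      eq₁₂ = sub≡0⇒≡ (cong (proj₂ ∘ proj₂) eq)
      coordinate : ∀ {x y x′ y′} → x ≢ 0# → x * y′ ≡ x′ * y → y′ ≡ y * x ⁻¹ * x′
      coordinate {x} {y} {x′} {y′} x≢0 xy′≡x′y = *-cancelˡ x≢0 (trans xy′≡x′y (trans (sym (*-identityʳ _))
        (trans (cong (x′ * y *_) (sym (*-inverseʳ x≢0)))
          (solve 4 (λ x y x′ i → x′ :* y :* (x :* i) := x :* (y :* i :* x′)) refl x y x′ (x ⁻¹)))))
      proportional : ∀ c → Y ≡ scale c X → X ∼ Y
      proportional c Y≡cX = c , (λ c≡0 → Y≢0 (trans Y≡cX (triple≡ (vanish c≡0) (vanish c≡0) (vanish c≡0)))) , Y≡cX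
        where
        vanish : ∀ {x} → c ≡ 0# → c * x ≡ 0#
        vanish {x} c≡0 = trans (cong (_* x) c≡0) (zeroˡ x)
      main : X ∼ Y
      main with nonzero-coordinate X≢0
      ... | inj₁ x₁≢0 = proportional (y₁ * x₁ ⁻¹) (triple≡ (coordinate x₁≢0 refl) (coordinate x₁≢0 eq₁₂) (coordinate x₁≢0 (sym eq₃₁)))
      ... | inj₂ (inj₁ x₂≢0) = proportional (y₂ * x₂ ⁻¹) (triple≡ (coordinate x₂≢0 (sym eq₁₂)) (coordinate x₂≢0 refl) (coordinate x₂≢0 eq₂₃))
      ... | inj₂ (inj₂ x₃≢0) = proportional (y₃ * x₃ ⁻¹) (triple≡ (coordinate x₃≢0 eq₃₁) (coordinate x₃≢0 (sym eq₂₃)) (coordinate x₃≢0 refl))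

    bracket-nondegenerate : ∀ {X} → NonZero3 X → ∃[ Y ] ∃[ Z ] bracket X Y Z ≢ 0#
    bracket-nondegenerate {x₁ , x₂ , x₃} X≢0 with nonzero-coordinate X≢0
    ... | inj₁ x₁≢0 = e₂ , e₃ , λ eq → x₁≢0 (trans (sym (solve 3 (λ x y z →
            let o = con (ℤ.+ 0) ; i = con (ℤ.+ 1) in P.bracket (x , y , z) (o , i , o) (o , o , i) := x) refl x₁ x₂ x₃)) eq)
    ... | inj₂ (inj₁ x₂≢0) = e₃ , e₁ , λ eq → x₂≢0 (trans (sym (solve 3 (λ x y z →
            let o = con (ℤ.+ 0) ; i = con (ℤ.+ 1) in P.bracket (x , y , z) (o , o , i) (i , o , o) := y) refl x₁ x₂ x₃)) eq)
    ... | inj₂ (inj₂ x₃≢0) = e₁ , e₂ , λ eq → x₃≢0 (trans (sym (solve 3 (λ x y z →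
            let o = con (ℤ.+ 0) ; i = con (ℤ.+ 1) in P.bracket (x , y , z) (i , o , o) (o , i , o) := z) refl x₁ x₂ x₃)) eq)

    bracket-e₂e₃ : ∀ X → bracket e₂ e₃ X ≡ proj₁ X
    bracket-e₂e₃ (x , y , z) = solve 3 (λ x y z → let o = con (ℤ.+ 0) ; i = con (ℤ.+ 1) in
      P.bracket (o , i , o) (o , o , i) (x , y , z) := x) refl x y z

    bracket-e₃e₁ : ∀ X → bracket e₃ e₁ X ≡ proj₁ (proj₂ X)
    bracket-e₃e₁ (x , y , z) = solve 3 (λ x y z → let o = con (ℤ.+ 0) ; i = con (ℤ.+ 1) in
      P.bracket (o , o , i) (i , o , o) (x , y , z) := y) refl x y z

    bracket-e₁e₂ : ∀ X → bracket e₁ e₂ X ≡ proj₂ (proj₂ X)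
    bracket-e₁e₂ (x , y , z) = solve 3 (λ x y z → let o = con (ℤ.+ 0) ; i = con (ℤ.+ 1) in
      P.bracket (i , o , o) (o , i , o) (x , y , z) := z) refl x y z

    bracket-zeroˡ : ∀ Y Z → bracket zero3 Y Z ≡ 0#
    bracket-zeroˡ (y₁ , y₂ , y₃) (z₁ , z₂ , z₃) = solve 6 (λ y₁ y₂ y₃ z₁ z₂ z₃ →
      let o = con (ℤ.+ 0) in P.bracket (o , o , o) (y₁ , y₂ , y₃) (z₁ , z₂ , z₃) := o) refl y₁ y₂ y₃ z₁ z₂ z₃

  module ConicAlgebra (C : Conic) where
    open Conic C
    private module F = V.Form a b c d e f

    Q : Triple → Carrier
    Q = quadForm C

    abstract
      gradient : Triple → Triple
      gradient = F.gradient

    B : Triple → Triple → Carrier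
    B X Y = dot (gradient X) Y

    abstract
      B-comm : ∀ X Y → B X Y ≡ B Y X
      B-comm (x₁ , x₂ , x₃) (y₁ , y₂ , y₃) =
        solve 12 (λ a b c d e f x₁ x₂ x₃ y₁ y₂ y₃ →
          let X = x₁ , x₂ , x₃ ; Y = y₁ , y₂ , y₃ ; ∇ = P.Form.gradient a b c d e f ; form = P.Form.form a b c d e f in
          P.dot (∇ X) Y := P.dot (∇ Y) X)
          refl a b c d e f x₁ x₂ x₃ y₁ y₂ y₃

      B-self : ∀ X → B X X ≡ two * Q X
      B-self (x₁ , x₂ , x₃) =
        solve 9 (λ a b c d e f x₁ x₂ x₃ →
          let X = x₁ , x₂ , x₃ ; ∇ = P.Form.gradient a b c d e f ; form = P.Form.form a b c d e f in
          P.dot (∇ X) X := con (ℤ.+ 2) :* form X)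
          refl a b c d e f x₁ x₂ x₃

      Q-combine : ∀ s X t Y → Q (combine s X t Y) ≡ s * s * Q X + s * t * B X Y + t * t * Q Y
      Q-combine s (x₁ , x₂ , x₃) t (y₁ , y₂ , y₃) =
        solve 14 (λ a b c d e f s x₁ x₂ x₃ t y₁ y₂ y₃ →
          let X = x₁ , x₂ , x₃ ; Y = y₁ , y₂ , y₃ ; ∇ = P.Form.gradient a b c d e f ; form = P.Form.form a b c d e f in
          form (P.combine s X t Y) := s :* s :* form X :+ s :* t :* P.dot (∇ X) Y :+ t :* t :* form Y)
          refl a b c d e f s x₁ x₂ x₃ t y₁ y₂ y₃

      Q-scale : ∀ s X → Q (scale s X) ≡ s * s * Q X
      Q-scale s (x₁ , x₂ , x₃) =
        solve 10 (λ a b c d e f s x₁ x₂ x₃ → let form = P.Form.form a b c d e f in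
          form (s :* x₁ , s :* x₂ , s :* x₃) := s :* s :* form (x₁ , x₂ , x₃))
          refl a b c d e f s x₁ x₂ x₃

      B-combineʳ : ∀ X s Y t Z → B X (combine s Y t Z) ≡ s * B X Y + t * B X Z
      B-combineʳ X = dot-combine (gradient X)

      B-combineˡ : ∀ s X t Y Z → B (combine s X t Y) Z ≡ s * B X Z + t * B Y Z
      B-combineˡ s X t Y Z = trans (B-comm _ Z) (trans (B-combineʳ Z s X t Y)
        (cong₂ (λ u v → s * u + t * v) (B-comm Z X) (B-comm Z Y)))

      gradient-bracket : ∀ X Y Z → bracket (gradient X) (gradient Y) (gradient Z) ≡ det C * bracket X Y Z
      gradient-bracket (x₁ , x₂ , x₃) (y₁ , y₂ , y₃) (z₁ , z₂ , z₃) =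
        solve 15 (λ a b c d e f x₁ x₂ x₃ y₁ y₂ y₃ z₁ z₂ z₃ →
          let X = x₁ , x₂ , x₃ ; Y = y₁ , y₂ , y₃ ; Z = z₁ , z₂ , z₃ ; ∇ = P.Form.gradient a b c d e f ; form = P.Form.form a b c d e f in
          P.bracket (∇ X) (∇ Y) (∇ Z) := P.Form.discriminant a b c d e f :* P.bracket X Y Z)
          refl a b c d e f x₁ x₂ x₃ y₁ y₂ y₃ z₁ z₂ z₃

      -- The Gram matrix of `B` is the matrix of the form multiplied on both sides by the matrix of
      -- the three vectors. Applying multiplicativity twice avoids expanding the whole identity in
      -- coordinates.
      gram : ∀ X Y Z → det C * (bracket X Y Z * bracket X Y Z)
        ≡ symmetricDet (B X X) (B Y Y) (B Z Z) (B X Y) (B X Z) (B Y Z)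
      gram X Y Z = begin
        det C * (bracket X Y Z * bracket X Y Z)
          ≡⟨ solve 2 (λ d t → d :* (t :* t) := t :* (d :* t)) refl (det C) (bracket X Y Z) ⟩
        bracket X Y Z * (det C * bracket X Y Z)
          ≡⟨ cong (bracket X Y Z *_) (sym (gradient-bracket X Y Z)) ⟩
        bracket X Y Z * bracket (gradient X) (gradient Y) (gradient Z)
          ≡⟨ sym (bracket-multiplicative X Y Z (gradient X) (gradient Y) (gradient Z)) ⟩
        bracket (B X X , B X Y , B X Z) (B Y X , B Y Y , B Y Z) (B Z X , B Z Y , B Z Z)
          ≡⟨ cong₂ (λ u v → bracket (B X X , B X Y , B X Z) (u , B Y Y , B Y Z) (v , B Z Y , B Z Z)) (B-comm Y X) (B-comm Z X) ⟩
        bracket (B X X , B X Y , B X Z) (B X Y , B Y Y , B Y Z) (B X Z , B Z Y , B Z Z)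
          ≡⟨ cong (λ u → bracket (B X X , B X Y , B X Z) (B X Y , B Y Y , B Y Z) (B X Z , u , B Z Z)) (B-comm Z Y) ⟩
        bracket (B X X , B X Y , B X Z) (B X Y , B Y Y , B Y Z) (B X Z , B Y Z , B Z Z)
          ≡⟨ solve 6 (λ g₁₁ g₂₂ g₃₃ g₁₂ g₁₃ g₂₃ → P.bracket (g₁₁ , g₁₂ , g₁₃) (g₁₂ , g₂₂ , g₂₃) (g₁₃ , g₂₃ , g₃₃)
               := P.symmetricDet g₁₁ g₂₂ g₃₃ g₁₂ g₁₃ g₂₃) refl (B X X) (B Y Y) (B Z Z) (B X Y) (B X Z) (B Y Z) ⟩
        symmetricDet (B X X) (B Y Y) (B Z Z) (B X Y) (B X Z) (B Y Z) ∎
        where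
        open ≡-Reasoning

      gradient-cross : ∀ X Y Z → B (cross (gradient X) (gradient Y)) Z ≡ det C * dot (cross X Y) Z
      gradient-cross X Y Z = trans (B-comm _ Z) (trans (dot-comm (gradient Z) _) (gradient-bracket X Y Z))

    -- Because W lies on the conic there is no term in z², and along a line through W the form is
    -- linear in z.
    Q-span : ∀ {W} → Q W ≡ 0# → ∀ x U y V z →
      Q (span x U y V z W) ≡ (x * x * Q U + x * y * B U V + y * y * Q V) + z * (x * B U W + y * B V W)
    Q-span {W} QW≡0 x U y V z = begin
      Q (span x U y V z W)
        ≡⟨ Q-combine 1# (combine x U y V) z W ⟩
      1# * 1# * Q (combine x U y V) + 1# * z * B (combine x U y V) W + z * z * Q W
        ≡⟨ cong₂ (λ s t → 1# * 1# * s + 1# * z * t + z * z * Q W) (Q-combine x U y V) (B-combineˡ x U y V W) ⟩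
      1# * 1# * s + 1# * z * t + z * z * Q W
        ≡⟨ cong (λ u → 1# * 1# * s + 1# * z * t + z * z * u) QW≡0 ⟩
      1# * 1# * s + 1# * z * t + z * z * 0#
        ≡⟨ solve 3 (λ s t z → con (ℤ.+ 1) :* con (ℤ.+ 1) :* s :+ con (ℤ.+ 1) :* z :* t :+ z :* z :* con (ℤ.+ 0) := s :+ z :* t) refl s t z ⟩
      s + z * t ∎
      where
      open ≡-Reasoning
      s = x * x * Q U + x * y * B U V + y * y * Q V
      t = x * B U W + y * B V W

    B-spanˡ : ∀ {W} → Q W ≡ 0# → ∀ x U y V z → B (span x U y V z W) W ≡ x * B U W + y * B V W
    B-spanˡ {W} QW≡0 x U y V z = begin
      B (span x U y V z W) W
        ≡⟨ B-combineˡ 1# (combine x U y V) z W W ⟩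
      1# * B (combine x U y V) W + z * B W W
        ≡⟨ cong₂ (λ s t → 1# * s + z * t) (B-combineˡ x U y V W) (trans (B-self W) (trans (cong (two *_) QW≡0) (zeroʳ two))) ⟩
      1# * (x * B U W + y * B V W) + z * 0#
        ≡⟨ solve 2 (λ s z → con (ℤ.+ 1) :* s :+ z :* con (ℤ.+ 0) := s) refl _ z ⟩
      x * B U W + y * B V W ∎
      where
      open ≡-Reasoning

    abstract
      coefficient-a : Q e₁ ≡ a
      coefficient-a = solve 6 (λ a b c d e f → let o = con (ℤ.+ 0) ; i = con (ℤ.+ 1) ; form = P.Form.form a b c d e f in
        form (i , o , o) := a) refl a b c d e f

      coefficient-b : Q e₂ ≡ b
      coefficient-b = solve 6 (λ a b c d e f → let o = con (ℤ.+ 0) ; i = con (ℤ.+ 1) ; form = P.Form.form a b c d e f in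
        form (o , i , o) := b) refl a b c d e f

      coefficient-c : Q e₃ ≡ c
      coefficient-c = solve 6 (λ a b c d e f → let o = con (ℤ.+ 0) ; i = con (ℤ.+ 1) ; form = P.Form.form a b c d e f in
        form (o , o , i) := c) refl a b c d e f

      -- Polarisation expresses a mixed coefficient by values of the form at F-points, so that
      -- control of those values gives control of the equation.
      coefficient-d : Q (combine 1# e₁ 1# e₂) - Q e₁ - Q e₂ ≡ d
      coefficient-d = solve 6 (λ a b c d e f → let o = con (ℤ.+ 0) ; i = con (ℤ.+ 1) ; form = P.Form.form a b c d e f in
        form (P.combine i (i , o , o) i (o , i , o)) :- form (i , o , o) :- form (o , i , o) := d) refl a b c d e f

      coefficient-e : Q (combine 1# e₁ 1# e₃) - Q e₁ - Q e₃ ≡ e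
      coefficient-e = solve 6 (λ a b c d e f → let o = con (ℤ.+ 0) ; i = con (ℤ.+ 1) ; form = P.Form.form a b c d e f in
        form (P.combine i (i , o , o) i (o , o , i)) :- form (i , o , o) :- form (o , o , i) := e) refl a b c d e f

      coefficient-f : Q (combine 1# e₂ 1# e₃) - Q e₂ - Q e₃ ≡ f
      coefficient-f = solve 6 (λ a b c d e f → let o = con (ℤ.+ 0) ; i = con (ℤ.+ 1) ; form = P.Form.form a b c d e f in
        form (P.combine i (o , i , o) i (o , o , i)) :- form (o , i , o) :- form (o , o , i) := f) refl a b c d e f

-- External points and the quadratic character

module ExternalPoints (K : FiniteField) (p k q : ℕ) (p-prime : Prime p) (p≢2 : p ≢ 2) (q≡p^k : q ≡ p ℕ.^ k)
  (size≡q*q : FiniteField.size K ≡ q ℕ.* q) (C : Geometry.Conic K) (irreducible : Geometry.Irreducible K C) where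
  open CharacterSums K p k q p-prime p≢2 q≡p^k size≡q*q public
  open VectorAlgebra K public using
    (dot; cross; bracket; combine; span; symmetricDet; e₁; e₂; e₃; nonzero-coordinate;
     dot-combine; dot-comm; dot-scale; dot-zeroˡ; dot-zeroʳ; dot-crossˡ; dot-crossʳ; dot-cross-cross;
     dot-nondegenerate; dot-all-zero; dot≢0⇒NonZero3ʳ; cross≡0⇒∼; cramer; cross-components; combine-components;
     bracket-nondegenerate; bracket-zeroˡ; bracket-swap; bracket-e₂e₃; bracket-e₃e₁; bracket-e₁e₂;
     bracket-span₁; bracket-span₂; bracket-span₃; scale-span; scale-inverse)
  open VectorAlgebra.ConicAlgebra K C public
  open Geometry K public hiding (_^_)
  open ≡-Reasoning

  -- P is external exactly when κ Q(P) is a nonzero square.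
  κ : Carrier
  κ = - (two * det C)

  gradient-≢0 : ∀ {X} → NonZero3 X → NonZero3 (gradient X)
  gradient-≢0 {X} X≢0 gX≡0 = let Y , Z , bracket≢0 = bracket-nondegenerate X≢0 in *-nonzero irreducible bracket≢0 (begin
    det C * bracket X Y Z                                    ≡⟨ sym (gradient-bracket X Y Z) ⟩
    bracket (gradient X) (gradient Y) (gradient Z)           ≡⟨ cong (λ g → bracket g (gradient Y) (gradient Z)) gX≡0 ⟩
    bracket zero3 (gradient Y) (gradient Z)                  ≡⟨ bracket-zeroˡ _ _ ⟩
    0# ∎)

  private
    0+0 : ∀ {x y} → x ≡ 0# → y ≡ 0# → x + y ≡ 0#
    0+0 x≡0 y≡0 = trans (cong₂ _+_ x≡0 y≡0) (+-identityˡ 0#)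

    *0 : ∀ {x y} → y ≡ 0# → x * y ≡ 0#
    *0 {x} y≡0 = trans (cong (x *_) y≡0) (zeroʳ x)

  B-self≡0 : ∀ {X} → OnConic C X → B X X ≡ 0#
  B-self≡0 {X} QX≡0 = trans (B-self X) (*0 QX≡0)

  -- If B(X, P) ≠ 0 then Q(P) X - B(X, P) P is a second point of the conic on the line XP.
  tangent⇒polar : ∀ {ℓ X P} → dot ℓ X ≡ 0# → dot ℓ P ≡ 0# → OnConic C X →
    (∀ Y → NonZero3 Y → OnConic C Y → OnLine ℓ Y → X ∼ Y) → B X P ≡ 0#
  tangent⇒polar {ℓ} {X} {P} ℓX ℓP QX unique with ≡0? (B X P)
  ... | inj₁ eq = eq
  ... | inj₂ b≢0 with unique Y (dot≢0⇒NonZero3ʳ {gradient X} BXY≢0) QY (trans (dot-combine ℓ (Q P) X (- b) P) (0+0 (*0 ℓX) (*0 ℓP)))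
    where
    b = B X P
    Y = combine (Q P) X (- b) P
    BXY : B X Y ≡ - b * b
    BXY = trans (B-combineʳ X (Q P) X (- b) P) (trans (cong (_+ - b * b) (*0 (B-self≡0 QX))) (+-identityˡ _))
    BXY≢0 : B X Y ≢ 0#
    BXY≢0 eq = *-nonzero (-‿nonzero b≢0) b≢0 (trans (sym BXY) eq)
    QY : Q Y ≡ 0#
    QY = begin
      Q Y
        ≡⟨ Q-combine (Q P) X (- b) P ⟩
      Q P * Q P * Q X + Q P * - b * b + - b * - b * Q P
        ≡⟨ cong (λ t → t + Q P * - b * b + - b * - b * Q P) (*0 QX) ⟩
      0# + Q P * - b * b + - b * - b * Q P
        ≡⟨ solve 2 (λ s b → con (ℤ.+ 0) :+ s :* :- b :* b :+ :- b :* :- b :* s := con (ℤ.+ 0)) refl (Q P) b ⟩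
      0# ∎
  ...   | c , _ , Y≡cX = contradiction (begin
      - B X P * B X P                       ≡⟨ sym (trans (B-combineʳ X (Q P) X (- B X P) P) (trans (cong (_+ - B X P * B X P) (*0 (B-self≡0 QX))) (+-identityˡ _))) ⟩
      B X (combine (Q P) X (- B X P) P)     ≡⟨ cong (B X) Y≡cX ⟩
      B X (scale c X)                       ≡⟨ dot-comm (gradient X) _ ⟩
      dot (scale c X) (gradient X)          ≡⟨ dot-scale c X (gradient X) ⟩
      c * dot X (gradient X)                ≡⟨ *0 (trans (dot-comm X _) (B-self≡0 QX)) ⟩
      0# ∎) (*-nonzero (-‿nonzero b≢0) b≢0)

  symmetricDet-isotropic : ∀ p z b c → symmetricDet 0# p z 0# b c ≡ - (b * b * p)
  symmetricDet-isotropic p z b c =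
    solve 4 (λ p z b c → let o = con (ℤ.+ 0) in
      o :* (p :* z :- c :* c) :- o :* (o :* z :- c :* b) :+ b :* (o :* c :- p :* b) := :- (b :* b :* p)) refl p z b c

  -- Let X be the contact point of a tangent through P, so that B(X, P) = 0, and let b = B(X, Z) be
  -- nonzero. The Gram determinant of X, P, Z collapses to -2 b² Q(P), which exhibits κ Q(P) b² as
  -- the square of det(C) times the bracket of X, P, Z.
  external⇒χ≡1 : ∀ {P} → External C P → χ (κ * Q P) ≡ 1ℤ
  external⇒χ≡1 {P} (_ , QP≢0 , ℓ , _ , (_ , X , X≢0 , QX , ℓX , unique) , _ , _ , ℓP , _) = begin
    χ (κ * Q P)                              ≡⟨ sym (ℤₚ.*-identityʳ _) ⟩
    χ (κ * Q P) ℤ.* 1ℤ                       ≡⟨ cong (χ (κ * Q P) ℤ.*_) (sym (χ-square b≢0)) ⟩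
    χ (κ * Q P) ℤ.* χ (b * b)                ≡⟨ sym (χ-* _ _) ⟩
    χ (κ * Q P * (b * b))                    ≡⟨ cong χ (begin
        κ * Q P * (b * b)
          ≡⟨ solve 4 (λ t d s b → :- (t :* d) :* s :* (b :* b) := d :* (:- (b :* b :* (t :* s)))) refl two (det C) (Q P) b ⟩
        det C * - (b * b * (two * Q P))
          ≡⟨ cong (det C *_) (sym gram-XPZ) ⟩
        det C * (det C * (t * t))
          ≡⟨ solve 2 (λ d t → d :* (d :* (t :* t)) := (d :* t) :* (d :* t)) refl (det C) t ⟩
        (det C * t) * (det C * t) ∎) ⟩
    χ ((det C * t) * (det C * t))            ≡⟨ χ-square (*-nonzero irreducible t≢0) ⟩
    1ℤ ∎
    where
    polar = tangent⇒polar {ℓ} {X} {P} ℓX ℓP QX unique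
    Z = proj₁ (dot-nondegenerate (gradient-≢0 X≢0))
    b = B X Z
    b≢0 : b ≢ 0#
    b≢0 = proj₂ (dot-nondegenerate (gradient-≢0 X≢0))
    t = bracket X P Z
    gram-XPZ : det C * (t * t) ≡ - (b * b * (two * Q P))
    gram-XPZ = begin
      det C * (t * t)
        ≡⟨ gram X P Z ⟩
      symmetricDet (B X X) (B P P) (B Z Z) (B X P) b (B P Z)
        ≡⟨ cong₂ (λ u v → symmetricDet u (B P P) (B Z Z) v b (B P Z)) (B-self≡0 QX) polar ⟩
      symmetricDet 0# (B P P) (B Z Z) 0# b (B P Z)
        ≡⟨ symmetricDet-isotropic (B P P) (B Z Z) b (B P Z) ⟩
      - (b * b * B P P)
        ≡⟨ cong (λ u → - (b * b * u)) (B-self P) ⟩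
      - (b * b * (two * Q P)) ∎
    t≢0 : t ≢ 0#
    t≢0 t≡0 = -‿nonzero (*-nonzero (*-nonzero b≢0 b≢0) (*-nonzero 2≢0 QP≢0)) (trans (sym gram-XPZ) (*0 (*0 t≡0)))

  -- For every third vector Z the Gram determinant vanishes, hence so does the bracket of X, Y, Z.
  -- This means that the cross product of X and Y is zero.
  isotropic-orthogonal⇒∼ : ∀ {X Y} → NonZero3 X → NonZero3 Y → OnConic C X → OnConic C Y → B X Y ≡ 0# → X ∼ Y
  isotropic-orthogonal⇒∼ {X} {Y} X≢0 Y≢0 QX QY BXY = cross≡0⇒∼ X≢0 Y≢0 cross≡0
    where
    bracket≡0 : ∀ Z → bracket X Y Z ≡ 0#
    bracket≡0 Z with ≡0? (bracket X Y Z)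
    ... | inj₁ eq = eq
    ... | inj₂ ≢0 = contradiction (begin
      det C * (bracket X Y Z * bracket X Y Z)
        ≡⟨ gram X Y Z ⟩
      symmetricDet (B X X) (B Y Y) (B Z Z) (B X Y) (B X Z) (B Y Z)
        ≡⟨ cong₂ (λ u v → symmetricDet u (B Y Y) (B Z Z) v (B X Z) (B Y Z)) (B-self≡0 QX) BXY ⟩
      symmetricDet 0# (B Y Y) (B Z Z) 0# (B X Z) (B Y Z)
        ≡⟨ symmetricDet-isotropic (B Y Y) (B Z Z) (B X Z) (B Y Z) ⟩
      - (B X Z * B X Z * B Y Y)
        ≡⟨ trans (cong -_ (*0 (B-self≡0 QY))) -0#≈0# ⟩
      0# ∎) (*-nonzero irreducible (*-nonzero ≢0 ≢0))
    cross≡0 : cross X Y ≡ zero3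
    cross≡0 = dot-all-zero bracket≡0

  polar-tangent : ∀ {X} → NonZero3 X → OnConic C X → Tangent C (gradient X)
  polar-tangent {X} X≢0 QX = gradient-≢0 X≢0 , X , X≢0 , QX , B-self≡0 QX ,
    λ Y Y≢0 QY BXY → isotropic-orthogonal⇒∼ X≢0 Y≢0 QX QY BXY

  -- The second isotropic point of the polar line of P is the reflection of an arbitrary vector R of that line,
  -- not orthogonal to X: it is Q(R) X - B(X, R) R.
  isotropic-polar⇒external : ∀ {P X} → NonZero3 P → Q P ≢ 0# → NonZero3 X → OnConic C X → B P X ≡ 0# → External C P
  isotropic-polar⇒external {P} {X} P≢0 QP≢0 X≢0 QX BPX =
    P≢0 , QP≢0 , gradient X , gradient X′ , polar-tangent X≢0 QX , polar-tangent X′≢0 QX′ , distinct ,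
    trans (B-comm X P) BPX , trans (B-comm X′ P) BPX′
    where
    Z = proj₁ (dot-nondegenerate (gradient-≢0 X≢0))
    -- The projection of Z to the polar line of P, multiplied by 2 Q(P) to clear the denominator.
    R = combine (two * Q P) Z (- B P Z) P
    BPR : B P R ≡ 0#
    BPR = begin
      B P R                                          ≡⟨ B-combineʳ P (two * Q P) Z (- B P Z) P ⟩
      two * Q P * B P Z + - B P Z * B P P            ≡⟨ cong (λ t → two * Q P * B P Z + - B P Z * t) (B-self P) ⟩
      two * Q P * B P Z + - B P Z * (two * Q P)      ≡⟨ solve 2 (λ s b → s :* b :+ :- b :* s := con (ℤ.+ 0)) refl (two * Q P) (B P Z) ⟩
      0# ∎
    u = B X R
    u≢0 : u ≢ 0#
    u≢0 u≡0 = *-nonzero (*-nonzero 2≢0 QP≢0) (proj₂ (dot-nondegenerate (gradient-≢0 X≢0))) (begin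
      two * Q P * B X Z                              ≡⟨ sym (+-identityʳ _) ⟩
      two * Q P * B X Z + 0#                         ≡⟨ cong (two * Q P * B X Z +_) (sym (*0 (trans (B-comm X P) BPX))) ⟩
      two * Q P * B X Z + - B P Z * B X P            ≡⟨ sym (B-combineʳ X (two * Q P) Z (- B P Z) P) ⟩
      u                                              ≡⟨ u≡0 ⟩
      0# ∎)
    X′ = combine (Q R) X (- u) R
    QX′ : Q X′ ≡ 0#
    QX′ = begin
      Q X′                                                  ≡⟨ Q-combine (Q R) X (- u) R ⟩
      Q R * Q R * Q X + Q R * - u * u + - u * - u * Q R     ≡⟨ cong (λ t → t + Q R * - u * u + - u * - u * Q R) (*0 QX) ⟩
      0# + Q R * - u * u + - u * - u * Q R
        ≡⟨ solve 2 (λ s u → con (ℤ.+ 0) :+ s :* :- u :* u :+ :- u :* :- u :* s := con (ℤ.+ 0)) refl (Q R) u ⟩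
      0# ∎
    BPX′ : B P X′ ≡ 0#
    BPX′ = trans (B-combineʳ P (Q R) X (- u) R) (0+0 (*0 BPX) (*0 BPR))
    BXX′≢0 : B X X′ ≢ 0#
    BXX′≢0 eq = *-nonzero (-‿nonzero u≢0) u≢0 (begin
      - u * u                      ≡⟨ sym (+-identityˡ _) ⟩
      0# + - u * u                 ≡⟨ cong (_+ - u * u) (sym (*0 (B-self≡0 QX))) ⟩
      Q R * B X X + - u * u        ≡⟨ sym (B-combineʳ X (Q R) X (- u) R) ⟩
      B X X′                       ≡⟨ eq ⟩
      0# ∎)
    X′≢0 : NonZero3 X′
    X′≢0 = dot≢0⇒NonZero3ʳ {gradient X} BXX′≢0
    distinct : ¬ (gradient X ∼ gradient X′)
    distinct (c , _ , eq) = BXX′≢0 (begin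
      B X X′                           ≡⟨ B-comm X X′ ⟩
      dot (gradient X′) X              ≡⟨ cong (λ g → dot g X) eq ⟩
      dot (scale c (gradient X)) X     ≡⟨ dot-scale c (gradient X) X ⟩
      c * B X X                        ≡⟨ *0 (B-self≡0 QX) ⟩
      0# ∎)

  -- When W is not on the polar line of P, its projection R to that line has Q(R) ≠ 0, and R′ completes P, R to
  -- an orthogonal basis with Q(R′) = - κ Q(P) Q(R); a square root s of κ Q(P) makes R′ + s R isotropic.
  χ≡1⇒external : ∀ {P W} → NonZero3 W → OnConic C W → NonZero3 P → χ (κ * Q P) ≡ 1ℤ → External C P
  χ≡1⇒external {P} {W} W≢0 QW P≢0 χ≡1 with ≡0? (B P W)
  ... | inj₁ BPW = isotropic-polar⇒external P≢0 (*-nonzeroʳ (χ≡1⇒≢0 χ≡1)) W≢0 QW BPW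
  ... | inj₂ b≢0 = isotropic-polar⇒external P≢0 QP≢0 X≢0 QX BPX
    where
    QP≢0 : Q P ≢ 0#
    QP≢0 = *-nonzeroʳ (χ≡1⇒≢0 χ≡1)
    b = B P W
    s = proj₁ (χ≡1⇒square χ≡1)
    s*s≡ : s * s ≡ κ * Q P
    s*s≡ = proj₂ (χ≡1⇒square χ≡1)
    s≢0 : s ≢ 0#
    s≢0 s≡0 = χ≡1⇒≢0 χ≡1 (trans (sym s*s≡) (*0 s≡0))
    R = combine (two * Q P) W (- b) P
    BPR : B P R ≡ 0#
    BPR = begin
      B P R                                  ≡⟨ B-combineʳ P (two * Q P) W (- b) P ⟩
      two * Q P * b + - b * B P P            ≡⟨ cong (λ t → two * Q P * b + - b * t) (B-self P) ⟩
      two * Q P * b + - b * (two * Q P)      ≡⟨ solve 2 (λ s b → s :* b :+ :- b :* s := con (ℤ.+ 0)) refl (two * Q P) b ⟩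
      0# ∎
    QR : Q R ≡ - (b * b * Q P)
    QR = begin
      Q R
        ≡⟨ Q-combine (two * Q P) W (- b) P ⟩
      two * Q P * (two * Q P) * Q W + two * Q P * - b * B W P + - b * - b * Q P
        ≡⟨ cong₂ (λ t v → t + two * Q P * - b * v + - b * - b * Q P) (*0 QW) (B-comm W P) ⟩
      0# + two * Q P * - b * b + - b * - b * Q P
        ≡⟨ solve 2 (λ y b → con (ℤ.+ 0) :+ con (ℤ.+ 2) :* y :* :- b :* b :+ :- b :* :- b :* y := :- (b :* b :* y)) refl (Q P) b ⟩
      - (b * b * Q P) ∎
    QR≢0 : Q R ≢ 0#
    QR≢0 eq = -‿nonzero (*-nonzero (*-nonzero b≢0 b≢0) QP≢0) (trans (sym QR) eq)
    R′ = cross (gradient P) (gradient R)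
    BPR′ : B P R′ ≡ 0#
    BPR′ = dot-crossˡ (gradient P) (gradient R)
    BRR′ : B R R′ ≡ 0#
    BRR′ = dot-crossʳ (gradient P) (gradient R)
    -- Lagrange's identity for the inner product of two cross products; its mixed term disappears
    -- because P and R are orthogonal.
    QR′ : Q R′ ≡ two * det C * Q P * Q R
    QR′ = *-cancelˡ 2≢0 (begin
      two * Q R′
        ≡⟨ sym (B-self R′) ⟩
      B R′ R′
        ≡⟨ gradient-cross P R R′ ⟩
      det C * dot (cross P R) R′
        ≡⟨ cong (det C *_) (dot-cross-cross P R (gradient P) (gradient R)) ⟩
      det C * (dot P (gradient P) * dot R (gradient R) - dot P (gradient R) * dot R (gradient P))
        ≡⟨ cong₂ (λ x y → det C * (x - y))
             (cong₂ _*_ (trans (dot-comm P _) (B-self P)) (trans (dot-comm R _) (B-self R)))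
             (*0 (trans (dot-comm R _) BPR)) ⟩
      det C * (two * Q P * (two * Q R) - 0#)
        ≡⟨ solve 4 (λ t d x y → d :* (t :* x :* (t :* y) :- con (ℤ.+ 0)) := t :* (t :* d :* x :* y)) refl two (det C) (Q P) (Q R) ⟩
      two * (two * det C * Q P * Q R) ∎)
    X = combine 1# R′ s R
    QX : Q X ≡ 0#
    QX = begin
      Q X
        ≡⟨ Q-combine 1# R′ s R ⟩
      1# * 1# * Q R′ + 1# * s * B R′ R + s * s * Q R
        ≡⟨ cong (λ t → 1# * 1# * Q R′ + t + s * s * Q R) (*0 (trans (B-comm R′ R) BRR′)) ⟩
      1# * 1# * Q R′ + 0# + s * s * Q R
        ≡⟨ cong₂ (λ x y → 1# * 1# * x + 0# + y * Q R) QR′ s*s≡ ⟩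
      1# * 1# * (two * det C * Q P * Q R) + 0# + κ * Q P * Q R
        ≡⟨ solve 4 (λ t d x y → con (ℤ.+ 1) :* con (ℤ.+ 1) :* (t :* d :* x :* y) :+ con (ℤ.+ 0) :+ :- (t :* d) :* x :* y := con (ℤ.+ 0))
             refl two (det C) (Q P) (Q R) ⟩
      0# ∎
    BPX : B P X ≡ 0#
    BPX = trans (B-combineʳ P 1# R′ s R) (0+0 (*0 BPR′) (*0 BPR))
    BRX≢0 : B R X ≢ 0#
    BRX≢0 eq = *-nonzero s≢0 (*-nonzero 2≢0 QR≢0) (begin
      s * (two * Q R)              ≡⟨ cong (s *_) (sym (B-self R)) ⟩
      s * B R R                    ≡⟨ sym (+-identityˡ _) ⟩
      0# + s * B R R               ≡⟨ cong (_+ s * B R R) (sym (*0 BRR′)) ⟩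
      1# * B R R′ + s * B R R      ≡⟨ sym (B-combineʳ R 1# R′ s R) ⟩
      B R X                        ≡⟨ eq ⟩
      0# ∎)
    X≢0 : NonZero3 X
    X≢0 = dot≢0⇒NonZero3ʳ {gradient R} BRX≢0

-- On the values 0, 1, -1 the polynomial v² + v is twice the indicator of v = 1. Hence the factor 2
-- in front of all later counts.
length-filter-≡1 : ∀ {A : Set} (v : A → ℤ) → (∀ x → v x ≡ 0ℤ ⊎ v x ≡ 1ℤ ⊎ v x ≡ -1ℤ) → ∀ xs →
  ℤ.+ 2 ℤ.* ℤ.+ length (filter (λ x → v x ℤ.≟ 1ℤ) xs) ≡ ∑ xs (λ x → v x ℤ.* v x ℤ.+ v x)
length-filter-≡1 v vals [] = refl
length-filter-≡1 v vals (x ∷ xs) with v x ℤ.≟ 1ℤ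
... | yes vx≡1 = begin
  ℤ.+ 2 ℤ.* (1ℤ ℤ.+ n)                    ≡⟨ ℤₚ.*-distribˡ-+ (ℤ.+ 2) 1ℤ n ⟩
  ℤ.+ 2 ℤ.+ ℤ.+ 2 ℤ.* n                   ≡⟨ cong₂ ℤ._+_ (sym (cong (λ t → t ℤ.* t ℤ.+ t) vx≡1)) (length-filter-≡1 v vals xs) ⟩
  v x ℤ.* v x ℤ.+ v x ℤ.+ ∑ xs (λ x → v x ℤ.* v x ℤ.+ v x) ∎
  where
  open ≡-Reasoning
  n = ℤ.+ length (filter (λ x → v x ℤ.≟ 1ℤ) xs)
... | no vx≢1 = trans (length-filter-≡1 v vals xs) (trans (sym (ℤₚ.+-identityˡ _))
  (cong (ℤ._+ ∑ xs (λ x → v x ℤ.* v x ℤ.+ v x)) (sym (vanish (vals x)))))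
  where
  vanish : v x ≡ 0ℤ ⊎ v x ≡ 1ℤ ⊎ v x ≡ -1ℤ → v x ℤ.* v x ℤ.+ v x ≡ 0ℤ
  vanish (inj₁ eq) = cong (λ t → t ℤ.* t ℤ.+ t) eq
  vanish (inj₂ (inj₁ eq)) = contradiction eq vx≢1
  vanish (inj₂ (inj₂ eq)) = cong (λ t → t ℤ.* t ℤ.+ t) eq

-- Frames at an F-point of the conic, and counting along the lines through it

module Frames (K : FiniteField) (p k q : ℕ) (p-prime : Prime p) (p≢2 : p ≢ 2) (q≡p^k : q ≡ p ℕ.^ k)
  (size≡q*q : FiniteField.size K ≡ q ℕ.* q) (C : Geometry.Conic K) (irreducible : Geometry.Irreducible K C) where
  open ExternalPoints K p k q p-prime p≢2 q≡p^k size≡q*q C irreducible public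
  open SubGeometry q public hiding (InFq)
  open ≡-Reasoning

  power≡ : ∀ x n → Geometry._^_ K x n ≡ x ^ n
  power≡ x ℕ.zero = refl
  power≡ x (ℕ.suc n) = cong (x *_) (power≡ x n)

  InF3 : Triple → Set
  InF3 (x , y , z) = InF x × InF y × InF z

  FqPoint⇒InF3 : ∀ {X} → FqPoint X → InF3 X
  FqPoint⇒InF3 {x , y , z} (_ , x∈ , y∈ , z∈) = trans (sym (power≡ x q)) x∈ , trans (sym (power≡ y q)) y∈ , trans (sym (power≡ z q)) z∈

  InF3⇒FqPoint : ∀ {X} → NonZero3 X → InF3 X → FqPoint X
  InF3⇒FqPoint {x , y , z} X≢0 (x∈ , y∈ , z∈) = X≢0 , trans (power≡ x q) x∈ , trans (power≡ y q) y∈ , trans (power≡ z q) z∈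

  InF-dot : ∀ {X Y} → InF3 X → InF3 Y → InF (dot X Y)
  InF-dot (x₁ , x₂ , x₃) (y₁ , y₂ , y₃) = InF-+ (InF-+ (InF-* x₁ y₁) (InF-* x₂ y₂)) (InF-* x₃ y₃)

  InF-bracket : ∀ {X Y Z} → InF3 X → InF3 Y → InF3 Z → InF (bracket X Y Z)
  InF-bracket {X} {Y} (x₁ , x₂ , x₃) (y₁ , y₂ , y₃) Z∈ = InF-dot (subst InF3 (sym (cross-components X Y))
    ( InF-sub (InF-* x₂ y₃) (InF-* x₃ y₂) , InF-sub (InF-* x₃ y₁) (InF-* x₁ y₃) , InF-sub (InF-* x₁ y₂) (InF-* x₂ y₁))) Z∈

  InF3-combine : ∀ {s X t Y} → InF s → InF3 X → InF t → InF3 Y → InF3 (combine s X t Y)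
  InF3-combine {s} {X} {t} {Y} s∈ (x₁ , x₂ , x₃) t∈ (y₁ , y₂ , y₃) = subst InF3 (sym (combine-components s X t Y))
    (InF-+ (InF-* s∈ x₁) (InF-* t∈ y₁) , InF-+ (InF-* s∈ x₂) (InF-* t∈ y₂) , InF-+ (InF-* s∈ x₃) (InF-* t∈ y₃))

  InF3-span : ∀ {x U y V z W} → InF x → InF3 U → InF y → InF3 V → InF z → InF3 W → InF3 (span x U y V z W)
  InF3-span x∈ U∈ y∈ V∈ z∈ W∈ = InF3-combine σ-1 (InF3-combine x∈ U∈ y∈ V∈) z∈ W∈

  χ-values : ∀ x → χ x ≡ 0ℤ ⊎ χ x ≡ 1ℤ ⊎ χ x ≡ -1ℤ
  χ-values x with ≡0? x
  ... | inj₁ x≡0 = inj₁ (χ-0 x≡0)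
  ... | inj₂ x≢0 = inj₂ (χ-±1 x≢0)

  χ-*-square : ∀ x {y} → y ≢ 0# → χ (x * (y * y)) ≡ χ x
  χ-*-square x y≢0 = trans (χ-* x _) (trans (cong (χ x ℤ.*_) (χ-square y≢0)) (ℤₚ.*-identityʳ _))

  record Frame : Set where
    field
      U V W : Triple
      U∈ : InF3 U
      V∈ : InF3 V
      W∈ : InF3 W
      independent : bracket U V W ≢ 0#
      QW≡0 : Q W ≡ 0#

  -- The lines through the third vector W of a frame: slope y is spanned by W and U + y V, and ∞ by W and V.
  data Direction : Set where
    ∞ : Direction
    slope : Carrier → Direction

  module FrameTheory (Fr : Frame) where
    open Frame Fr

    -- In the frame, g = a x² + h x y + b y² and l = e x + f y. The constant `γ` is g(f, -e), the
    -- value of g where l vanishes, that is, the value of the form on the tangent at W.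
    D a b h e f γ : Carrier
    D = bracket U V W
    a = Q U
    b = Q V
    h = B U V
    e = B U W
    f = B V W
    γ = a * (f * f) - h * (e * f) + b * (e * e)

    quad lin : Direction → Carrier
    quad ∞ = b
    quad (slope y) = a + y * h + y * y * b
    lin ∞ = f
    lin (slope y) = e + y * f

    point : Direction → Carrier → Triple
    point ∞ z = span 0# U 1# V z W
    point (slope y) z = span 1# U y V z W

    Q-point : ∀ d z → Q (point d z) ≡ quad d + z * lin d
    Q-point ∞ z = trans (Q-span QW≡0 0# U 1# V z)
      (solve 6 (λ a h b e f z → let o = con (ℤ.+ 0) ; i = con (ℤ.+ 1) in
        (o :* o :* a :+ o :* i :* h :+ i :* i :* b) :+ z :* (o :* e :+ i :* f) := b :+ z :* f) refl a h b e f z)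
    Q-point (slope y) z = trans (Q-span QW≡0 1# U y V z)
      (solve 7 (λ a h b e f y z → let i = con (ℤ.+ 1) in
        (i :* i :* a :+ i :* y :* h :+ y :* y :* b) :+ z :* (i :* e :+ y :* f) := (a :+ y :* h :+ y :* y :* b) :+ z :* (e :+ y :* f))
        refl a h b e f y z)

    -- The Gram determinant of the frame, in which B(W, W) = 0. Since κ and `γ` differ by squares
    -- only, `γ` can replace κ in every character, and it is a polynomial in the coefficients that
    -- also locate the base points.
    κD²≡4γ : κ * (D * D) ≡ two * two * γ
    κD²≡4γ = begin
      κ * (D * D)
        ≡⟨ solve 3 (λ t d s → :- (t :* d) :* s := :- (t :* (d :* s))) refl two (det C) (D * D) ⟩
      - (two * (det C * (D * D)))
        ≡⟨ cong (λ s → - (two * s)) (gram U V W) ⟩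
      - (two * symmetricDet (B U U) (B V V) (B W W) h e f)
        ≡⟨ cong₂ (λ s t → - (two * symmetricDet s t (B W W) h e f)) (B-self U) (B-self V) ⟩
      - (two * symmetricDet (two * a) (two * b) (B W W) h e f)
        ≡⟨ cong (λ t → - (two * symmetricDet (two * a) (two * b) t h e f)) (B-self≡0 QW≡0) ⟩
      - (two * symmetricDet (two * a) (two * b) 0# h e f)
        ≡⟨ solve 5 (λ a b h e f → let o = con (ℤ.+ 0) ; t = con (ℤ.+ 2) in
             :- (t :* (t :* a :* (t :* b :* o :- f :* f) :- h :* (h :* o :- f :* e) :+ e :* (h :* f :- t :* b :* e)))
               := t :* t :* (a :* (f :* f) :- h :* (e :* f) :+ b :* (e :* e))) refl a b h e f ⟩
      two * two * γ ∎

    γ≢0 : γ ≢ 0#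
    γ≢0 = *-nonzeroʳ λ 4γ≡0 → *-nonzero (-‿nonzero (*-nonzero 2≢0 irreducible)) (*-nonzero independent independent) (trans κD²≡4γ 4γ≡0)

    χ-κ≡χ-γ : ∀ x → χ (κ * x) ≡ χ (γ * x)
    χ-κ≡χ-γ x = begin
      χ (κ * x)                    ≡⟨ sym (χ-*-square (κ * x) independent) ⟩
      χ (κ * x * (D * D))          ≡⟨ cong χ (solve 3 (λ k x s → k :* x :* s := (k :* s) :* x) refl κ x (D * D)) ⟩
      χ (κ * (D * D) * x)          ≡⟨ cong (λ t → χ (t * x)) κD²≡4γ ⟩
      χ (two * two * γ * x)        ≡⟨ cong χ (solve 3 (λ t g x → t :* t :* g :* x := g :* x :* (t :* t)) refl two γ x) ⟩
      χ (γ * x * (two * two))      ≡⟨ χ-*-square (γ * x) 2≢0 ⟩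
      χ (γ * x) ∎

    -- The points other than W, one representative each.
    indices : List (Direction × Carrier)
    indices = map (∞ ,_) F ++ cartesianProductWith (λ y z → slope y , z) F F

    value : Direction × Carrier → ℤ
    value (d , z) = χ (γ * (quad d + z * lin d))

    χ-point : ∀ d z → χ (κ * Q (point d z)) ≡ value (d , z)
    χ-point d z = trans (χ-κ≡χ-γ _) (cong (λ t → χ (γ * t)) (Q-point d z))

    indices-unique : Unique indices
    indices-unique = Uniqueₚ.++⁺ (Uniqueₚ.map⁺ (λ { refl → refl }) F-unique)
      (Uniqueₚ.cartesianProductWith⁺ _ (λ { refl → refl , refl }) F-unique F-unique)
      λ (i∈∞ , i∈slope) → disjoint (∈-map⁻ (∞ ,_) i∈∞) (∈-cartesianProductWith⁻ (λ y z → slope y , z) F F i∈slope)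
      where
      disjoint : ∀ {i} → (∃[ z ] z ∈ F × i ≡ (∞ , z)) → ¬ (∃[ y ] ∃[ z ] y ∈ F × z ∈ F × i ≡ (slope y , z))
      disjoint (_ , _ , refl) (_ , _ , _ , _ , ())

    InF-index : Direction × Carrier → Set
    InF-index (∞ , z) = InF z
    InF-index (slope y , z) = InF y × InF z

    indices-InF : ∀ {i} → i ∈ indices → InF-index i
    indices-InF i∈ with ∈-++⁻ (map (∞ ,_) F) i∈
    ... | inj₁ i∈∞ with ∈-map⁻ (∞ ,_) i∈∞
    ...   | z , z∈ , refl = F-InF z∈
    indices-InF i∈ | inj₂ i∈slope with ∈-cartesianProductWith⁻ (λ y z → slope y , z) F F i∈slope
    ...   | y , z , y∈ , z∈ , refl = F-InF y∈ , F-InF z∈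

    ∈-indices : ∀ i → InF-index i → i ∈ indices
    ∈-indices (∞ , z) z∈ = ∈-++⁺ˡ (∈-map⁺ (∞ ,_) (∈-F z∈))
    ∈-indices (slope y , z) (y∈ , z∈) = ∈-++⁺ʳ (map (∞ ,_) F) (∈-cartesianProductWith⁺ (λ y z → slope y , z) (∈-F y∈) (∈-F z∈))

    point-InF3 : ∀ i → InF-index i → InF3 (point (proj₁ i) (proj₂ i))
    point-InF3 (∞ , z) z∈ = InF3-span σ-0 U∈ σ-1 V∈ z∈ W∈
    point-InF3 (slope y , z) (y∈ , z∈) = InF3-span σ-1 U∈ y∈ V∈ z∈ W∈

    span-∼⇒coordinates : ∀ {c x y z x′ y′ z′} → span x′ U y′ V z′ W ≡ scale c (span x U y V z W) →
      x′ ≡ c * x × y′ ≡ c * y × z′ ≡ c * z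
    span-∼⇒coordinates {c} {x} {y} {z} {x′} {y′} {z′} eq =
      coordinate (λ X → bracket X V W) (bracket-span₁ U V W) ,
      coordinate (λ X → bracket U X W) (bracket-span₂ U V W) ,
      coordinate (λ X → bracket U V X) (bracket-span₃ U V W)
      where
      eq′ : span x′ U y′ V z′ W ≡ span (c * x) U (c * y) V (c * z) W
      eq′ = trans eq (scale-span c x U y V z W)
      coordinate : ∀ (φ : Triple → Carrier) {π : Carrier → Carrier → Carrier → Carrier} →
        (∀ x y z → φ (span x U y V z W) ≡ π x y z * D) → π x′ y′ z′ ≡ π (c * x) (c * y) (c * z)
      coordinate φ φ-span = *-cancelˡ independent (trans (*-comm _ _) (trans (sym (φ-span _ _ _)) (trans (cong φ eq′) (trans (φ-span _ _ _) (*-comm _ _)))))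

    point-distinct : ∀ i j → point (proj₁ i) (proj₂ i) ∼ point (proj₁ j) (proj₂ j) → i ≡ j
    point-distinct (∞ , z) (∞ , z′) (c , _ , eq) with span-∼⇒coordinates eq
    ... | _ , 1≡c , z′≡cz = cong (∞ ,_) (sym (trans z′≡cz (trans (cong (_* z) (sym (trans 1≡c (*-identityʳ c)))) (*-identityˡ z))))
    point-distinct (∞ , z) (slope y′ , z′) (c , _ , eq) with span-∼⇒coordinates eq
    ... | 1≡0 , _ , _ = contradiction (trans 1≡0 (zeroʳ c)) 1≢0
    point-distinct (slope y , z) (∞ , z′) (c , c≢0 , eq) with span-∼⇒coordinates eq
    ... | 0≡c , _ , _ = contradiction (sym (trans 0≡c (*-identityʳ c))) c≢0
    point-distinct (slope y , z) (slope y′ , z′) (c , _ , eq) with span-∼⇒coordinates eq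
    ... | 1≡c , y′≡cy , z′≡cz = cong₂ (λ s t → slope s , t) (sym (trans y′≡cy (unit y))) (sym (trans z′≡cz (unit z)))
      where
      unit : ∀ t → c * t ≡ t
      unit t = trans (cong (_* t) (sym (trans 1≡c (*-identityʳ c)))) (*-identityˡ t)

    χ≡1⇒NonZero3 : ∀ {X} → χ (κ * Q X) ≡ 1ℤ → NonZero3 X
    χ≡1⇒NonZero3 χ≡1 refl = *-nonzeroʳ {κ} (χ≡1⇒≢0 χ≡1) (solve 6 (λ a b c d e f → let o = con (ℤ.+ 0) in
      a :* o :* o :+ b :* o :* o :+ c :* o :* o :+ d :* o :* o :+ e :* o :* o :+ f :* o :* o := o)
      refl (Conic.a C) (Conic.b C) (Conic.c C) (Conic.d C) (Conic.e C) (Conic.f C))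

    span-coordinates : ∀ {X} → InF3 X → ∃[ x ] ∃[ y ] ∃[ z ] InF x × InF y × InF z × X ≡ span x U y V z W
    span-coordinates {X} X∈ = D ⁻¹ * bracket X V W , D ⁻¹ * bracket U X W , D ⁻¹ * bracket U V X ,
      InF-* D⁻¹∈ (InF-bracket X∈ V∈ W∈) , InF-* D⁻¹∈ (InF-bracket U∈ X∈ W∈) , InF-* D⁻¹∈ (InF-bracket U∈ V∈ X∈) ,
      trans (sym (scale-inverse independent X)) (trans (cong (scale (D ⁻¹)) (cramer U V W X)) (scale-span (D ⁻¹) _ U _ V _ W))
      where
      D⁻¹∈ : InF (D ⁻¹)
      D⁻¹∈ = InF-⁻¹ independent (InF-bracket U∈ V∈ W∈)

    -- The first nonzero one among the coordinates along U and V is scaled to 1. If both vanish, X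
    -- is a multiple of W and lies on the conic.
    normalise : ∀ {X} → InF3 X → Q X ≢ 0# → ∃[ i ] InF-index i × (X ∼ point (proj₁ i) (proj₂ i))
    normalise {X} X∈ QX≢0 = let x , y , z , x∈ , y∈ , z∈ , X≡ = span-coordinates X∈ in by-cases x∈ y∈ z∈ X≡ (≡0? x) (≡0? y)
      where
      scaled : ∀ {x y z x′ y′ z′ c} → X ≡ span x U y V z W → c ≢ 0# → c * x ≡ x′ → c * y ≡ y′ → c * z ≡ z′ → X ∼ span x′ U y′ V z′ W
      scaled {x} {y} {z} {c = c} X≡ c≢0 refl refl refl = c , c≢0 , sym (trans (cong (scale c) X≡) (scale-span c x U y V z W))
      inverseˡ : ∀ {x} → x ≢ 0# → x ⁻¹ * x ≡ 1#
      inverseˡ x≢0 = trans (*-comm _ _) (*-inverseʳ x≢0)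
      by-cases : ∀ {x y z} → InF x → InF y → InF z → X ≡ span x U y V z W → x ≡ 0# ⊎ x ≢ 0# → y ≡ 0# ⊎ y ≢ 0# →
        ∃[ i ] InF-index i × (X ∼ point (proj₁ i) (proj₂ i))
      by-cases {x} {y} {z} x∈ y∈ z∈ X≡ (inj₂ x≢0) _ =
        (slope (x ⁻¹ * y) , x ⁻¹ * z) , (InF-* (InF-⁻¹ x≢0 x∈) y∈ , InF-* (InF-⁻¹ x≢0 x∈) z∈) ,
        scaled X≡ (⁻¹-nonzero x≢0) (inverseˡ x≢0) refl refl
      by-cases {x} {y} {z} x∈ y∈ z∈ X≡ (inj₁ x≡0) (inj₂ y≢0) =
        (∞ , y ⁻¹ * z) , InF-* (InF-⁻¹ y≢0 y∈) z∈ ,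
        scaled X≡ (⁻¹-nonzero y≢0) (trans (cong (y ⁻¹ *_) x≡0) (zeroʳ _)) (inverseˡ y≢0) refl
      by-cases {x} {y} {z} x∈ y∈ z∈ X≡ (inj₁ x≡0) (inj₁ y≡0) = contradiction QX≡0 QX≢0
        where
        QX≡0 : Q X ≡ 0#
        QX≡0 = begin
          Q X
            ≡⟨ cong Q X≡ ⟩
          Q (span x U y V z W)
            ≡⟨ Q-span QW≡0 x U y V z ⟩
          (x * x * a + x * y * h + y * y * b) + z * (x * e + y * f)
            ≡⟨ cong₂ (λ x y → (x * x * a + x * y * h + y * y * b) + z * (x * e + y * f)) x≡0 y≡0 ⟩
          (0# * 0# * a + 0# * 0# * h + 0# * 0# * b) + z * (0# * e + 0# * f)
            ≡⟨ solve 6 (λ a h b e f z → let o = con (ℤ.+ 0) in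
                 (o :* o :* a :+ o :* o :* h :+ o :* o :* b) :+ z :* (o :* e :+ o :* f) := o) refl a h b e f z ⟩
          0# ∎

    externals : List (Direction × Carrier)
    externals = filter (λ i → value i ℤ.≟ 1ℤ) indices

    W≢0 : NonZero3 W
    W≢0 W≡0 = independent (trans (cong (dot (cross U V)) W≡0) (dot-zeroʳ _))

    point′ : Direction × Carrier → Triple
    point′ i = point (proj₁ i) (proj₂ i)

    external-point : ∀ i → InF-index i → value i ≡ 1ℤ → FqPoint (point′ i) × External C (point′ i)
    external-point i i∈ value≡1 = InF3⇒FqPoint point≢0 (point-InF3 i i∈) , χ≡1⇒external W≢0 QW≡0 point≢0 χ≡1
      where
      χ≡1 : χ (κ * Q (point′ i)) ≡ 1ℤ
      χ≡1 = trans (χ-point (proj₁ i) (proj₂ i)) value≡1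
      point≢0 : NonZero3 (point′ i)
      point≢0 = χ≡1⇒NonZero3 χ≡1

    external-value : ∀ P i → External C P → P ∼ point′ i → value i ≡ 1ℤ
    external-value P i P-external (c , c≢0 , eq) = begin
      value i                          ≡⟨ sym (χ-point (proj₁ i) (proj₂ i)) ⟩
      χ (κ * Q (point′ i))             ≡⟨ cong (λ X → χ (κ * Q X)) eq ⟩
      χ (κ * Q (scale c P))            ≡⟨ cong (λ t → χ (κ * t)) (Q-scale c P) ⟩
      χ (κ * (c * c * Q P))            ≡⟨ cong χ (solve 3 (λ k c s → k :* (c :* c :* s) := k :* s :* (c :* c)) refl κ c (Q P)) ⟩
      χ (κ * Q P * (c * c))            ≡⟨ χ-*-square (κ * Q P) c≢0 ⟩
      χ (κ * Q P)                      ≡⟨ external⇒χ≡1 P-external ⟩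
      1ℤ ∎

    value≟1 : ∀ i → Dec (value i ≡ 1ℤ)
    value≟1 i = value i ℤ.≟ 1ℤ

    extCount : ExtCount C (length externals)
    extCount = map point′ externals ,
      Allₚ.map⁺ (All.tabulate external) ,
      AllPairsₚ.map⁺ (AllPairs.map (λ {i} {j} i≢j i∼j → i≢j (point-distinct i j i∼j)) (Uniqueₚ.filter⁺ value≟1 indices-unique)) ,
      complete ,
      length-map point′ externals
      where
      external : ∀ {i} → i ∈ externals → FqPoint (point′ i) × External C (point′ i)
      external {i} i∈ = let i∈indices , value≡1 = ∈-filter⁻ value≟1 {xs = indices} i∈ in
        external-point i (indices-InF i∈indices) value≡1
      complete : ∀ P → FqPoint P → External C P → Any (P ∼_) (map point′ externals)
      complete P P∈ P-external = let i , i∈ , P∼i = normalise (FqPoint⇒InF3 P∈) (proj₁ (proj₂ P-external)) in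
        Anyₚ.map⁺ (lose (∈-filter⁺ value≟1 (∈-indices i i∈) (external-value P i P-external P∼i)) P∼i)

    ψ : ℤ → ℤ
    ψ v = v ℤ.* v ℤ.+ v

    line : Direction → ℤ
    line d = ∑ F (λ z → ψ (value (d , z)))

    2m≡∑lines : ℤ.+ 2 ℤ.* ℤ.+ length externals ≡ line ∞ ℤ.+ ∑ F (λ y → line (slope y))
    2m≡∑lines = begin
      ℤ.+ 2 ℤ.* ℤ.+ length externals
        ≡⟨ length-filter-≡1 value (λ (d , z) → χ-values _) indices ⟩
      ∑ indices (ψ ∘ value)
        ≡⟨ ∑-++ (ψ ∘ value) (map (∞ ,_) F) _ ⟩
      ∑ (map (∞ ,_) F) (ψ ∘ value) ℤ.+ ∑ (cartesianProductWith (λ y z → slope y , z) F F) (ψ ∘ value)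
        ≡⟨ cong₂ ℤ._+_ (∑-map (ψ ∘ value) (∞ ,_) F) (∑-cartesian (λ y z → slope y , z) (ψ ∘ value) F F) ⟩
      line ∞ ℤ.+ ∑ F (λ y → line (slope y)) ∎

    -- For `lin d ≢ 0#` this says that g / l lies in F, so that z = -g / l gives an F-point of the
    -- conic other than W on the line. If `lin d` is zero it holds vacuously; that direction is the
    -- tangent at W and is counted separately.
    Special : Direction → Set
    Special d = quad d * σ (lin d) ≡ lin d * σ (quad d)

    special? : ∀ d → Dec (Special d)
    special? d = quad d * σ (lin d) ≟ lin d * σ (quad d)

    -- The contribution of a direction that carries a further base point exceeds the generic one q - χ(γ l) by this.
    excess : Direction → ℤ
    excess d with special? d
    ... | yes _ = ℤ.+ q ℤ.* χ (γ * lin d) ℤ.- 1ℤ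
    ... | no _ = 0ℤ

    excess-special : ∀ {d} → Special d → excess d ≡ ℤ.+ q ℤ.* χ (γ * lin d) ℤ.- 1ℤ
    excess-special {d} sp with special? d
    ... | yes _ = refl
    ... | no ¬sp = contradiction sp ¬sp

    excess-generic : ∀ {d} → ¬ Special d → excess d ≡ 0ℤ
    excess-generic {d} ¬sp with special? d
    ... | yes sp = contradiction sp ¬sp
    ... | no _ = refl

    module _ (d : Direction) (l≢0 : lin d ≢ 0#) where
      private
        g = quad d
        l = lin d
        w = g * l ⁻¹
        c = χ (γ * l)

      value-factor : ∀ z → value (d , z) ≡ c ℤ.* χ (z + w)
      value-factor z = trans (cong χ (begin
        γ * (g + z * l)                        ≡⟨ cong (λ t → γ * (t + z * l)) (trans (sym (*-identityʳ g)) (cong (g *_) (sym (*-inverseʳ l≢0)))) ⟩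
        γ * (g * (l * l ⁻¹) + z * l)           ≡⟨ solve 5 (λ γ g l i z → γ :* (g :* (l :* i) :+ z :* l) := γ :* l :* (z :+ g :* i)) refl γ g l (l ⁻¹) z ⟩
        γ * l * (z + w) ∎)) (χ-* _ _)

      c²≡1 : c ℤ.* c ≡ 1ℤ
      c²≡1 = χ²≡1 (*-nonzero γ≢0 l≢0)

      open ℤS using () renaming (solve to ℤ-solve; con to ℤ-con; _:+_ to _⊕_; _:*_ to _⊗_; _:-_ to _⊖_; :-_ to ⊝_; _:=_ to _⊜_)

      -- The base point z = -w contributes 0 and each of the other q - 1 points 1 + c, as z + w is
      -- then in F and nonzero. The total (q - 1) (1 + c) is arranged as the generic value plus an
      -- excess.
      line-special : Special d → line d ≡ ℤ.+ q ℤ.- c ℤ.+ (ℤ.+ q ℤ.* c ℤ.- 1ℤ)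
      line-special sp = begin
        line d
          ≡⟨ ∑-F-except (λ z → ψ (value (d , z))) (1ℤ ℤ.+ c) (- w) (InF-neg w∈) off ⟩
        ℤ.+ q ℤ.* (1ℤ ℤ.+ c) ℤ.+ (ψ (value (d , - w)) ℤ.- (1ℤ ℤ.+ c))
          ≡⟨ cong (λ t → ℤ.+ q ℤ.* (1ℤ ℤ.+ c) ℤ.+ (ψ t ℤ.- (1ℤ ℤ.+ c))) (trans (value-factor (- w)) (trans (cong (c ℤ.*_) (χ-0 (-‿inverseˡ w))) (ℤₚ.*-zeroʳ c))) ⟩
        ℤ.+ q ℤ.* (1ℤ ℤ.+ c) ℤ.+ (0ℤ ℤ.- (1ℤ ℤ.+ c))
          ≡⟨ ℤ-solve 2 (λ q c → q ⊗ (ℤ-con 1ℤ ⊕ c) ⊕ (ℤ-con 0ℤ ⊖ (ℤ-con 1ℤ ⊕ c)) ⊜ q ⊖ c ⊕ (q ⊗ c ⊖ ℤ-con 1ℤ)) refl (ℤ.+ q) c ⟩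
        ℤ.+ q ℤ.- c ℤ.+ (ℤ.+ q ℤ.* c ℤ.- 1ℤ) ∎
        where
        w∈ : InF w
        w∈ = proportional⇒InF l≢0 sp
        off : ∀ {z} → InF z → z ≢ - w → ψ (value (d , z)) ≡ 1ℤ ℤ.+ c
        off {z} z∈ z≢ = trans (cong ψ (trans (value-factor z) (trans (cong (c ℤ.*_) (χ-F (InF-+ z∈ w∈) z+w≢0)) (ℤₚ.*-identityʳ c))))
          (cong (ℤ._+ c) c²≡1)
          where
          z+w≢0 : z + w ≢ 0#
          z+w≢0 z+w≡0 = z≢ (trans (solve 2 (λ z w → z := (z :+ w) :- w) refl z w) (trans (cong (_- w) z+w≡0) (+-identityˡ _)))

      line-generic : ¬ Special d → line d ≡ ℤ.+ q ℤ.- c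
      line-generic ¬sp = begin
        line d                                           ≡⟨ ∑-cong F (λ z∈ → term (F-InF z∈)) ⟩
        ∑ F (λ z → 1ℤ ℤ.+ c ℤ.* χ (z + w))               ≡⟨ ∑-+ (λ _ → 1ℤ) (λ z → c ℤ.* χ (z + w)) F ⟩
        ∑ F (λ _ → 1ℤ) ℤ.+ ∑ F (λ z → c ℤ.* χ (z + w))   ≡⟨ cong₂ ℤ._+_ (∑-const-F 1ℤ) (∑-*ˡ c (λ z → χ (z + w)) F) ⟩
        ℤ.+ q ℤ.* 1ℤ ℤ.+ c ℤ.* S w                       ≡⟨ cong (λ t → ℤ.+ q ℤ.* 1ℤ ℤ.+ c ℤ.* t) (S-∉F w∉) ⟩
        ℤ.+ q ℤ.* 1ℤ ℤ.+ c ℤ.* -1ℤ                       ≡⟨ ℤ-solve 2 (λ q c → q ⊗ ℤ-con 1ℤ ⊕ c ⊗ ℤ-con -1ℤ ⊜ q ⊖ c) refl (ℤ.+ q) c ⟩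
        ℤ.+ q ℤ.- c ∎
        where
        w*l≡g : w * l ≡ g
        w*l≡g = trans (solve 3 (λ g i l → g :* i :* l := g :* (l :* i)) refl g (l ⁻¹) l) (trans (cong (g *_) (*-inverseʳ l≢0)) (*-identityʳ g))
        w∉ : ¬ InF w
        w∉ w∈ = ¬sp (begin
          g * σ l                ≡⟨ cong (_* σ l) (sym w*l≡g) ⟩
          w * l * σ l            ≡⟨ solve 3 (λ w l s → w :* l :* s := l :* (w :* s)) refl w l (σ l) ⟩
          l * (w * σ l)          ≡⟨ cong (l *_) (trans (cong (_* σ l) (sym w∈)) (sym (σ-* w l))) ⟩
          l * σ (w * l)          ≡⟨ cong (λ t → l * σ t) w*l≡g ⟩
          l * σ g ∎)
        term : ∀ {z} → InF z → ψ (value (d , z)) ≡ 1ℤ ℤ.+ c ℤ.* χ (z + w)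
        term {z} z∈ = begin
          ψ (value (d , z))                  ≡⟨ cong ψ (value-factor z) ⟩
          ψ (c ℤ.* x)                        ≡⟨ ℤ-solve 2 (λ c x → c ⊗ x ⊗ (c ⊗ x) ⊕ c ⊗ x ⊜ (c ⊗ c) ⊗ (x ⊗ x) ⊕ c ⊗ x) refl c x ⟩
          c ℤ.* c ℤ.* (x ℤ.* x) ℤ.+ c ℤ.* x  ≡⟨ cong₂ (λ s t → s ℤ.* t ℤ.+ c ℤ.* x) c²≡1 (χ²≡1 z+w≢0) ⟩
          1ℤ ℤ.+ c ℤ.* x ∎
          where
          x = χ (z + w)
          -- A zero would put w = -z in F. So no point of this sum lies on the conic, and every
          -- squared character is 1.
          z+w≢0 : z + w ≢ 0#
          z+w≢0 z+w≡0 = w∉ (subst InF (sym (trans (solve 2 (λ z w → w := (z :+ w) :- z) refl z w)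
            (trans (cong (_- z) z+w≡0) (+-identityˡ _)))) (InF-neg z∈))

      line≡ : line d ≡ ℤ.+ q ℤ.- c ℤ.+ excess d
      line≡ with special? d
      ... | yes sp = line-special sp
      ... | no ¬sp = trans (line-generic ¬sp) (sym (ℤₚ.+-identityʳ _))

    -- Q is constant on the listed points of such a line, the tangent at W; all q of them are
    -- external, and each has weight 2.
    line-constant : ∀ d → lin d ≡ 0# → χ (γ * quad d) ≡ 1ℤ → line d ≡ ℤ.+ q ℤ.* ℤ.+ 2
    line-constant d l≡0 χ≡1 = trans (∑-cong F (λ {z} _ → cong ψ (trans (cong (λ t → χ (γ * t))
        (trans (cong (λ l → quad d + z * l) l≡0) (trans (cong (quad d +_) (zeroʳ z)) (+-identityʳ _)))) χ≡1)))
      (∑-const-F (ℤ.+ 2))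

    open ℤS using () renaming (solve to ℤ-solve; con to ℤ-con; _:+_ to _⊕_; _:*_ to _⊗_; _:-_ to _⊖_; :-_ to ⊝_; _:=_ to _⊜_)

    -- When the tangent at W is not an F-line, the characters of the lin d cancel.
    count-secant : e * σ f ≢ f * σ e →
      ℤ.+ 2 ℤ.* ℤ.+ length externals ≡ ℤ.+ q ℤ.* ℤ.+ q ℤ.+ ℤ.+ q ℤ.+ (excess ∞ ℤ.+ ∑ F (excess ∘ slope))
    count-secant e∦f = begin
      ℤ.+ 2 ℤ.* ℤ.+ length externals
        ≡⟨ 2m≡∑lines ⟩
      line ∞ ℤ.+ ∑ F (λ y → line (slope y))
        ≡⟨ cong₂ ℤ._+_ (line≡ ∞ f≢0) (trans (∑-cong F (λ {y} y∈ → line≡ (slope y) (l≢0 (F-InF y∈))))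
             (trans (∑-+ (λ y → ℤ.+ q ℤ.- χ (γ * lin (slope y))) (excess ∘ slope) F) (cong (ℤ._+ ∑ F (excess ∘ slope)) ∑-generic))) ⟩
      (ℤ.+ q ℤ.- χ (γ * f) ℤ.+ excess ∞) ℤ.+ ((ℤ.+ q ℤ.* ℤ.+ q ℤ.+ χ (γ * f)) ℤ.+ ∑ F (excess ∘ slope))
        ≡⟨ ℤ-solve 4 (λ q c x s → (q ⊖ c ⊕ x) ⊕ ((q ⊗ q ⊕ c) ⊕ s) ⊜ q ⊗ q ⊕ q ⊕ (x ⊕ s)) refl (ℤ.+ q) (χ (γ * f)) (excess ∞) _ ⟩
      ℤ.+ q ℤ.* ℤ.+ q ℤ.+ ℤ.+ q ℤ.+ (excess ∞ ℤ.+ ∑ F (excess ∘ slope)) ∎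
      where
      f≢0 : f ≢ 0#
      f≢0 f≡0 = e∦f (trans (cong (λ t → e * σ t) f≡0) (trans (cong (e *_) σ-0) (trans (zeroʳ e) (sym (trans (cong (_* σ e) f≡0) (zeroˡ _))))))
      w = e * f ⁻¹
      w*f≡e : w * f ≡ e
      w*f≡e = trans (solve 3 (λ g i l → g :* i :* l := g :* (l :* i)) refl e (f ⁻¹) f) (trans (cong (e *_) (*-inverseʳ f≢0)) (*-identityʳ e))
      w∉ : ¬ InF w
      w∉ w∈ = e∦f (begin
        e * σ f                ≡⟨ cong (_* σ f) (sym w*f≡e) ⟩
        w * f * σ f            ≡⟨ solve 3 (λ w l s → w :* l :* s := l :* (w :* s)) refl w f (σ f) ⟩
        f * (w * σ f)          ≡⟨ cong (f *_) (trans (cong (_* σ f) (sym w∈)) (sym (σ-* w f))) ⟩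
        f * σ (w * f)          ≡⟨ cong (λ t → f * σ t) w*f≡e ⟩
        f * σ e ∎)
      lin-factor : ∀ y → lin (slope y) ≡ f * (y + w)
      lin-factor y = trans (cong (_+ y * f) (sym w*f≡e)) (solve 3 (λ w f y → w :* f :+ y :* f := f :* (y :+ w)) refl w f y)
      l≢0 : ∀ {y} → InF y → lin (slope y) ≢ 0#
      l≢0 {y} y∈ l≡0 = w∉ (subst InF (sym (trans (solve 2 (λ z w → w := (z :+ w) :- z) refl y w)
        (trans (cong (_- y) (zero-product f≢0 (trans (sym (lin-factor y)) l≡0))) (+-identityˡ _)))) (InF-neg y∈))
      -- The sum over directions is of the same kind as the sum along a line: l is f (y + w) with w
      -- = e / f outside F, so `S-∉F` applies once more. The resulting +χ(γ f) cancels the -χ(γ f)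
      -- of the direction `∞`.
      ∑-generic : ∑ F (λ y → ℤ.+ q ℤ.- χ (γ * lin (slope y))) ≡ ℤ.+ q ℤ.* ℤ.+ q ℤ.+ χ (γ * f)
      ∑-generic = begin
        ∑ F (λ y → ℤ.+ q ℤ.- χ (γ * lin (slope y)))
          ≡⟨ ∑-cong F (λ {y} _ → trans (cong (λ t → ℤ.+ q ℤ.- t) (trans (cong χ (trans (cong (γ *_) (lin-factor y)) (sym (*-assoc _ _ _)))) (χ-* (γ * f) (y + w))))
               (ℤ-solve 3 (λ q c x → q ⊖ c ⊗ x ⊜ q ⊕ (⊝ c) ⊗ x) refl (ℤ.+ q) (χ (γ * f)) (χ (y + w)))) ⟩
        ∑ F (λ y → ℤ.+ q ℤ.+ (ℤ.- χ (γ * f)) ℤ.* χ (y + w))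
          ≡⟨ ∑-+ (λ _ → ℤ.+ q) (λ y → (ℤ.- χ (γ * f)) ℤ.* χ (y + w)) F ⟩
        ∑ F (λ _ → ℤ.+ q) ℤ.+ ∑ F (λ y → (ℤ.- χ (γ * f)) ℤ.* χ (y + w))
          ≡⟨ cong₂ ℤ._+_ (∑-const-F (ℤ.+ q)) (trans (∑-*ˡ (ℤ.- χ (γ * f)) (λ y → χ (y + w)) F) (cong ((ℤ.- χ (γ * f)) ℤ.*_) (S-∉F w∉))) ⟩
        ℤ.+ q ℤ.* ℤ.+ q ℤ.+ (ℤ.- χ (γ * f)) ℤ.* -1ℤ
          ≡⟨ ℤ-solve 2 (λ q c → q ⊗ q ⊕ (⊝ c) ⊗ ℤ-con -1ℤ ⊜ q ⊗ q ⊕ c) refl (ℤ.+ q) (χ (γ * f)) ⟩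
        ℤ.+ q ℤ.* ℤ.+ q ℤ.+ χ (γ * f) ∎

    -- For f = 0 the vector V lies on the tangent at W and γ = b e². That tangent supplies the
    -- summand 2 q. On the other q lines l is the constant e, so their terms -χ(γ e) accumulate.
    count-tangent : f ≡ 0# →
      ℤ.+ 2 ℤ.* ℤ.+ length externals ≡ ℤ.+ q ℤ.* ℤ.+ 2 ℤ.+ (ℤ.+ q ℤ.* (ℤ.+ q ℤ.- χ (γ * e)) ℤ.+ ∑ F (excess ∘ slope))
    count-tangent f≡0 = trans 2m≡∑lines (cong₂ ℤ._+_ (line-constant ∞ f≡0 χγb≡1)
      (trans (∑-cong F (λ {y} _ → trans (line≡ (slope y) (λ l≡0 → e≢0 (trans (sym (lin≡e y)) l≡0)))
          (cong (λ t → ℤ.+ q ℤ.- χ (γ * t) ℤ.+ excess (slope y)) (lin≡e y))))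
        (trans (∑-+ (λ _ → ℤ.+ q ℤ.- χ (γ * e)) (excess ∘ slope) F) (cong (ℤ._+ ∑ F (excess ∘ slope)) (∑-const-F _)))))
      where
      γ≡ : γ ≡ b * (e * e)
      γ≡ = trans (cong (λ f → a * (f * f) - h * (e * f) + b * (e * e)) f≡0)
        (solve 4 (λ a h e b → a :* (con (ℤ.+ 0) :* con (ℤ.+ 0)) :- h :* (e :* con (ℤ.+ 0)) :+ b :* (e :* e) := b :* (e :* e)) refl a h e b)
      be²≢0 : b * (e * e) ≢ 0#
      be²≢0 eq = γ≢0 (trans γ≡ eq)
      b≢0 : b ≢ 0#
      b≢0 = *-nonzeroˡ be²≢0
      e≢0 : e ≢ 0#
      e≢0 = *-nonzeroˡ (*-nonzeroʳ be²≢0)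
      lin≡e : ∀ y → lin (slope y) ≡ e
      lin≡e y = trans (cong (λ t → e + y * t) f≡0) (trans (cong (e +_) (zeroʳ y)) (+-identityʳ e))
      χγb≡1 : χ (γ * b) ≡ 1ℤ
      χγb≡1 = trans (cong χ (trans (cong (_* b) γ≡) (solve 2 (λ b e → b :* (e :* e) :* b := (b :* e) :* (b :* e)) refl b e))) (χ-square (*-nonzero b≢0 e≢0))

-- Classification by the further base points

-- Fewer pairs than the theorem allows; its lists for q = 3 and q = 5 depend on this.
data Admissible : (n₀ α : ℕ) → Set where
  ⟨0,2⟩ : Admissible 0 2
  ⟨0,4⟩ : Admissible 0 4
  ⟨1,1⟩ : Admissible 1 1
  ⟨1,3⟩ : Admissible 1 3
  ⟨2,2⟩ : Admissible 2 2
  ⟨2,4⟩ : Admissible 2 4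
  ⟨3,1⟩ : Admissible 3 1
  ⟨3,5⟩ : Admissible 3 5

module Classification (K : FiniteField) (p k q : ℕ) (p-prime : Prime p) (p≢2 : p ≢ 2) (q≡p^k : q ≡ p ℕ.^ k)
  (size≡q*q : FiniteField.size K ≡ q ℕ.* q) (C : Geometry.Conic K) (irreducible : Geometry.Irreducible K C) where
  open Frames K p k q p-prime p≢2 q≡p^k size≡q*q C irreducible
  open ≡-Reasoning
  open ℤS using () renaming (solve to ℤ-solve; con to ℤ-con; _:+_ to _⊕_; _:*_ to _⊗_; _:-_ to _⊖_; :-_ to ⊝_; _:=_ to _⊜_)

  Outcome : Set
  Outcome = ∃[ m ] (ExtCount C m × ∃[ n₀ ] ∃[ α ] (Admissible n₀ α ×
    ℤ.+ 2 ℤ.* ℤ.+ m ≡ ℤ.+ q ℤ.* ℤ.+ q ℤ.+ (ℤ.+ α ℤ.- ℤ.+ 1) ℤ.* ℤ.+ q ℤ.- ℤ.+ n₀))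

  χ-neg-one : χ (- 1#) ≡ 1ℤ
  χ-neg-one = χ-F (InF-neg σ-1) (-‿nonzero 1≢0)

  e₁∈ : InF3 e₁
  e₁∈ = σ-1 , σ-0 , σ-0

  e₂∈ : InF3 e₂
  e₂∈ = σ-0 , σ-1 , σ-0

  e₃∈ : InF3 e₃
  e₃∈ = σ-0 , σ-0 , σ-1

  frame-at : ∀ {W} → NonZero3 W → InF3 W → Q W ≡ 0# → Frame
  frame-at {W} W≢0 W∈ QW≡0 = choose (nonzero-coordinate W≢0)
    where
    choose : proj₁ W ≢ 0# ⊎ proj₁ (proj₂ W) ≢ 0# ⊎ proj₂ (proj₂ W) ≢ 0# → Frame
    choose (inj₁ w₁≢0) = record { U = e₂ ; V = e₃ ; W = W ; U∈ = e₂∈ ; V∈ = e₃∈ ; W∈ = W∈ ;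
      independent = λ eq → w₁≢0 (trans (sym (bracket-e₂e₃ W)) eq) ; QW≡0 = QW≡0 }
    choose (inj₂ (inj₁ w₂≢0)) = record { U = e₃ ; V = e₁ ; W = W ; U∈ = e₃∈ ; V∈ = e₁∈ ; W∈ = W∈ ;
      independent = λ eq → w₂≢0 (trans (sym (bracket-e₃e₁ W)) eq) ; QW≡0 = QW≡0 }
    choose (inj₂ (inj₂ w₃≢0)) = record { U = e₁ ; V = e₂ ; W = W ; U∈ = e₁∈ ; V∈ = e₂∈ ; W∈ = W∈ ;
      independent = λ eq → w₃≢0 (trans (sym (bracket-e₁e₂ W)) eq) ; QW≡0 = QW≡0 }

  swap : Frame → Frame
  swap Fr = record { U = V ; V = U ; W = W ; U∈ = V∈ ; V∈ = U∈ ; W∈ = W∈ ;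
      independent = λ eq → -‿nonzero independent (trans (sym (bracket-swap U V W)) eq) ; QW≡0 = QW≡0 }
    where
    open Frame Fr

  shear : Frame → ∀ {y z} → InF y → InF z → Frame
  shear Fr {y} {z} y∈ z∈ = record { U = span 1# U y V z W ; V = V ; W = W ; U∈ = InF3-span σ-1 U∈ y∈ V∈ z∈ W∈ ; V∈ = V∈ ; W∈ = W∈ ;
      independent = λ eq → independent (trans (sym (*-identityˡ _)) (trans (sym (bracket-span₁ U V W 1# y z)) eq)) ; QW≡0 = QW≡0 }
    where
    open Frame Fr

  module Reframed (Fr : Frame) where
    open FrameTheory Fr
    open Frame Fr

    -- A special direction contains a base point besides W; the shear moves U onto it.
    base-point-shear : ∀ {y} → InF y → lin (slope y) ≢ 0# → Special (slope y) → ∃[ Fr′ ]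
      (FrameTheory.a Fr′ ≡ 0# × FrameTheory.b Fr′ ≡ b × FrameTheory.e Fr′ ≡ e + y * f × FrameTheory.f Fr′ ≡ f)
    base-point-shear {y} y∈ l≢0 sp = shear Fr y∈ z∈ ,
      trans (Q-point (slope y) z) vanish , refl ,
      trans (B-spanˡ QW≡0 1# U y V z) (cong (_+ y * f) (*-identityˡ e)) , refl
      where
      g = quad (slope y)
      l = lin (slope y)
      z = - (g * l ⁻¹)
      z∈ : InF z
      z∈ = InF-neg (proportional⇒InF l≢0 sp)
      vanish : g + z * l ≡ 0#
      vanish = begin
        g + - (g * l ⁻¹) * l    ≡⟨ solve 3 (λ g i l → g :+ :- (g :* i) :* l := g :- g :* (l :* i)) refl g (l ⁻¹) l ⟩
        g - g * (l * l ⁻¹)      ≡⟨ cong (λ t → g - g * t) (*-inverseʳ l≢0) ⟩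
        g - g * 1#              ≡⟨ solve 1 (λ g → g :- g :* con (ℤ.+ 1) := con (ℤ.+ 0)) refl g ⟩
        0# ∎

    special-∞ : b ≡ 0# → Special ∞
    special-∞ b≡0 = trans (cong (_* σ f) b≡0) (trans (zeroˡ _) (sym (trans (cong (λ t → f * σ t) b≡0) (trans (cong (f *_) σ-0) (zeroʳ f)))))

    secant-slope≢0 : e * σ f ≢ f * σ e → ∀ {y} → InF y → lin (slope y) ≢ 0#
    secant-slope≢0 e∦f {y} y∈ l≡0 = e∦f (begin
      e * σ f                        ≡⟨ cong (_* σ f) e≡ ⟩
      - (y * f) * σ f                ≡⟨ solve 3 (λ y f s → :- (y :* f) :* s := f :* :- (y :* s)) refl y f (σ f) ⟩
      f * - (y * σ f)                ≡⟨ cong (λ t → f * - (t * σ f)) (sym y∈) ⟩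
      f * - (σ y * σ f)              ≡⟨ cong (λ t → f * - t) (sym (σ-* y f)) ⟩
      f * - σ (y * f)                ≡⟨ cong (f *_) (sym (σ-neg (y * f))) ⟩
      f * σ (- (y * f))              ≡⟨ cong (λ t → f * σ t) (sym e≡) ⟩
      f * σ e ∎)
      where
      e≡ : e ≡ - (y * f)
      e≡ = trans (solve 2 (λ e t → e := (e :+ t) :- t) refl e (y * f)) (trans (cong (_- y * f) l≡0) (+-identityˡ _))

    -- The expression e σ(f) - f σ(e) is alternating and F-bilinear, so adding an F-multiple of f to
    -- e does not change it.
    secant-shear : e * σ f ≢ f * σ e → ∀ {y} → InF y → (e + y * f) * σ f ≢ f * σ (e + y * f)
    secant-shear e∦f {y} y∈ eq = e∦f (sub≡0⇒≡ (begin
      e * σ f - f * σ e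
        ≡⟨ solve 5 (λ e f y s t → e :* s :- f :* t := (e :+ y :* f) :* s :- f :* (t :+ y :* s)) refl e f y (σ f) (σ e) ⟩
      (e + y * f) * σ f - f * (σ e + y * σ f)
        ≡⟨ ≡⇒sub≡0 (trans eq (cong (f *_) (trans (σ-+ e (y * f)) (cong (σ e +_) (trans (σ-* y f) (cong (_* σ f) y∈)))))) ⟩
      0# ∎))

    ∑-excess : ∀ ys → Unique ys → (∀ {y} → y ∈ ys → InF y) → (∀ {y} → InF y → Special (slope y) → y ∈ ys) →
      ∑ F (excess ∘ slope) ≡ ∑ ys (excess ∘ slope)
    ∑-excess ys uys ys⊆F only = ∑-support _≟_ (excess ∘ slope) F ys F-unique uys (λ y∈ → ∈-F (ys⊆F y∈))
      (λ x∈ x∉ → excess-generic (λ sp → x∉ (only (F-InF x∈) sp)))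

    SpecialSearch : Set
    SpecialSearch = (∃[ y ] (InF y × Special (slope y))) ⊎ (∀ {y} → InF y → ¬ Special (slope y))

    find-special : SpecialSearch
    find-special with Any.any? (λ y → special? (slope y)) F
    ... | yes found = let y , y∈ , sp = find found in inj₁ (y , F-InF y∈ , sp)
    ... | no none = inj₂ λ y∈ sp → none (lose (∈-F y∈) sp)

    outcome : ∀ {n₀ α} → Admissible n₀ α →
      ℤ.+ 2 ℤ.* ℤ.+ length externals ≡ ℤ.+ q ℤ.* ℤ.+ q ℤ.+ (ℤ.+ α ℤ.- ℤ.+ 1) ℤ.* ℤ.+ q ℤ.- ℤ.+ n₀ → Outcome
    outcome adm eq = length externals , extCount , _ , _ , adm , eq

    secant-none : e * σ f ≢ f * σ e → ¬ Special ∞ → (∀ {y} → InF y → ¬ Special (slope y)) → Outcome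
    secant-none e∦f ¬∞ ¬slope = outcome ⟨0,2⟩ (begin
      ℤ.+ 2 ℤ.* ℤ.+ length externals
        ≡⟨ count-secant e∦f ⟩
      ℤ.+ q ℤ.* ℤ.+ q ℤ.+ ℤ.+ q ℤ.+ (excess ∞ ℤ.+ ∑ F (excess ∘ slope))
        ≡⟨ cong₂ (λ s t → ℤ.+ q ℤ.* ℤ.+ q ℤ.+ ℤ.+ q ℤ.+ (s ℤ.+ t)) (excess-generic ¬∞) (∑-excess [] [] (λ ()) (λ y∈ sp → contradiction sp (¬slope y∈))) ⟩
      ℤ.+ q ℤ.* ℤ.+ q ℤ.+ ℤ.+ q ℤ.+ (0ℤ ℤ.+ 0ℤ)
        ≡⟨ ℤ-solve 1 (λ q → q ⊗ q ⊕ q ⊕ (ℤ-con 0ℤ ⊕ ℤ-con 0ℤ) ⊜ q ⊗ q ⊕ ℤ-con 1ℤ ⊗ q ⊖ ℤ-con 0ℤ) refl (ℤ.+ q) ⟩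
      ℤ.+ q ℤ.* ℤ.+ q ℤ.+ 1ℤ ℤ.* ℤ.+ q ℤ.- 0ℤ ∎)

    secant⇒f≢0 : e * σ f ≢ f * σ e → f ≢ 0#
    secant⇒f≢0 e∦f f≡0 = e∦f (trans (cong (λ t → e * σ t) f≡0)
      (trans (cong (e *_) σ-0) (trans (zeroʳ e) (sym (trans (cong (_* σ e) f≡0) (zeroˡ _))))))

    secant-one : e * σ f ≢ f * σ e → Special ∞ → (∀ {y} → InF y → ¬ Special (slope y)) → Outcome
    secant-one e∦f sp ¬slope = by-sign (χ-±1 (*-nonzero γ≢0 (secant⇒f≢0 e∦f)))
      where
      count : ∀ v → χ (γ * f) ≡ v → ℤ.+ 2 ℤ.* ℤ.+ length externals ≡ ℤ.+ q ℤ.* ℤ.+ q ℤ.+ ℤ.+ q ℤ.+ (ℤ.+ q ℤ.* v ℤ.- 1ℤ ℤ.+ 0ℤ)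
      count _ refl = trans (count-secant e∦f) (cong₂ (λ s t → ℤ.+ q ℤ.* ℤ.+ q ℤ.+ ℤ.+ q ℤ.+ (s ℤ.+ t)) (excess-special sp)
        (∑-excess [] [] (λ ()) (λ y∈ sp → contradiction sp (¬slope y∈))))
      by-sign : χ (γ * f) ≡ 1ℤ ⊎ χ (γ * f) ≡ -1ℤ → Outcome
      by-sign (inj₁ χ≡1) = outcome ⟨1,3⟩ (trans (count _ χ≡1)
        (ℤ-solve 1 (λ q → q ⊗ q ⊕ q ⊕ (q ⊗ ℤ-con 1ℤ ⊖ ℤ-con 1ℤ ⊕ ℤ-con 0ℤ) ⊜ q ⊗ q ⊕ ℤ-con (ℤ.+ 2) ⊗ q ⊖ ℤ-con 1ℤ) refl (ℤ.+ q)))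
      by-sign (inj₂ χ≡-1) = outcome ⟨1,1⟩ (trans (count _ χ≡-1)
        (ℤ-solve 1 (λ q → q ⊗ q ⊕ q ⊕ (q ⊗ ℤ-con -1ℤ ⊖ ℤ-con 1ℤ ⊕ ℤ-con 0ℤ) ⊜ q ⊗ q ⊕ ℤ-con 0ℤ ⊗ q ⊖ ℤ-con 1ℤ) refl (ℤ.+ q)))

    -- With U on the conic, y = 0 is special and any other special y is the root of a linear polynomial t₁ + t₂ y,
    -- whose coefficients are negated by σ.
    special-sum : ∀ {t₁ t₂} → σ t₁ ≡ - t₁ → σ t₂ ≡ - t₂ → ¬ (t₁ ≡ 0# × t₂ ≡ 0#) →
      (∀ {y} → InF y → Special (slope y) → y * (t₁ + y * t₂) ≡ 0#) →
      (∀ {y} → InF y → y * (t₁ + y * t₂) ≡ 0# → Special (slope y)) →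
      ((t₁ ≡ 0# ⊎ t₂ ≡ 0#) × ∑ F (excess ∘ slope) ≡ ℤ.+ q ℤ.* χ (γ * lin (slope 0#)) ℤ.- 1ℤ) ⊎
      (∃[ y ] (t₁ + y * t₂ ≡ 0# × t₂ ≢ 0# ×
        ∑ F (excess ∘ slope) ≡ (ℤ.+ q ℤ.* χ (γ * lin (slope 0#)) ℤ.- 1ℤ) ℤ.+ (ℤ.+ q ℤ.* χ (γ * lin (slope y)) ℤ.- 1ℤ)))
    special-sum {t₁} {t₂} σt₁ σt₂ not-both to from = cases (≡0? t₁) (≡0? t₂)
      where
      special-0 : Special (slope 0#)
      special-0 = from σ-0 (zeroˡ _)
      one-root : (t₁ ≡ 0# ⊎ t₂ ≡ 0#) → (∀ {y} → y ≢ 0# → t₁ + y * t₂ ≢ 0#) →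
        (t₁ ≡ 0# ⊎ t₂ ≡ 0#) × ∑ F (excess ∘ slope) ≡ ℤ.+ q ℤ.* χ (γ * lin (slope 0#)) ℤ.- 1ℤ
      one-root degenerate no-root = degenerate ,
        trans (∑-excess (0# ∷ []) ([] ∷ []) (λ { (here refl) → σ-0 }) only) (trans (ℤₚ.+-identityʳ _) (excess-special special-0))
        where
        only : ∀ {y} → InF y → Special (slope y) → y ∈ 0# ∷ []
        only {y} y∈ sp with ≡0? y
        ... | inj₁ y≡0 = here y≡0
        ... | inj₂ y≢0 = contradiction (zero-product y≢0 (to y∈ sp)) (no-root y≢0)
      cases : t₁ ≡ 0# ⊎ t₁ ≢ 0# → t₂ ≡ 0# ⊎ t₂ ≢ 0# → _
      cases (inj₁ t₁≡0) (inj₁ t₂≡0) = contradiction (t₁≡0 , t₂≡0) not-both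
      -- For t₁ = 0 the second root merges with y = 0; in the next case, t₂ = 0, it goes off to the
      -- direction `∞`.
      cases (inj₁ t₁≡0) (inj₂ t₂≢0) = inj₁ (one-root (inj₁ t₁≡0) λ {y} y≢0 eq →
        *-nonzero y≢0 t₂≢0 (trans (sym (+-identityˡ _)) (trans (cong (_+ y * t₂) (sym t₁≡0)) eq)))
      cases (inj₂ t₁≢0) (inj₁ t₂≡0) = inj₁ (one-root (inj₂ t₂≡0) λ {y} y≢0 eq →
        t₁≢0 (trans (sym (+-identityʳ _)) (trans (cong (t₁ +_) (sym (trans (cong (y *_) t₂≡0) (zeroʳ y)))) eq)))
      cases (inj₂ t₁≢0) (inj₂ t₂≢0) = inj₂ (y₁ , root , t₂≢0 ,
        trans (∑-excess (0# ∷ y₁ ∷ []) (((λ 0≡y₁ → y₁≢0 (sym 0≡y₁)) ∷ []) ∷ [] ∷ []) (λ { (here refl) → σ-0 ; (there (here refl)) → y₁∈ }) only)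
          (cong₂ ℤ._+_ (excess-special special-0) (trans (ℤₚ.+-identityʳ _) (excess-special (from y₁∈ (trans (cong (y₁ *_) root) (zeroʳ y₁)))))))
        where
        y₁ = - (t₁ * t₂ ⁻¹)
        y₁∈ : InF y₁
        y₁∈ = InF-neg (proportional⇒InF t₂≢0 (begin
          t₁ * σ t₂       ≡⟨ cong (t₁ *_) σt₂ ⟩
          t₁ * - t₂       ≡⟨ solve 2 (λ s t → s :* :- t := t :* :- s) refl t₁ t₂ ⟩
          t₂ * - t₁       ≡⟨ cong (t₂ *_) (sym σt₁) ⟩
          t₂ * σ t₁ ∎))
        y₁≢0 : y₁ ≢ 0#
        y₁≢0 = -‿nonzero (*-nonzero t₁≢0 (⁻¹-nonzero t₂≢0))
        root : t₁ + y₁ * t₂ ≡ 0#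
        root = begin
          t₁ + - (t₁ * t₂ ⁻¹) * t₂    ≡⟨ solve 3 (λ s i t → s :+ :- (s :* i) :* t := s :- s :* (t :* i)) refl t₁ (t₂ ⁻¹) t₂ ⟩
          t₁ - t₁ * (t₂ * t₂ ⁻¹)      ≡⟨ cong (λ u → t₁ - t₁ * u) (*-inverseʳ t₂≢0) ⟩
          t₁ - t₁ * 1#                ≡⟨ solve 1 (λ s → s :- s :* con (ℤ.+ 1) := con (ℤ.+ 0)) refl t₁ ⟩
          0# ∎
        only : ∀ {y} → InF y → Special (slope y) → y ∈ 0# ∷ y₁ ∷ []
        only {y} y∈ sp with ≡0? y
        ... | inj₁ y≡0 = here y≡0
        ... | inj₂ y≢0 = there (here (sub≡0⇒≡ (zero-product t₂≢0 (begin
          t₂ * (y - y₁)                    ≡⟨ solve 4 (λ s t y z → t :* (y :- z) := (s :+ y :* t) :- (s :+ z :* t)) refl t₁ t₂ y y₁ ⟩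
          (t₁ + y * t₂) - (t₁ + y₁ * t₂)   ≡⟨ cong₂ _-_ (zero-product y≢0 (to y∈ sp)) root ⟩
          0# - 0#                          ≡⟨ -‿inverseʳ 0# ⟩
          0# ∎))))

    -- An alternating F-bilinear form on K which vanishes when its arguments are proportional over
    -- F. Conjugation negates it, so the ratio of two of its values lies in F.
    skew : Carrier → Carrier → Carrier
    skew u v = u * σ v - v * σ u

    σ-skew : ∀ u v → σ (skew u v) ≡ - skew u v
    σ-skew u v = begin
      σ (u * σ v - v * σ u)              ≡⟨ σ-sub _ _ ⟩
      σ (u * σ v) - σ (v * σ u)          ≡⟨ cong₂ _-_ (trans (σ-* u _) (cong (σ u *_) (σ-σ v))) (trans (σ-* v _) (cong (σ v *_) (σ-σ u))) ⟩
      σ u * v - σ v * u                  ≡⟨ solve 4 (λ u v s t → s :* v :- t :* u := :- (u :* t :- v :* s)) refl u v (σ u) (σ v) ⟩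
      - (u * σ v - v * σ u) ∎

    σ-quad : a ≡ 0# → ∀ {y} → InF y → quad (slope y) ≡ y * (h + y * b) × σ (quad (slope y)) ≡ y * (σ h + y * σ b)
    σ-quad a≡0 {y} y∈ = quad≡ , (begin
      σ (quad (slope y))         ≡⟨ cong σ quad≡ ⟩
      σ (y * (h + y * b))        ≡⟨ trans (σ-* y _) (cong₂ _*_ y∈ (trans (σ-+ h _) (cong (σ h +_) (trans (σ-* y b) (cong (_* σ b) y∈))))) ⟩
      y * (σ h + y * σ b) ∎)
      where
      quad≡ : quad (slope y) ≡ y * (h + y * b)
      quad≡ = trans (cong (λ t → t + y * h + y * y * b) a≡0)
        (solve 3 (λ y h b → con (ℤ.+ 0) :+ y :* h :+ y :* y :* b := y :* (h :+ y :* b)) refl y h b)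

    σ-lin : ∀ {y} → InF y → σ (lin (slope y)) ≡ σ e + y * σ f
    σ-lin {y} y∈ = trans (σ-+ e _) (cong (σ e +_) (trans (σ-* y f) (cong (_* σ f) y∈)))

    special-difference : a ≡ 0# → ∀ {y} → InF y → quad (slope y) * σ (lin (slope y)) - lin (slope y) * σ (quad (slope y))
      ≡ y * (h + y * b) * (σ e + y * σ f) - (e + y * f) * (y * (σ h + y * σ b))
    special-difference a≡0 y∈ = cong₂ (λ s t → s - t)
      (cong₂ _*_ (proj₁ (σ-quad a≡0 y∈)) (σ-lin y∈)) (cong (_*_ (lin (slope _))) (proj₂ (σ-quad a≡0 y∈)))

    lin-0 : lin (slope 0#) ≡ e
    lin-0 = trans (cong (e +_) (zeroˡ f)) (+-identityʳ e)

    -- U, V and W lie on the conic; the three possible characters multiply to 1.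
    triangle : e * σ f ≢ f * σ e → a ≡ 0# → b ≡ 0# → Outcome
    triangle e∦f a≡0 b≡0 = by-specials (special-sum (σ-skew h e) (σ-skew h f) not-both
        (λ y∈ sp → trans (sym (difference y∈)) (≡⇒sub≡0 sp)) (λ y∈ eq → sub≡0⇒≡ (trans (difference y∈) eq)))
      where
      γ≡ : γ ≡ - (h * (e * f))
      γ≡ = trans (cong₂ (λ a b → a * (f * f) - h * (e * f) + b * (e * e)) a≡0 b≡0)
        (solve 3 (λ h e f → con (ℤ.+ 0) :* (f :* f) :- h :* (e :* f) :+ con (ℤ.+ 0) :* (e :* e) := :- (h :* (e :* f))) refl h e f)
      hef≢0 : h * (e * f) ≢ 0#
      hef≢0 eq = γ≢0 (trans γ≡ (trans (cong -_ eq) -0#≈0#))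
      h≢0 = *-nonzeroˡ hef≢0
      e≢0 = *-nonzeroˡ (*-nonzeroʳ hef≢0)
      f≢0 = *-nonzeroʳ (*-nonzeroʳ hef≢0)
      difference : ∀ {y} → InF y → quad (slope y) * σ (lin (slope y)) - lin (slope y) * σ (quad (slope y)) ≡ y * (skew h e + y * skew h f)
      difference {y} y∈ = begin
        _
          ≡⟨ special-difference a≡0 y∈ ⟩
        y * (h + y * b) * (σ e + y * σ f) - (e + y * f) * (y * (σ h + y * σ b))
          ≡⟨ cong₂ (λ s t → y * (h + y * s) * (σ e + y * σ f) - (e + y * f) * (y * (σ h + y * t))) b≡0 (trans (cong σ b≡0) σ-0) ⟩
        y * (h + y * 0#) * (σ e + y * σ f) - (e + y * f) * (y * (σ h + y * 0#))
          ≡⟨ solve 7 (λ y h e f h′ e′ f′ → y :* (h :+ y :* con (ℤ.+ 0)) :* (e′ :+ y :* f′) :- (e :+ y :* f) :* (y :* (h′ :+ y :* con (ℤ.+ 0)))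
               := y :* ((h :* e′ :- e :* h′) :+ y :* (h :* f′ :- f :* h′))) refl y h e f (σ h) (σ e) (σ f) ⟩
        y * (skew h e + y * skew h f) ∎
      -- The expansion of a vanishing determinant with rows (h, e, f), (h, e, f) and (σ h, σ e, σ
      -- f).
      relation : e * skew h f - f * skew h e ≡ h * skew e f
      relation = solve 6 (λ h e f h′ e′ f′ → e :* (h :* f′ :- f :* h′) :- f :* (h :* e′ :- e :* h′) := h :* (e :* f′ :- f :* e′))
        refl h e f (σ h) (σ e) (σ f)
      skew-ef≢0 : skew e f ≢ 0#
      skew-ef≢0 eq = e∦f (sub≡0⇒≡ eq)
      -- The tangent at U is h y + e z = 0 and the one at V is h x + f z = 0. If both were F-lines,
      -- `relation` would make the tangent at W an F-line too.
      not-both : ¬ (skew h e ≡ 0# × skew h f ≡ 0#)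
      not-both (t₁≡0 , t₂≡0) = *-nonzero h≢0 skew-ef≢0 (begin
        h * skew e f                    ≡⟨ sym relation ⟩
        e * skew h f - f * skew h e     ≡⟨ cong₂ (λ s t → e * s - f * t) t₂≡0 t₁≡0 ⟩
        e * 0# - f * 0#                 ≡⟨ solve 2 (λ e f → e :* con (ℤ.+ 0) :- f :* con (ℤ.+ 0) := con (ℤ.+ 0)) refl e f ⟩
        0# ∎)
      χ-negate : ∀ x → χ (- x) ≡ χ x
      χ-negate x = trans (cong χ (solve 1 (λ x → :- x := (:- con (ℤ.+ 1)) :* x) refl x))
        (trans (χ-* (- 1#) x) (trans (cong (ℤ._* χ x) χ-neg-one) (ℤₚ.*-identityˡ _)))
      χγ : ∀ x → χ (γ * x) ≡ χ (h * (e * f) * x)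
      χγ x = trans (cong (λ t → χ (t * x)) γ≡) (trans (cong χ (sym (-‿distribˡ-* _ x))) (χ-negate _))
      -- Since -1 is a square of K, γ f is h e up to squares; likewise γ e is h f.
      χγf : χ (γ * f) ≡ χ h ℤ.* χ e
      χγf = trans (χγ f) (trans (cong χ (solve 3 (λ h e f → h :* (e :* f) :* f := h :* e :* (f :* f)) refl h e f)) (trans (χ-*-square (h * e) f≢0) (χ-* h e)))
      χγe : χ (γ * lin (slope 0#)) ≡ χ h ℤ.* χ f
      χγe = trans (cong (λ t → χ (γ * t)) lin-0) (trans (χγ e)
        (trans (cong χ (solve 3 (λ h e f → h :* (e :* f) :* e := h :* f :* (e :* e)) refl h e f)) (trans (χ-*-square (h * f) e≢0) (χ-* h f))))
      -- At the third base point `relation` gives l t₂ = h `skew e f`. The ratio of the two skew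
      -- values lies in F, so l is h up to squares, and γ l is e f.
      χγl : ∀ {y} → skew h e + y * skew h f ≡ 0# → skew h f ≢ 0# → χ (γ * lin (slope y)) ≡ χ e ℤ.* χ f
      χγl {y} root t₂≢0 = begin
        χ (γ * l)                                   ≡⟨ χγ l ⟩
        χ (h * (e * f) * l)                         ≡⟨ sym (χ-*-square _ t₂≢0) ⟩
        χ (h * (e * f) * l * (t₂ * t₂))             ≡⟨ cong χ (solve 5 (λ h e f l t → h :* (e :* f) :* l :* (t :* t) := h :* (e :* f) :* (l :* t) :* t) refl h e f l t₂) ⟩
        χ (h * (e * f) * (l * t₂) * t₂)             ≡⟨ cong (λ t → χ (h * (e * f) * t * t₂)) l*t₂≡ ⟩
        χ (h * (e * f) * (h * skew e f) * t₂)       ≡⟨ cong χ (solve 5 (λ h e f d t → h :* (e :* f) :* (h :* d) :* t := e :* f :* (d :* t) :* (h :* h)) refl h e f (skew e f) t₂) ⟩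
        χ (e * f * (skew e f * t₂) * (h * h))       ≡⟨ χ-*-square _ h≢0 ⟩
        χ (e * f * (skew e f * t₂))                 ≡⟨ trans (χ-* (e * f) _) (cong (χ (e * f) ℤ.*_) (χ-proportional skew-ef≢0 t₂≢0 skew-proportional)) ⟩
        χ (e * f) ℤ.* 1ℤ                            ≡⟨ trans (ℤₚ.*-identityʳ _) (χ-* e f) ⟩
        χ e ℤ.* χ f ∎
        where
        l = lin (slope y)
        t₂ = skew h f
        l*t₂≡ : l * t₂ ≡ h * skew e f
        l*t₂≡ = begin
          (e + y * f) * t₂                              ≡⟨ solve 5 (λ e y f t s → (e :+ y :* f) :* t := e :* t :- f :* s :+ f :* (s :+ y :* t)) refl e y f t₂ (skew h e) ⟩
          e * t₂ - f * skew h e + f * (skew h e + y * t₂) ≡⟨ cong₂ _+_ relation (trans (cong (f *_) root) (zeroʳ f)) ⟩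
          h * skew e f + 0#                             ≡⟨ +-identityʳ _ ⟩
          h * skew e f ∎
        skew-proportional : skew e f * σ t₂ ≡ t₂ * σ (skew e f)
        skew-proportional = trans (cong (skew e f *_) (σ-skew h f))
          (trans (solve 2 (λ s t → s :* :- t := t :* :- s) refl (skew e f) t₂) (cong (t₂ *_) (sym (σ-skew e f))))
      count : ∀ s → ∑ F (excess ∘ slope) ≡ s →
        ℤ.+ 2 ℤ.* ℤ.+ length externals ≡ ℤ.+ q ℤ.* ℤ.+ q ℤ.+ ℤ.+ q ℤ.+ ((ℤ.+ q ℤ.* (χ h ℤ.* χ e) ℤ.- 1ℤ) ℤ.+ s)
      count s ∑≡s = trans (count-secant e∦f) (cong₂ (λ s t → ℤ.+ q ℤ.* ℤ.+ q ℤ.+ ℤ.+ q ℤ.+ (s ℤ.+ t))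
        (trans (excess-special (special-∞ b≡0)) (cong (λ t → ℤ.+ q ℤ.* t ℤ.- 1ℤ) χγf)) ∑≡s)
      two-specials : ∀ u v → ℤ.+ 2 ℤ.* ℤ.+ length externals ≡ ℤ.+ q ℤ.* ℤ.+ q ℤ.+ ℤ.+ q ℤ.+ ((ℤ.+ q ℤ.* u ℤ.- 1ℤ) ℤ.+ (ℤ.+ q ℤ.* v ℤ.- 1ℤ)) →
        u ≡ 1ℤ ⊎ v ≡ 1ℤ → u ≡ 1ℤ ⊎ u ≡ -1ℤ → v ≡ 1ℤ ⊎ v ≡ -1ℤ → Outcome
      two-specials _ _ eq _ (inj₁ refl) (inj₁ refl) = outcome ⟨2,4⟩ (trans eq
        (ℤ-solve 1 (λ q → q ⊗ q ⊕ q ⊕ ((q ⊗ ℤ-con 1ℤ ⊖ ℤ-con 1ℤ) ⊕ (q ⊗ ℤ-con 1ℤ ⊖ ℤ-con 1ℤ)) ⊜ q ⊗ q ⊕ ℤ-con (ℤ.+ 3) ⊗ q ⊖ ℤ-con (ℤ.+ 2)) refl (ℤ.+ q)))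
      two-specials _ _ eq _ (inj₁ refl) (inj₂ refl) = outcome ⟨2,2⟩ (trans eq
        (ℤ-solve 1 (λ q → q ⊗ q ⊕ q ⊕ ((q ⊗ ℤ-con 1ℤ ⊖ ℤ-con 1ℤ) ⊕ (q ⊗ ℤ-con -1ℤ ⊖ ℤ-con 1ℤ)) ⊜ q ⊗ q ⊕ ℤ-con (ℤ.+ 1) ⊗ q ⊖ ℤ-con (ℤ.+ 2)) refl (ℤ.+ q)))
      two-specials _ _ eq _ (inj₂ refl) (inj₁ refl) = outcome ⟨2,2⟩ (trans eq
        (ℤ-solve 1 (λ q → q ⊗ q ⊕ q ⊕ ((q ⊗ ℤ-con -1ℤ ⊖ ℤ-con 1ℤ) ⊕ (q ⊗ ℤ-con 1ℤ ⊖ ℤ-con 1ℤ)) ⊜ q ⊗ q ⊕ ℤ-con (ℤ.+ 1) ⊗ q ⊖ ℤ-con (ℤ.+ 2)) refl (ℤ.+ q)))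
      two-specials _ _ eq (inj₁ ()) (inj₂ refl) (inj₂ refl)
      two-specials _ _ eq (inj₂ ()) (inj₂ refl) (inj₂ refl)
      three-specials : ∀ x y z → ℤ.+ 2 ℤ.* ℤ.+ length externals ≡
          ℤ.+ q ℤ.* ℤ.+ q ℤ.+ ℤ.+ q ℤ.+ ((ℤ.+ q ℤ.* (x ℤ.* y) ℤ.- 1ℤ) ℤ.+ ((ℤ.+ q ℤ.* (x ℤ.* z) ℤ.- 1ℤ) ℤ.+ (ℤ.+ q ℤ.* (y ℤ.* z) ℤ.- 1ℤ))) →
        x ℤ.* y ℤ.+ x ℤ.* z ℤ.+ y ℤ.* z ≡ ℤ.+ 3 ⊎ x ℤ.* y ℤ.+ x ℤ.* z ℤ.+ y ℤ.* z ≡ -1ℤ → Outcome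
      three-specials x y z eq (inj₁ sum≡) = outcome ⟨3,5⟩ (trans eq (trans
        (ℤ-solve 4 (λ q u v w → q ⊗ q ⊕ q ⊕ ((q ⊗ u ⊖ ℤ-con 1ℤ) ⊕ ((q ⊗ v ⊖ ℤ-con 1ℤ) ⊕ (q ⊗ w ⊖ ℤ-con 1ℤ)))
          ⊜ q ⊗ q ⊕ (ℤ-con 1ℤ ⊕ (u ⊕ v ⊕ w)) ⊗ q ⊖ ℤ-con (ℤ.+ 3)) refl (ℤ.+ q) (x ℤ.* y) (x ℤ.* z) (y ℤ.* z))
        (cong (λ t → ℤ.+ q ℤ.* ℤ.+ q ℤ.+ (1ℤ ℤ.+ t) ℤ.* ℤ.+ q ℤ.- ℤ.+ 3) sum≡)))
      three-specials x y z eq (inj₂ sum≡) = outcome ⟨3,1⟩ (trans eq (trans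
        (ℤ-solve 4 (λ q u v w → q ⊗ q ⊕ q ⊕ ((q ⊗ u ⊖ ℤ-con 1ℤ) ⊕ ((q ⊗ v ⊖ ℤ-con 1ℤ) ⊕ (q ⊗ w ⊖ ℤ-con 1ℤ)))
          ⊜ q ⊗ q ⊕ (ℤ-con 1ℤ ⊕ (u ⊕ v ⊕ w)) ⊗ q ⊖ ℤ-con (ℤ.+ 3)) refl (ℤ.+ q) (x ℤ.* y) (x ℤ.* z) (y ℤ.* z))
        (cong (λ t → ℤ.+ q ℤ.* ℤ.+ q ℤ.+ (1ℤ ℤ.+ t) ℤ.* ℤ.+ q ℤ.- ℤ.+ 3) sum≡)))
      -- The product of x y, x z and y z is a square, so either none or exactly two of the three are
      -- -1. Added to 1 the sum is α - 1, whence α is 5 or 1.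
      sign-sum : ∀ {x y z} → x ≡ 1ℤ ⊎ x ≡ -1ℤ → y ≡ 1ℤ ⊎ y ≡ -1ℤ → z ≡ 1ℤ ⊎ z ≡ -1ℤ →
        x ℤ.* y ℤ.+ x ℤ.* z ℤ.+ y ℤ.* z ≡ ℤ.+ 3 ⊎ x ℤ.* y ℤ.+ x ℤ.* z ℤ.+ y ℤ.* z ≡ -1ℤ
      sign-sum (inj₁ refl) (inj₁ refl) (inj₁ refl) = inj₁ refl
      sign-sum (inj₁ refl) (inj₁ refl) (inj₂ refl) = inj₂ refl
      sign-sum (inj₁ refl) (inj₂ refl) (inj₁ refl) = inj₂ refl
      sign-sum (inj₁ refl) (inj₂ refl) (inj₂ refl) = inj₂ refl
      sign-sum (inj₂ refl) (inj₁ refl) (inj₁ refl) = inj₂ refl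
      sign-sum (inj₂ refl) (inj₁ refl) (inj₂ refl) = inj₂ refl
      sign-sum (inj₂ refl) (inj₂ refl) (inj₁ refl) = inj₂ refl
      sign-sum (inj₂ refl) (inj₂ refl) (inj₂ refl) = inj₁ refl
      sign-* : ∀ {u v} → u ≢ 0# → v ≢ 0# → χ u ℤ.* χ v ≡ 1ℤ ⊎ χ u ℤ.* χ v ≡ -1ℤ
      sign-* {u} {v} u≢0 v≢0 = subst (λ t → t ≡ 1ℤ ⊎ t ≡ -1ℤ) (χ-* u v) (χ-±1 (*-nonzero u≢0 v≢0))
      proportional : ∀ {u v} → u ≢ 0# → v ≢ 0# → skew u v ≡ 0# → χ u ℤ.* χ v ≡ 1ℤ
      proportional {u} {v} u≢0 v≢0 eq = trans (sym (χ-* u v)) (χ-proportional u≢0 v≢0 (sub≡0⇒≡ eq))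
      -- An F-line as tangent at U puts h / e in F, which makes the sign of V equal to 1; with the
      -- tangent at V the roles are exchanged. So the two signs are never both -1.
      degenerate : skew h e ≡ 0# ⊎ skew h f ≡ 0# → χ h ℤ.* χ e ≡ 1ℤ ⊎ χ h ℤ.* χ f ≡ 1ℤ
      degenerate (inj₁ eq) = inj₁ (proportional h≢0 e≢0 eq)
      degenerate (inj₂ eq) = inj₂ (proportional h≢0 f≢0 eq)
      by-specials : _ → Outcome
      by-specials (inj₁ (degen , ∑≡)) = two-specials (χ h ℤ.* χ e) (χ h ℤ.* χ f)
        (count _ (trans ∑≡ (cong (λ t → ℤ.+ q ℤ.* t ℤ.- 1ℤ) χγe))) (degenerate degen) (sign-* h≢0 e≢0) (sign-* h≢0 f≢0)
      by-specials (inj₂ (y , root , t₂≢0 , ∑≡)) = three-specials (χ h) (χ e) (χ f)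
        (count _ (trans ∑≡ (cong₂ (λ s t → (ℤ.+ q ℤ.* s ℤ.- 1ℤ) ℤ.+ (ℤ.+ q ℤ.* t ℤ.- 1ℤ)) χγe (χγl root t₂≢0))))
        (sign-sum (χ-±1 h≢0) (χ-±1 e≢0) (χ-±1 f≢0))

    tangent⇒e≢0 : f ≡ 0# → e ≢ 0#
    tangent⇒e≢0 f≡0 e≡0 = γ≢0 (trans (cong₂ (λ e f → a * (f * f) - h * (e * f) + b * (e * e)) e≡0 f≡0)
      (solve 3 (λ a h b → let o = con (ℤ.+ 0) in a :* (o :* o) :- h :* (o :* o) :+ b :* (o :* o) := o) refl a h b))

    tangent-lin : f ≡ 0# → ∀ y → lin (slope y) ≡ e
    tangent-lin f≡0 y = trans (cong (λ t → e + y * t) f≡0) (trans (cong (e +_) (zeroʳ y)) (+-identityʳ e))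

    -- No base point restricts the common sign of the lines here: 1 gives q² + q, and -1 gives q² +
    -- 3 q.
    tangent-none : f ≡ 0# → (∀ {y} → InF y → ¬ Special (slope y)) → Outcome
    tangent-none f≡0 ¬slope = by-sign (χ-±1 (*-nonzero γ≢0 (tangent⇒e≢0 f≡0)))
      where
      count : ∀ v → χ (γ * e) ≡ v → ℤ.+ 2 ℤ.* ℤ.+ length externals ≡ ℤ.+ q ℤ.* ℤ.+ 2 ℤ.+ (ℤ.+ q ℤ.* (ℤ.+ q ℤ.- v) ℤ.+ 0ℤ)
      count _ refl = trans (count-tangent f≡0) (cong (λ t → ℤ.+ q ℤ.* ℤ.+ 2 ℤ.+ (ℤ.+ q ℤ.* (ℤ.+ q ℤ.- χ (γ * e)) ℤ.+ t))
        (∑-excess [] [] (λ ()) (λ y∈ sp → contradiction sp (¬slope y∈))))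
      by-sign : χ (γ * e) ≡ 1ℤ ⊎ χ (γ * e) ≡ -1ℤ → Outcome
      by-sign (inj₁ χ≡1) = outcome ⟨0,2⟩ (trans (count _ χ≡1)
        (ℤ-solve 1 (λ q → q ⊗ ℤ-con (ℤ.+ 2) ⊕ (q ⊗ (q ⊖ ℤ-con 1ℤ) ⊕ ℤ-con 0ℤ) ⊜ q ⊗ q ⊕ ℤ-con (ℤ.+ 1) ⊗ q ⊖ ℤ-con 0ℤ) refl (ℤ.+ q)))
      by-sign (inj₂ χ≡-1) = outcome ⟨0,4⟩ (trans (count _ χ≡-1)
        (ℤ-solve 1 (λ q → q ⊗ ℤ-con (ℤ.+ 2) ⊕ (q ⊗ (q ⊖ ℤ-con -1ℤ) ⊕ ℤ-con 0ℤ) ⊜ q ⊗ q ⊕ ℤ-con (ℤ.+ 3) ⊗ q ⊖ ℤ-con 0ℤ) refl (ℤ.+ q)))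

    -- If both coefficients vanish, Q / e takes values in F at all F-points, in particular at those that determine its coefficients.
    proportional-coefficients⇒defined : f ≡ 0# → a ≡ 0# → skew h e ≡ 0# → skew b e ≡ 0# → DefinedOverFq C
    proportional-coefficients⇒defined f≡0 a≡0 skew-h skew-b =
      e ⁻¹ , ⁻¹-nonzero e≢0 , coefficient e₁∈ coefficient-a , coefficient e₂∈ coefficient-b , coefficient e₃∈ coefficient-c ,
      mixed (InF3-combine σ-1 e₁∈ σ-1 e₂∈) e₁∈ e₂∈ coefficient-d ,
      mixed (InF3-combine σ-1 e₁∈ σ-1 e₃∈) e₁∈ e₃∈ coefficient-e ,
      mixed (InF3-combine σ-1 e₂∈ σ-1 e₃∈) e₂∈ e₃∈ coefficient-f
      where
      e≢0 = tangent⇒e≢0 f≡0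
      h/e∈ : InF (h * e ⁻¹)
      h/e∈ = proportional⇒InF e≢0 (sub≡0⇒≡ skew-h)
      b/e∈ : InF (b * e ⁻¹)
      b/e∈ = proportional⇒InF e≢0 (sub≡0⇒≡ skew-b)
      value∈ : ∀ {X} → InF3 X → InF (e ⁻¹ * Q X)
      value∈ {X} X∈ = let x , y , z , x∈ , y∈ , z∈ , X≡ = span-coordinates X∈ in
        subst InF (sym (begin
          e ⁻¹ * Q X
            ≡⟨ cong (λ X → e ⁻¹ * Q X) X≡ ⟩
          e ⁻¹ * Q (span x U y V z W)
            ≡⟨ cong (e ⁻¹ *_) (Q-span QW≡0 x U y V z) ⟩
          e ⁻¹ * ((x * x * a + x * y * h + y * y * b) + z * (x * e + y * f))
            ≡⟨ cong₂ (λ a f → e ⁻¹ * ((x * x * a + x * y * h + y * y * b) + z * (x * e + y * f))) a≡0 f≡0 ⟩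
          e ⁻¹ * ((x * x * 0# + x * y * h + y * y * b) + z * (x * e + y * 0#))
            ≡⟨ solve 7 (λ i x y z h b e → let o = con (ℤ.+ 0) in i :* ((x :* x :* o :+ x :* y :* h :+ y :* y :* b) :+ z :* (x :* e :+ y :* o))
                 := x :* y :* (h :* i) :+ y :* y :* (b :* i) :+ z :* x :* (e :* i)) refl (e ⁻¹) x y z h b e ⟩
          x * y * (h * e ⁻¹) + y * y * (b * e ⁻¹) + z * x * (e * e ⁻¹)
            ≡⟨ cong (λ t → x * y * (h * e ⁻¹) + y * y * (b * e ⁻¹) + z * x * t) (*-inverseʳ e≢0) ⟩
          x * y * (h * e ⁻¹) + y * y * (b * e ⁻¹) + z * x * 1# ∎))
          (InF-+ (InF-+ (InF-* (InF-* x∈ y∈) h/e∈) (InF-* (InF-* y∈ y∈) b/e∈)) (InF-* (InF-* z∈ x∈) σ-1))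
      coefficient : ∀ {X t} → InF3 X → Q X ≡ t → Geometry.SubGeometry.InFq K q (e ⁻¹ * t)
      coefficient X∈ refl = trans (power≡ _ q) (value∈ X∈)
      mixed : ∀ {X Y Z t} → InF3 X → InF3 Y → InF3 Z → Q X - Q Y - Q Z ≡ t → Geometry.SubGeometry.InFq K q (e ⁻¹ * t)
      mixed {X} {Y} {Z} X∈ Y∈ Z∈ refl = trans (power≡ _ q) (subst InF
        (solve 4 (λ i x y z → i :* x :- i :* y :- i :* z := i :* (x :- y :- z)) refl (e ⁻¹) (Q X) (Q Y) (Q Z))
        (InF-sub (InF-sub (value∈ X∈) (value∈ Y∈)) (value∈ Z∈)))

    tangent-base-point : ¬ DefinedOverFq C → f ≡ 0# → a ≡ 0# → Outcome
    tangent-base-point not-defined f≡0 a≡0 = by-specials (χ-±1 (*-nonzero γ≢0 e≢0)) (special-sum (σ-skew h e) (σ-skew b e)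
        -- Here the conic not being defined over F bounds the base points: the polynomial y (t₁ + y
        -- t₂) is not identically zero.
        (λ (skew-h , skew-b) → not-defined (proportional-coefficients⇒defined f≡0 a≡0 skew-h skew-b))
        (λ y∈ sp → trans (sym (difference y∈)) (≡⇒sub≡0 sp)) (λ y∈ eq → sub≡0⇒≡ (trans (difference y∈) eq)))
      where
      e≢0 = tangent⇒e≢0 f≡0
      difference : ∀ {y} → InF y → quad (slope y) * σ (lin (slope y)) - lin (slope y) * σ (quad (slope y)) ≡ y * (skew h e + y * skew b e)
      difference {y} y∈ = begin
        _
          ≡⟨ special-difference a≡0 y∈ ⟩
        y * (h + y * b) * (σ e + y * σ f) - (e + y * f) * (y * (σ h + y * σ b))
          ≡⟨ cong₂ (λ s t → y * (h + y * b) * (σ e + y * t) - (e + y * s) * (y * (σ h + y * σ b))) f≡0 (trans (cong σ f≡0) σ-0) ⟩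
        y * (h + y * b) * (σ e + y * 0#) - (e + y * 0#) * (y * (σ h + y * σ b))
          ≡⟨ solve 7 (λ y h e b h′ e′ b′ → y :* (h :+ y :* b) :* (e′ :+ y :* con (ℤ.+ 0)) :- (e :+ y :* con (ℤ.+ 0)) :* (y :* (h′ :+ y :* b′))
               := y :* ((h :* e′ :- e :* h′) :+ y :* (b :* e′ :- e :* b′))) refl y h e b (σ h) (σ e) (σ b) ⟩
        y * (skew h e + y * skew b e) ∎
      c = χ (γ * e)
      χ-slope : ∀ y → χ (γ * lin (slope y)) ≡ c
      χ-slope y = cong (λ t → χ (γ * t)) (tangent-lin f≡0 y)
      count : ∀ v s → c ≡ v → ∑ F (excess ∘ slope) ≡ s →
        ℤ.+ 2 ℤ.* ℤ.+ length externals ≡ ℤ.+ q ℤ.* ℤ.+ 2 ℤ.+ (ℤ.+ q ℤ.* (ℤ.+ q ℤ.- v) ℤ.+ s)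
      count _ _ refl ∑≡s = trans (count-tangent f≡0) (cong (λ t → ℤ.+ q ℤ.* ℤ.+ 2 ℤ.+ (ℤ.+ q ℤ.* (ℤ.+ q ℤ.- c) ℤ.+ t)) ∑≡s)
      one′ two′ : ℤ → ℤ
      one′ v = ℤ.+ q ℤ.* v ℤ.- 1ℤ
      two′ v = one′ v ℤ.+ one′ v
      by-specials : c ≡ 1ℤ ⊎ c ≡ -1ℤ → _ → Outcome
      -- With a single further base point its q c cancels the q terms -c of the lines, so that both
      -- signs lead to the same count.
      by-specials _ (inj₁ (_ , ∑≡)) = outcome ⟨1,3⟩ (trans (count c (one′ c) refl (trans ∑≡ (cong one′ (χ-slope 0#))))
        (ℤ-solve 2 (λ q c → q ⊗ ℤ-con (ℤ.+ 2) ⊕ (q ⊗ (q ⊖ c) ⊕ (q ⊗ c ⊖ ℤ-con 1ℤ)) ⊜ q ⊗ q ⊕ ℤ-con (ℤ.+ 2) ⊗ q ⊖ ℤ-con 1ℤ) refl (ℤ.+ q) c))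
      by-specials (inj₁ c≡1) (inj₂ (y , _ , _ , ∑≡)) = outcome ⟨2,4⟩ (trans
        (count 1ℤ (two′ 1ℤ) c≡1 (trans ∑≡ (cong₂ (λ s t → one′ s ℤ.+ one′ t) (trans (χ-slope 0#) c≡1) (trans (χ-slope y) c≡1))))
        (ℤ-solve 1 (λ q → q ⊗ ℤ-con (ℤ.+ 2) ⊕ (q ⊗ (q ⊖ ℤ-con 1ℤ) ⊕ ((q ⊗ ℤ-con 1ℤ ⊖ ℤ-con 1ℤ) ⊕ (q ⊗ ℤ-con 1ℤ ⊖ ℤ-con 1ℤ)))
          ⊜ q ⊗ q ⊕ ℤ-con (ℤ.+ 3) ⊗ q ⊖ ℤ-con (ℤ.+ 2)) refl (ℤ.+ q)))
      by-specials (inj₂ c≡-1) (inj₂ (y , _ , _ , ∑≡)) = outcome ⟨2,2⟩ (trans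
        (count -1ℤ (two′ -1ℤ) c≡-1 (trans ∑≡ (cong₂ (λ s t → one′ s ℤ.+ one′ t) (trans (χ-slope 0#) c≡-1) (trans (χ-slope y) c≡-1))))
        (ℤ-solve 1 (λ q → q ⊗ ℤ-con (ℤ.+ 2) ⊕ (q ⊗ (q ⊖ ℤ-con -1ℤ) ⊕ ((q ⊗ ℤ-con -1ℤ ⊖ ℤ-con 1ℤ) ⊕ (q ⊗ ℤ-con -1ℤ ⊖ ℤ-con 1ℤ)))
          ⊜ q ⊗ q ⊕ ℤ-con (ℤ.+ 1) ⊗ q ⊖ ℤ-con (ℤ.+ 2)) refl (ℤ.+ q)))

  module _ (not-defined : ¬ DefinedOverFq C) where

    tangent-outcome : ∀ Fr → FrameTheory.f Fr ≡ 0# → Outcome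
    tangent-outcome Fr f≡0 = search find-special
      where
      open FrameTheory Fr
      open Reframed Fr
      search : SpecialSearch → Outcome
      search (inj₂ none) = tangent-none f≡0 none
      search (inj₁ (y , y∈ , sp)) =
        let Fr′ , a≡0 , _ , _ , f≡ = base-point-shear y∈ (λ l≡0 → tangent⇒e≢0 f≡0 (trans (sym (tangent-lin f≡0 y)) l≡0)) sp in
        Reframed.tangent-base-point Fr′ not-defined (trans f≡ f≡0) a≡0

    Secant : Frame → Set
    Secant Fr = e * σ f ≢ f * σ e
      where
      open FrameTheory Fr

    base-point-at-U : ∀ Fr → Secant Fr → (y : Carrier) → InF y → FrameTheory.Special Fr (slope y) →
      ∃[ Fr′ ] (Secant Fr′ × FrameTheory.a Fr′ ≡ 0# × FrameTheory.b Fr′ ≡ FrameTheory.b Fr)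
    base-point-at-U Fr e∦f y y∈ sp =
      let Fr′ , a≡0 , b≡ , e≡ , f≡ = base-point-shear y∈ (secant-slope≢0 e∦f y∈) sp in
      Fr′ , (λ eq → secant-shear e∦f y∈ (trans (cong₂ (λ s t → s * σ t) (sym e≡) (sym f≡))
        (trans eq (cong₂ (λ s t → t * σ s) e≡ f≡)))) , a≡0 , b≡
      where
      open Reframed Fr

    -- With V on the conic the direction `∞` is special. A further base point can be sheared to U
    -- without moving V, which produces an inscribed triangle.
    secant-outcome-at-V : ∀ Fr → Secant Fr → FrameTheory.b Fr ≡ 0# → Reframed.SpecialSearch Fr → Outcome
    secant-outcome-at-V Fr e∦f b≡0 (inj₂ none) = Reframed.secant-one Fr e∦f (Reframed.special-∞ Fr b≡0) none
    secant-outcome-at-V Fr e∦f b≡0 (inj₁ (y , y∈ , sp)) = let Fr₂ , e∦f₂ , a≡0 , b≡ = base-point-at-U Fr e∦f y y∈ sp in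
      Reframed.triangle Fr₂ e∦f₂ a≡0 (trans b≡ b≡0)

    -- The shear acts only on U. A base point found there is therefore swapped to V, which frees the
    -- first place for the next search.
    secant-outcome : ∀ Fr → Secant Fr → Outcome
    secant-outcome Fr e∦f = search (Reframed.find-special Fr)
      where
      search : Reframed.SpecialSearch Fr → Outcome
      search (inj₂ none) = search-∞ (FrameTheory.special? Fr ∞)
        where
        search-∞ : Dec (FrameTheory.Special Fr ∞) → Outcome
        search-∞ (yes sp) = Reframed.secant-one Fr e∦f sp none
        search-∞ (no ¬sp) = Reframed.secant-none Fr e∦f ¬sp none
      search (inj₁ (y , y∈ , sp)) = let Fr₁ , e∦f₁ , a≡0 , _ = base-point-at-U Fr e∦f y y∈ sp in
        secant-outcome-at-V (swap Fr₁) (λ eq → e∦f₁ (sym eq)) a≡0 (Reframed.find-special (swap Fr₁))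

    -- If the tangent at W is an F-line, choose V on it.
    frame-outcome : Frame → Outcome
    frame-outcome Fr = choose (e * σ f ≟ f * σ e) (≡0? f)
      where
      open FrameTheory Fr
      open Frame Fr
      choose : Dec (e * σ f ≡ f * σ e) → f ≡ 0# ⊎ f ≢ 0# → Outcome
      choose (no e∦f) _ = secant-outcome Fr e∦f
      choose (yes _) (inj₁ f≡0) = tangent-outcome Fr f≡0
      -- For y = -e / f, an element of F, the vector U + y V is orthogonal to W; the swap makes it
      -- the new V.
      choose (yes e∥f) (inj₂ f≢0) = tangent-outcome (swap (shear Fr y∈ σ-0)) (begin
        B (span 1# U y V 0# W) W       ≡⟨ B-spanˡ QW≡0 1# U y V 0# ⟩
        1# * e + y * f                 ≡⟨ solve 3 (λ e i f → con (ℤ.+ 1) :* e :+ :- (e :* i) :* f := e :- e :* (f :* i)) refl e (f ⁻¹) f ⟩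
        e - e * (f * f ⁻¹)             ≡⟨ cong (λ t → e - e * t) (*-inverseʳ f≢0) ⟩
        e - e * 1#                     ≡⟨ solve 1 (λ e → e :- e :* con (ℤ.+ 1) := con (ℤ.+ 0)) refl e ⟩
        0# ∎)
        where
        y = - (e * f ⁻¹)
        y∈ : InF y
        y∈ = InF-neg (proportional⇒InF f≢0 e∥f)

    classification : ContainsFqPoint C → Outcome
    classification (P , P∈ , QP≡0) = frame-outcome (frame-at (proj₁ P∈) (FqPoint⇒InF3 P∈) QP≡0)

-- From admissible pairs to the values in the theorem

open import Data.Nat using (ℕ; _*_; _^_; _<_; _≤_)
open import Data.Integer as ℤ using (ℤ; +_)
open import Data.Integer.Divisibility using () renaming (_∣_ to _∣ℤ_)

-- For numerals q, n₀ and α the counting formula evaluates to a literal `+ (2 * c)`, so the tables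
-- below need only name c and its place in the list.
half≡ : ∀ {m} c → + 2 ℤ.* + m ≡ + (2 * c) → m ≡ c
half≡ {m} c eq = ℕₚ.*-cancelˡ-≡ m c 2 (ℤₚ.+-injective (trans (ℤₚ.pos-* 2 m) eq))

admissible-3 : ∀ {m n₀ α} → Admissible n₀ α → + 2 ℤ.* + m ≡ + 3 ℤ.* + 3 ℤ.+ (+ α ℤ.- + 1) ℤ.* + 3 ℤ.- + n₀ →
  m ∈ 3 ∷ 4 ∷ 5 ∷ 6 ∷ 7 ∷ 8 ∷ 9 ∷ []
admissible-3 ⟨0,2⟩ eq = there (there (there (here (half≡ 6 eq))))
admissible-3 ⟨0,4⟩ eq = there (there (there (there (there (there (here (half≡ 9 eq)))))))
admissible-3 ⟨1,1⟩ eq = there (here (half≡ 4 eq))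
admissible-3 ⟨1,3⟩ eq = there (there (there (there (here (half≡ 7 eq)))))
admissible-3 ⟨2,2⟩ eq = there (there (here (half≡ 5 eq)))
admissible-3 ⟨2,4⟩ eq = there (there (there (there (there (here (half≡ 8 eq))))))
admissible-3 ⟨3,1⟩ eq = here (half≡ 3 eq)
admissible-3 ⟨3,5⟩ eq = there (there (there (there (there (there (here (half≡ 9 eq)))))))

admissible-5 : ∀ {m n₀ α} → Admissible n₀ α → + 2 ℤ.* + m ≡ + 5 ℤ.* + 5 ℤ.+ (+ α ℤ.- + 1) ℤ.* + 5 ℤ.- + n₀ →
  m ∈ 11 ∷ 12 ∷ 14 ∷ 15 ∷ 16 ∷ 17 ∷ 19 ∷ 20 ∷ 21 ∷ 22 ∷ 25 ∷ []
admissible-5 ⟨0,2⟩ eq = there (there (there (here (half≡ 15 eq))))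
admissible-5 ⟨0,4⟩ eq = there (there (there (there (there (there (there (here (half≡ 20 eq))))))))
admissible-5 ⟨1,1⟩ eq = there (here (half≡ 12 eq))
admissible-5 ⟨1,3⟩ eq = there (there (there (there (there (here (half≡ 17 eq))))))
admissible-5 ⟨2,2⟩ eq = there (there (here (half≡ 14 eq)))
admissible-5 ⟨2,4⟩ eq = there (there (there (there (there (there (here (half≡ 19 eq)))))))
admissible-5 ⟨3,1⟩ eq = here (half≡ 11 eq)
admissible-5 ⟨3,5⟩ eq = there (there (there (there (there (there (there (there (here (half≡ 21 eq)))))))))

-- Divisibility in ℤ is divisibility of absolute values; hence the quotient 1 for n₀ = 3, α = 1,
-- where the difference is -2.
admissible-range : ∀ {n₀ α} → Admissible n₀ α →
  n₀ ∈ 0 ∷ 1 ∷ 2 ∷ 3 ∷ [] × α ∈ 1 ∷ 2 ∷ 3 ∷ 4 ∷ 5 ∷ 7 ∷ [] × (+ 2) ∣ℤ (+ α ℤ.- + n₀)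
admissible-range ⟨0,2⟩ = here refl , there (here refl) , ℕ∣.divides 1 refl
admissible-range ⟨0,4⟩ = here refl , there (there (there (here refl))) , ℕ∣.divides 2 refl
admissible-range ⟨1,1⟩ = there (here refl) , here refl , ℕ∣.divides 0 refl
admissible-range ⟨1,3⟩ = there (here refl) , there (there (here refl)) , ℕ∣.divides 1 refl
admissible-range ⟨2,2⟩ = there (there (here refl)) , there (here refl) , ℕ∣.divides 0 refl
admissible-range ⟨2,4⟩ = there (there (here refl)) , there (there (there (here refl))) , ℕ∣.divides 1 refl
admissible-range ⟨3,1⟩ = there (there (there (here refl))) , here refl , ℕ∣.divides 1 refl
admissible-range ⟨3,5⟩ = there (there (there (here refl))) , there (there (there (there (here refl)))) , ℕ∣.divides 1 refl

theorem1p2 : (p k q : ℕ) → Prime p → p ≢ 2 → 1 ≤ k → q ≡ p ^ k →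
    (K : FiniteField) → FiniteField.size K ≡ q * q →
    (C : Geometry.Conic K) → Geometry.Irreducible K C →
    ¬ Geometry.SubGeometry.DefinedOverFq K q C →
    Geometry.SubGeometry.ContainsFqPoint K q C →
    ∃[ m ] (Geometry.SubGeometry.ExtCount K q C m ×
    (q ≡ 3 → m ∈ (3 ∷ 4 ∷ 5 ∷ 6 ∷ 7 ∷ 8 ∷ 9 ∷ [])) ×
    (q ≡ 5 → m ∈ (11 ∷ 12 ∷ 14 ∷ 15 ∷ 16 ∷ 17 ∷ 19 ∷ 20 ∷ 21 ∷ 22 ∷ 25 ∷ [])) ×
    (5 < q → ∃[ n₀ ] ∃[ α ] (n₀ ∈ (0 ∷ 1 ∷ 2 ∷ 3 ∷ []) ×
    α ∈ (1 ∷ 2 ∷ 3 ∷ 4 ∷ 5 ∷ 7 ∷ []) ×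
    (+ 2) ∣ℤ (+ α ℤ.- + n₀) ×
    (+ 2) ℤ.* (+ m) ≡ (+ q) ℤ.* (+ q) ℤ.+ (+ α ℤ.- + 1) ℤ.* (+ q) ℤ.- + n₀)))
theorem1p2 p k q p-prime p≢2 _ q≡p^k K size≡q*q C irreducible not-defined contains =
  let m , count , n₀ , α , admissible , eq =
        Classification.classification K p k q p-prime p≢2 q≡p^k size≡q*q C irreducible not-defined contains
      n₀∈ , α∈ , parity = admissible-range admissible
  in m , count ,
     (λ { refl → admissible-3 admissible eq }) ,
     (λ { refl → admissible-5 admissible eq }) ,
     (λ _ → n₀ , α , n₀∈ , α∈ , parity , eq)
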